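{- Every double spider is strongly antimagic.
   Context: A double spider is a tree containing exactly two vertices of degree greater than 2. For a graph $G=(V,E)$ and a bijection $f:E\to\{1,2,\dots,|E|\}$, the vertex-sum at $u$ is $\varphi_f(u)=\sum_{e\in E(u)}f(e)$, where $E(u)$ is the set of edges incident to $u$. The bijection $f$ is a strongly antimagic labeling if $\varphi_f(u)\neq\varphi_f(v)$ for all distinct vertices $u,v$, and moreover $\varphi_f(u)<\varphi_f(v)$ whenever $\deg(u)<\deg(v)$. A graph is strongly antimagic if it has a strongly antimagic labeling. -}

module Defs where

open import Data.Nat using (ℕ; zero; suc; _+_; _<_)
open import Data.Fin using (Fin; zero; suc; toℕ; inject₁; fromℕ; _≟_)
open import Data.Product using (_×_; _,_; proj₁; proj₂; Σ; ∃; ∃-syntax)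
open import Data.Sum using (_⊎_)
open import Relation.Binary.PropositionalEquality using (_≡_; _≢_)
open import Relation.Nullary using (¬_; Dec; yes; no)
open import Relation.Nullary.Decidable using (_⊎-dec_)
open import Function.Bundles using (_⤖_; Bijection)
open import Function.Definitions using (Injective)

record Graph : Set where
  field
    n    : ℕ
    m    : ℕ
    ends : Fin m → Fin n × Fin n

open Graph public

IsSimple : Graph → Set
IsSimple G =
  (∀ e → proj₁ (ends G e) ≢ proj₂ (ends G e)) ×
  (∀ e e' → (ends G e ≡ ends G e' ⊎ ends G e ≡ (proj₂ (ends G e') , proj₁ (ends G e'))) → e ≡ e')

Incident : (G : Graph) → Fin (n G) → Fin (m G) → Set
Incident G u e = proj₁ (ends G e) ≡ u ⊎ proj₂ (ends G e) ≡ u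

incident? : (G : Graph) → (u : Fin (n G)) → (e : Fin (m G)) → Dec (Incident G u e)
incident? G u e = (proj₁ (ends G e) ≟ u) ⊎-dec (proj₂ (ends G e) ≟ u)

sumFin : (k : ℕ) → (Fin k → ℕ) → ℕ
sumFin zero    f = 0
sumFin (suc k) f = f zero + sumFin k (λ i → f (suc i))

incSum : (G : Graph) → (Fin (m G) → ℕ) → Fin (n G) → ℕ
incSum G w u = sumFin (m G) (λ e → val (incident? G u e) (w e))
  where
  val : ∀ {P : Set} → Dec P → ℕ → ℕ
  val (yes _) x = x
  val (no _)  _ = 0

degree : (G : Graph) → Fin (n G) → ℕ
degree G = incSum G (λ _ → 1)

Adj : (G : Graph) → Fin (n G) → Fin (n G) → Set
Adj G u v = ∃[ e ] (ends G e ≡ (u , v) ⊎ ends G e ≡ (v , u))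

data Reach (G : Graph) : Fin (n G) → Fin (n G) → Set where
  here : ∀ {u} → Reach G u u
  step : ∀ {u v w} → Adj G u v → Reach G v w → Reach G u w

Connected : Graph → Set
Connected G = ∀ u v → Reach G u v

HasCycle : Graph → Set
HasCycle G =
  Σ ℕ λ k → Σ (Fin (suc (suc (suc k))) → Fin (n G)) λ vs →
    Injective _≡_ _≡_ vs ×
    (∀ (i : Fin (suc (suc k))) → Adj G (vs (inject₁ i)) (vs (suc i))) ×
    Adj G (vs (fromℕ (suc (suc k)))) (vs zero)

IsTree : Graph → Set
IsTree G = IsSimple G × (0 < n G) × Connected G × ¬ HasCycle G

IsDoubleSpider : Graph → Set
IsDoubleSpider G =
  IsTree G ×
  Σ (Fin (n G)) λ u → Σ (Fin (n G)) λ v →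
    u ≢ v × 2 < degree G u × 2 < degree G v ×
    (∀ w → 2 < degree G w → w ≡ u ⊎ w ≡ v)

-- a bijection f : E → {1,…,|E|}, encoded as a bijection Fin m ⤖ Fin m with
-- label e = toℕ (f e) + 1
labelOf : (G : Graph) → (Fin (m G) ⤖ Fin (m G)) → Fin (m G) → ℕ
labelOf G f e = suc (toℕ (Bijection.to f e))

vertexSum : (G : Graph) → (Fin (m G) ⤖ Fin (m G)) → Fin (n G) → ℕ
vertexSum G f = incSum G (labelOf G f)

IsStronglyAntimagicLabeling : (G : Graph) → (Fin (m G) ⤖ Fin (m G)) → Set
IsStronglyAntimagicLabeling G f =
  (∀ u v → u ≢ v → vertexSum G f u ≢ vertexSum G f v) ×
  (∀ u v → degree G u < degree G v → vertexSum G f u < vertexSum G f v)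

StronglyAntimagic : Graph → Set
StronglyAntimagic G = Σ (Fin (m G) ⤖ Fin (m G)) (IsStronglyAntimagicLabeling G)

{-# OPTIONS --safe #-}
module Submission where

-- Let u and v be the hubs, with deg v ≤ deg u. Call the labels up to a bound P small and the others large,
-- and suppose that all pendant labels are small and that every vertex of degree two meets a large label.
-- A new leg or core that alternates between the lowest small and the lowest large labels has consecutive
-- sums at its inner vertices, and these lie above all pendant labels and below all old sums; the old labels
-- are shifted by an amount that depends on their class only. So the order of the sums at the vertices of
-- degree one and two survives, and that of the hubs is controlled by comparing degrees and numbers of large
-- labels. If no leg has length one, all pendant edges are removed and later get the lowest labels in the
-- order of the labels next to them. Otherwise a leg of u of length one is removed together with a leg of v
-- of length two, or an odd leg of v is removed; if all legs of v are even of length at least four, they are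
-- paired with legs of u that dominate them. This leaves deg v = 3, where the insertion order is read off a
-- finite table: the hub sums are linear forms in the lengths, compared coefficient by coefficient.
-- In the graph, non-backtracking walks have distinct vertices because there is no cycle, hence a walk from u
-- is determined by its last vertex, and the legs and the core partition the edges.

-- Shifting by class can reverse an inequality: a smaller sum with more large labels may overtake a
-- larger one. Two sums therefore count as separated only if the larger one also has at least as
-- many large labels (`Compat`), a relation that no later shift destroys. A second obstacle is
-- parity: alternating towards a small pendant label, an odd leg has a small label at its hub, and
-- an alternating even core has one at one of its ends. The Q-labels, the topmost of the large
-- labels, are put in front of such a zigzag to make that end large. A third obstacle is a leg of
-- `v` of length two with two small labels: its inner sum contains no large label, and a zigzag
-- inserted later need not fit below it. The recursion therefore inserts a zigzag only where such
-- sums are excluded, that is, if `u` has no leg of length one or `v` has none of length two.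

-- Linear inequalities between label values.

module Arithmetic where

  open import Data.Nat using (suc; _+_; _*_; _≤_; _<_; z≤n)
  open import Data.Nat.Properties using (+-cancelʳ-≤; +-monoʳ-≤; +-mono-≤; ≤-trans; ≤-reflexive; m≤m+n)
  open import Data.Nat.Tactic.RingSolver using (solve)
  open import Data.List using ([]; _∷_)
  open import Relation.Binary.PropositionalEquality using (_≡_)

  -- A linear inequality follows from an inequality X ≤ Y once the slack k is named.
  lin : ∀ {a b X Y} k → X ≤ Y → a + Y + k ≡ b + X → a ≤ b
  lin {a} {b} {X} {Y} k h e =
    +-cancelʳ-≤ Y a b (≤-trans (m≤m+n (a + Y) k) (≤-trans (≤-reflexive e) (+-monoʳ-≤ b h)))

  -- This keeps a new zigzag, whose sums are at most `P′ + c + d`, below an old sum: the old sum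
  -- exceeds `P` and rises by `2 * c` and, owing to its large label, by at least `d` more.
  ins-bound : ∀ x P c d l v e y → x ≤ P + c + 0 + c + d → P + l < v → 1 ≤ l → d ≤ e → x < v + (2 * c + (e + y))
  ins-bound x P c d l v e y h0 h1 h2 h3 = lin (1 + y) (+-mono-≤ h0 (+-mono-≤ h1 (+-mono-≤ h2 h3))) (solve (x ∷ P ∷ c ∷ d ∷ l ∷ v ∷ e ∷ y ∷ []))

  lq-new : ∀ R P d → 1 ≤ d → d ≤ R → P + 2 < suc R + suc P
  lq-new R P d h0 h1 = lin 0 (+-mono-≤ h0 h1) (solve (R ∷ P ∷ d ∷ []))

  up<lq : ∀ x R P c d → x ≤ P + c + d → c + d ≤ R → x < suc R + suc P
  up<lq x R P c d h0 h1 = lin 1 (+-mono-≤ h0 h1) (solve (x ∷ R ∷ P ∷ c ∷ d ∷ []))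

  up≤PR : ∀ x R P c d → x ≤ P + c + d → c + d ≤ R → x ≤ P + R
  up≤PR x R P c d h0 h1 = lin 0 (+-mono-≤ h0 h1) (solve (x ∷ R ∷ P ∷ c ∷ d ∷ []))

  sl<lq : ∀ a P R c d → a ≤ P + R → a + (2 * c + (d + 0 + 0)) < suc (R + c + d) + suc (P + c + 0)
  sl<lq a P R c d h0 = lin 1 h0 (solve (a ∷ P ∷ R ∷ c ∷ d ∷ []))

  lq<lq : ∀ a P R c d ν → P + R + 2 ≤ a → suc (R + c + d) + suc (P + c + 0) < a + (2 * c + (2 * d + (1 + ν)))
  lq<lq a P R c d ν h0 = lin (d + ν) h0 (solve (a ∷ P ∷ R ∷ c ∷ d ∷ ν ∷ []))

  sl-sh : ∀ a P R c d → a ≤ P + R → a + (2 * c + (d + 0 + 0)) ≤ P + c + 0 + (R + c + d)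
  sl-sh a P R c d h0 = lin 0 h0 (solve (a ∷ P ∷ R ∷ c ∷ d ∷ []))

  lq-sh : ∀ a P R c d ν → P + R + 2 ≤ a → P + c + 0 + (R + c + d) + 2 ≤ a + (2 * c + (2 * d + 1 * ν))
  lq-sh a P R c d ν h0 = lin (d + ν) h0 (solve (a ∷ P ∷ R ∷ c ∷ d ∷ ν ∷ []))

  x≤P′ : ∀ P c → suc (P + c) ≤ P + c + 2
  x≤P′ P c = lin 1 (z≤n {0}) (solve (P ∷ c ∷ []))

  sx<lq : ∀ P R c d → suc (P + c) + suc (R + c + (2 + d)) < suc (R + c + (2 + d)) + suc (P + c + 2)
  sx<lq P R c d = lin 1 (z≤n {0}) (solve (P ∷ R ∷ c ∷ d ∷ []))

  sx-val : ∀ P R c d → suc (P + c) + suc (R + c + (2 + d)) ≤ P + c + 2 + (R + c + (2 + d))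
  sx-val P R c d = lin 0 (z≤n {0}) (solve (P ∷ R ∷ c ∷ d ∷ []))

  sx-P : ∀ P R c d → 1 ≤ c → P + c + 2 + 1 < suc (P + c) + suc (R + c + (2 + d))
  sx-P P R c d h0 = lin (1 + R + d) h0 (solve (P ∷ R ∷ c ∷ d ∷ []))

  xp-sl : ∀ a P R c d → a ≤ P + R → a + (2 * c + ((2 + d) + 0 + 0)) < suc (P + c) + suc (R + c + (2 + d))
  xp-sl a P R c d h0 = lin 1 h0 (solve (a ∷ P ∷ R ∷ c ∷ d ∷ []))

  xp-sx : ∀ a P R c d → a ≤ P + R → a + (2 * c + ((2 + d) + 0 + 1)) < suc (P + c) + suc (R + c + (2 + d))
  xp-sx a P R c d h0 = lin 0 h0 (solve (a ∷ P ∷ R ∷ c ∷ d ∷ []))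

  xp-lq : ∀ a P R c d → P + R + 2 ≤ a → suc (R + c + (2 + d)) + suc (P + c + 2) < a + (2 * c + (2 * (2 + d) + 1))
  xp-lq a P R c d h0 = lin d h0 (solve (a ∷ P ∷ R ∷ c ∷ d ∷ []))

  xp-sl′ : ∀ a P R c d y → a ≤ P + R → y ≤ 1 → a + (2 * c + ((2 + d) + 0 + y)) ≤ P + c + 2 + (R + c + (2 + d))
  xp-sl′ a P R c d y h0 h1 = lin 1 (+-mono-≤ h0 h1) (solve (a ∷ P ∷ R ∷ c ∷ d ∷ y ∷ []))

  xp-lq′ : ∀ a P R c d → P + R + 2 ≤ a → P + c + 2 + (R + c + (2 + d)) + 2 ≤ a + (2 * c + (2 * (2 + d) + 1))
  xp-lq′ a P R c d h0 = lin (1 + d) h0 (solve (a ∷ P ∷ R ∷ c ∷ d ∷ []))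

  up<sx : ∀ x P R c d → x ≤ P + c + 2 + c + d → x < suc (P + c) + suc (R + c + (2 + d))
  up<sx x P R c d h0 = lin (1 + R) h0 (solve (x ∷ P ∷ R ∷ c ∷ d ∷ []))

  xp-bound : ∀ x P c d l v e y → x ≤ P + c + 2 + c + d → P + l < v → 1 ≤ l → 2 + d ≤ e → x < v + (2 * c + (e + y))
  xp-bound x P c d l v e y h0 h1 h2 h3 = lin (1 + y) (+-mono-≤ h0 (+-mono-≤ h1 (+-mono-≤ h2 h3))) (solve (x ∷ P ∷ c ∷ d ∷ l ∷ v ∷ e ∷ y ∷ []))

  d-cross : ∀ P l v y → P + l < v → suc (P + 2 + 1) < v + (4 + y)
  d-cross P l v y h0 = lin (l + y) h0 (solve (P ∷ l ∷ v ∷ y ∷ []))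

  w-old : ∀ w V c μ x y z e q → w < V → 3 * c ≤ x → e ≤ μ + y → μ ≤ c → w + (2 * c + (e + q * 0)) < V + (x + (y + z))
  w-old w V c μ x y z e q h0 h1 h2 h3 = lin z (+-mono-≤ h0 (+-mono-≤ h1 (+-mono-≤ h2 h3))) (solve (w ∷ V ∷ c ∷ μ ∷ x ∷ y ∷ z ∷ e ∷ q ∷ []))

  w-new : ∀ a V P c d x y → a ≤ P + c + 0 + c + d → P < V → 3 * c ≤ x → d ≤ c → a < V + (x + y)
  w-new a V P c d x y h0 h1 h2 h3 = lin y (+-mono-≤ h0 (+-mono-≤ h1 (+-mono-≤ h2 h3))) (solve (a ∷ V ∷ P ∷ c ∷ d ∷ x ∷ y ∷ []))

  P-new : ∀ V P c x y → P < V → 3 * c ≤ x → P + c + 0 < V + (x + y)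
  P-new V P c x y h0 h1 = lin (2 * c + y) (+-mono-≤ h0 h1) (solve (V ∷ P ∷ c ∷ x ∷ y ∷ []))

  uvV : ∀ V U j x y e f p q → V < U → suc j + (suc j + x) ≤ y → e ≤ f + 2 * j → 1 + (V + (x + (e + p * 0))) < U + (y + (f + q * 0))
  uvV V U j x y e f p q h0 h1 h2 = lin 1 (+-mono-≤ h0 (+-mono-≤ h1 h2)) (solve (V ∷ U ∷ j ∷ x ∷ y ∷ e ∷ f ∷ p ∷ q ∷ []))

  uvV1 : ∀ V U nv nu e f p q → V < U → suc nv ≤ nu → 1 + (V + (nv * 1 + (e * 0 + p * 0))) < U + (nu * 1 + (f * 0 + q * 0))
  uvV1 V U nv nu e f p q h0 h1 = lin 0 (+-mono-≤ h0 h1) (solve (V ∷ U ∷ nv ∷ nu ∷ e ∷ f ∷ p ∷ q ∷ []))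

  uvU1 : ∀ V U nv nu e f p q → V < U → suc nv ≤ nu → V + (nv * 1 + (e * 0 + p * 0)) < 1 + (U + (nu * 1 + (f * 0 + q * 0)))
  uvU1 V U nv nu e f p q h0 h1 = lin 2 (+-mono-≤ h0 h1) (solve (V ∷ U ∷ nv ∷ nu ∷ e ∷ f ∷ p ∷ q ∷ []))

  uvU : ∀ V U c d x y e f p q h → V < U → c + x ≤ y → e ≤ f + d → d ≤ c → V + (x + (e + p * 0)) < h + (U + (y + (f + q * 0)))
  uvU V U c d x y e f p q h h0 h1 h2 h3 = lin h (+-mono-≤ h0 (+-mono-≤ h1 (+-mono-≤ h2 h3))) (solve (V ∷ U ∷ c ∷ d ∷ x ∷ y ∷ e ∷ f ∷ p ∷ q ∷ h ∷ []))

  uvD : ∀ V U nv nu e f p q → V < U → suc nv ≤ nu → e ≤ f + 2 → 1 + (V + (nv * 2 + (e * 1 + p * 0))) < 2 + (U + (nu * 2 + (f * 1 + q * 0)))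
  uvD V U nv nu e f p q h0 h1 h2 = lin 1 (+-mono-≤ h0 (+-mono-≤ h1 (+-mono-≤ h1 h2))) (solve (V ∷ U ∷ nv ∷ nu ∷ e ∷ f ∷ p ∷ q ∷ []))

  wD : ∀ V P x y → P < V → 6 ≤ x → suc (P + 2 + 1) < 1 + (V + (x + y))
  wD V P x y h0 h1 = lin (3 + y) (+-mono-≤ h0 h1) (solve (V ∷ P ∷ x ∷ y ∷ []))

  PD : ∀ V P x y → P < V → 6 ≤ x → P + 2 + 1 < 1 + (V + (x + y))
  PD V P x y h0 h1 = lin (4 + y) (+-mono-≤ h0 h1) (solve (V ∷ P ∷ x ∷ y ∷ []))

  -- The bound `3 ≤ nv` is supplied twice because `nv` enters with the factor two.
  wD-old : ∀ w V l lw nv x y z → w < V → lw ≤ suc l → 3 ≤ nv → 3 ≤ nv → w + (4 + (lw * 1 + x * 0)) < 1 + (V + (nv * 2 + (l * 1 + z)))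
  wD-old w V l lw nv x y z h0 h1 h2 h3 = lin (2 + z) (+-mono-≤ h0 (+-mono-≤ h1 (+-mono-≤ h2 h3))) (solve (w ∷ V ∷ l ∷ lw ∷ nv ∷ x ∷ y ∷ z ∷ []))

  b-end<in : ∀ e t r w → r ≤ t → e < w → e + t + r < w + (t + t)
  b-end<in e t r w h0 h1 = lin 0 (+-mono-≤ h0 h1) (solve (e ∷ t ∷ r ∷ w ∷ []))

  b-inP : ∀ e t r → 1 ≤ e → 1 ≤ r → t + 1 < e + t + r
  b-inP e t r h0 h1 = lin 0 (+-mono-≤ h0 h1) (solve (e ∷ t ∷ r ∷ []))

  b-in2P : ∀ w t → 3 ≤ t → t + 2 < w + (t + t)
  b-in2P w t h0 = lin w h0 (solve (w ∷ t ∷ []))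

  b-hub : ∀ w V t x → w < V → 2 * t ≤ x → w + (t + t) < V + x
  b-hub w V t x h0 h1 = lin 0 (+-mono-≤ h0 h1) (solve (w ∷ V ∷ t ∷ x ∷ []))

  b-hubE : ∀ e V t r x → e < V → r ≤ t → 2 * t ≤ x → e + t + r < V + x
  b-hubE e V t r x h0 h1 h2 = lin 0 (+-mono-≤ h0 (+-mono-≤ h1 h2)) (solve (e ∷ V ∷ t ∷ r ∷ x ∷ []))

  b-hubP : ∀ e V t x → e < V → 2 * t ≤ x → t < V + x
  b-hubP e V t x h0 h1 = lin (e + t) (+-mono-≤ h0 h1) (solve (e ∷ V ∷ t ∷ x ∷ []))

  -- An inner sum consists of two labels, so for `d ≤ c` it rises by at most `4 * c`; four labels at
  -- `v` keep pace with that.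
  lamW : ∀ w V c d X Y Z e q → w < V → 4 * c ≤ X → d ≤ Y → e ≤ 2 * d → d ≤ c → w + (2 * c + (e + q * 0)) < V + (X + (Y + Z))
  lamW w V c d X Y Z e q h0 h1 h2 h3 h4 = lin (Z + c) (+-mono-≤ h0 (+-mono-≤ h1 (+-mono-≤ h2 (+-mono-≤ h3 h4)))) (solve (w ∷ V ∷ c ∷ d ∷ X ∷ Y ∷ Z ∷ e ∷ q ∷ []))

  lamWQ : ∀ w V c X Y Z e q → w < V → 4 * c ≤ X → c ≤ Y → e ≤ 2 * c → q ≤ 1 → 1 ≤ c → w + (2 * c + (e + q * 1)) < V + (X + (Y + Z))
  lamWQ w V c X Y Z e q h0 h1 h2 h3 h4 h5 = lin Z (+-mono-≤ h0 (+-mono-≤ h1 (+-mono-≤ h2 (+-mono-≤ h3 (+-mono-≤ h4 h5))))) (solve (w ∷ V ∷ c ∷ X ∷ Y ∷ Z ∷ e ∷ q ∷ []))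

  lamWX : ∀ w V P c X Y Z e q → w < V → 4 * c ≤ X → 2 + c ≤ Y → e ≤ 2 * (2 + c) → q ≤ 1 → 1 ≤ c → w + (2 * c + (e + q * 1)) < suc (P + c) + (V + (X + (Y + Z)))
  lamWX w V P c X Y Z e q h0 h1 h2 h3 h4 h5 = lin (P + Z) (+-mono-≤ h0 (+-mono-≤ h1 (+-mono-≤ h2 (+-mono-≤ h3 (+-mono-≤ h4 (+-mono-≤ h5 h5)))))) (solve (w ∷ V ∷ P ∷ c ∷ X ∷ Y ∷ Z ∷ e ∷ q ∷ []))

  -- The value `P + R + 2` is that of the sum next to a freshly inserted Q-label, which has to stay
  -- below the sum at `v`.
  lamPR : ∀ V P R c d X Y → P + R + 2 < V → 4 * c ≤ X → d ≤ c → P + c + 0 + (R + c + d) + 2 < V + (X + Y)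
  lamPR V P R c d X Y h0 h1 h2 = lin (Y + c) (+-mono-≤ h0 (+-mono-≤ h1 h2)) (solve (V ∷ P ∷ R ∷ c ∷ d ∷ X ∷ Y ∷ []))

  lamPRX : ∀ V P R c X Y Z → P + R + 2 < V → 4 * c ≤ X → 2 + c ≤ Y → 1 ≤ c → P + c + 2 + (R + c + (2 + c)) + 2 < suc (P + c) + (V + (X + (Y + Z)))
  lamPRX V P R c X Y Z h0 h1 h2 h3 = lin (P + Z + 2 * c) (+-mono-≤ h0 (+-mono-≤ h1 (+-mono-≤ h2 h3))) (solve (V ∷ P ∷ R ∷ c ∷ X ∷ Y ∷ Z ∷ []))

  lamU : ∀ V U P h X Y Z X1 Y1 Z1 → V < U → P < h → X ≤ X1 → Y ≤ Y1 → Z ≤ Z1 → V + (X + (Y + Z)) + suc P < h + (U + (X1 + (Y1 + Z1)))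
  lamU V U P h X Y Z X1 Y1 Z1 h0 h1 h2 h3 h4 = lin 0 (+-mono-≤ h0 (+-mono-≤ h1 (+-mono-≤ h2 (+-mono-≤ h3 h4)))) (solve (V ∷ U ∷ P ∷ h ∷ X ∷ Y ∷ Z ∷ X1 ∷ Y1 ∷ Z1 ∷ []))

  lamV : ∀ V U P c X Y Z X1 Y1 Z1 → V + suc P < U → c + X ≤ X1 → Y ≤ Y1 → Z ≤ Z1 → suc (P + c + 0) + (V + (X + (Y + Z))) < U + (X1 + (Y1 + Z1))
  lamV V U P c X Y Z X1 Y1 Z1 h0 h1 h2 h3 = lin 0 (+-mono-≤ h0 (+-mono-≤ h1 (+-mono-≤ h2 h3))) (solve (V ∷ U ∷ P ∷ c ∷ X ∷ Y ∷ Z ∷ X1 ∷ Y1 ∷ Z1 ∷ []))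

  lamX : ∀ V U P c X Y Z X1 Y1 Z1 → V < U → X ≤ X1 → Y ≤ Y1 → Z ≤ Z1 → suc (P + c) + (V + (X + (Y + Z))) < P + c + 2 + (U + (X1 + (Y1 + Z1)))
  lamX V U P c X Y Z X1 Y1 Z1 h0 h1 h2 h3 = lin 1 (+-mono-≤ h0 (+-mono-≤ h1 (+-mono-≤ h2 h3))) (solve (V ∷ U ∷ P ∷ c ∷ X ∷ Y ∷ Z ∷ X1 ∷ Y1 ∷ Z1 ∷ []))

  lamE : ∀ V U h X Y Z X1 Y1 Z1 → V < U → X ≤ X1 → Y ≤ Y1 → Z ≤ Z1 → V + (X + (Y + Z)) < h + (U + (X1 + (Y1 + Z1)))
  lamE V U h X Y Z X1 Y1 Z1 h0 h1 h2 h3 = lin h (+-mono-≤ h0 (+-mono-≤ h1 (+-mono-≤ h2 h3))) (solve (V ∷ U ∷ h ∷ X ∷ Y ∷ Z ∷ X1 ∷ Y1 ∷ Z1 ∷ []))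

  lam-P : ∀ P R V → P + R + 2 < V → P < V
  lam-P P R V h0 = lin (2 + R) h0 (solve (P ∷ R ∷ V ∷ []))

  lq-val : ∀ P R → suc R + suc P ≤ P + R + 2
  lq-val P R = lin 0 (z≤n {0}) (solve (P ∷ R ∷ []))

open import Data.Nat using (ℕ; zero; suc; _+_; _*_; _≤_; _<_; z≤n; s≤s)
open import Data.List using (List; []; _∷_; _++_; map; concatMap; length)
open import Data.List.Membership.Propositional using (_∈_; _∉_)
open import Data.List.Relation.Unary.Any as Any using (Any; here; there)
open import Data.List.Relation.Unary.All as All using (All; []; _∷_)
open import Data.List.Relation.Unary.All.Properties as Allₚ using ()
open import Data.List.Relation.Unary.AllPairs as AllPairs using (AllPairs; []; _∷_)
open import Data.List.Relation.Unary.AllPairs.Properties as APₚ using ()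
open import Data.List.Relation.Binary.Permutation.Propositional using (_↭_; ↭-refl; ↭-sym; ↭-trans; ↭-reflexive; prep; swap)
open import Data.List.Relation.Binary.Permutation.Propositional.Properties as Perm using (↭-length; All-resp-↭; ∈-resp-↭)
open import Data.Product using (_×_; _,_; proj₁; proj₂; Σ; ∃; ∃₂)
open import Data.Sum as Sum using (_⊎_; inj₁; inj₂)
open import Data.Empty using (⊥-elim)
open import Function using (_∘_)

-- Classes of labels, configurations and the effect of shifts.

module Labellings where

  open import Data.Nat.Properties
  open import Data.Nat.Tactic.RingSolver using (solve-∀)
  open import Data.List.Properties using (concatMap-++; concatMap-map; map-concatMap; concatMap-cong; length-++; length-map)
  open import Data.Product using (map₂)
  open import Relation.Binary.PropositionalEquality using (_≡_; refl; sym; trans; cong; cong₂; subst)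
  open Arithmetic

  -- lv counts the large labels (L and Q) in a sum of labels and tp those among them that are Q-labels;
  -- they determine how the sum moves when room is made for new labels.
  record Lab : Set where
    constructor ⟨_,_,_⟩
    field
      lv tp val : ℕ

  open Lab public

  pattern S a = ⟨ 0 , 0 , a ⟩
  pattern L a = ⟨ 1 , 0 , a ⟩
  pattern Q a = ⟨ 1 , 1 , a ⟩

  infixl 6 _⊕_
  _⊕_ : Lab → Lab → Lab
  x ⊕ y = ⟨ lv x + lv y , tp x + tp y , val x + val y ⟩

  total : List Lab → Lab
  total []       = ⟨ 0 , 0 , 0 ⟩
  total (x ∷ xs) = x ⊕ total xs

  -- A shift adds an amount that is monotone in `lv` and `tp`. Asking for these two inequalities
  -- besides the one between values makes the relation stable under every later shift.
  Below : Lab → Lab → Set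
  Below x y = lv x ≤ lv y × tp x ≤ tp y × val x < val y

  Compat : Lab → Lab → Set
  Compat x y = Below x y ⊎ Below y x

  Compat-sym : ∀ {x y} → Compat x y → Compat y x
  Compat-sym (inj₁ p) = inj₂ p
  Compat-sym (inj₂ p) = inj₁ p

  -- Here `k` is the number of labels in the sum `x`. Each of them rises by `c`, each large one by a
  -- further `μ`, and each Q-label by a further `ν`.
  sh : ℕ → ℕ → ℕ → ℕ → Lab → Lab
  sh k c μ ν x = ⟨ lv x , tp x , val x + (k * c + (lv x * μ + tp x * ν)) ⟩

  Below-sh : ∀ k c μ ν {x y} → Below x y → Below (sh k c μ ν x) (sh k c μ ν y)
  Below-sh k c μ ν (p , q , r) = p , q ,
    +-mono-<-≤ r (+-monoʳ-≤ (k * c) (+-mono-≤ (*-monoˡ-≤ μ p) (*-monoˡ-≤ ν q)))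

  Compat-sh : ∀ k c μ ν {x y} → Compat x y → Compat (sh k c μ ν x) (sh k c μ ν y)
  Compat-sh k c μ ν (inj₁ p) = inj₁ (Below-sh k c μ ν p)
  Compat-sh k c μ ν (inj₂ p) = inj₂ (Below-sh k c μ ν p)

  sh-⊕ : ∀ k k′ c μ ν x y → sh k c μ ν x ⊕ sh k′ c μ ν y ≡ sh (k + k′) c μ ν (x ⊕ y)
  sh-⊕ k k′ c μ ν ⟨ l , q , v ⟩ ⟨ l′ , q′ , v′ ⟩ =
    cong ⟨ l + l′ , q + q′ ,_⟩ (lem k k′ c μ ν l q v l′ q′ v′)
    where
    lem : ∀ k k′ c μ ν l q v l′ q′ v′ →
      v + (k * c + (l * μ + q * ν)) + (v′ + (k′ * c + (l′ * μ + q′ * ν))) ≡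
      v + v′ + ((k + k′) * c + ((l + l′) * μ + (q + q′) * ν))
    lem = solve-∀

  total-sh : ∀ c μ ν xs → total (map (sh 1 c μ ν) xs) ≡ sh (length xs) c μ ν (total xs)
  total-sh c μ ν []       = refl
  total-sh c μ ν (x ∷ xs) =
    trans (cong (sh 1 c μ ν x ⊕_) (total-sh c μ ν xs)) (sh-⊕ 1 (length xs) c μ ν x (total xs))

  total-++ : ∀ xs ys → total (xs ++ ys) ≡ total xs ⊕ total ys
  total-++ []       ys = refl
  total-++ (x ∷ xs) ys rewrite total-++ xs ys
    | +-assoc (lv x) (lv (total xs)) (lv (total ys))
    | +-assoc (tp x) (tp (total xs)) (tp (total ys))
    | +-assoc (val x) (val (total xs)) (val (total ys)) = refl

  sums : List Lab → List Lab
  sums []           = []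
  sums (x ∷ [])     = []
  sums (x ∷ y ∷ zs) = x ⊕ y ∷ sums (y ∷ zs)

  sums-sh : ∀ c μ ν xs → sums (map (sh 1 c μ ν) xs) ≡ map (sh 2 c μ ν) (sums xs)
  sums-sh c μ ν []           = refl
  sums-sh c μ ν (x ∷ [])     = refl
  sums-sh c μ ν (x ∷ y ∷ zs) = cong₂ _∷_ (sh-⊕ 1 1 c μ ν x y) (sums-sh c μ ν (y ∷ zs))

  -- A piece is a leg of the hub u, a leg of the hub v (both listed from the hub to the leaf),
  -- or the core, listed from u to v (cK) or from v to u (rK).
  data Kind : Set where
    uK vK cK rK : Kind

  Piece : Set
  Piece = Kind × List Lab

  Config : Set
  Config = List Piece

  labels : Config → List Lab
  labels = concatMap proj₂

  inner : Config → List Lab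
  inner = concatMap (λ p → sums (proj₂ p))

  hd : List Lab → Lab
  -- A mere default, as `PieceOK` excludes empty pieces.
  hd []      = S 0
  hd (x ∷ _) = x

  lst : List Lab → Lab
  lst []           = S 0
  lst (x ∷ [])     = x
  lst (x ∷ y ∷ ys) = lst (y ∷ ys)

  atU atV : Piece → List Lab
  atU (uK , xs) = hd xs ∷ []
  atU (vK , xs) = []
  atU (cK , xs) = hd xs ∷ []
  atU (rK , xs) = lst xs ∷ []
  atV (uK , xs) = []
  atV (vK , xs) = hd xs ∷ []
  atV (cK , xs) = lst xs ∷ []
  atV (rK , xs) = hd xs ∷ []

  hubU hubV : Config → List Lab
  hubU = concatMap atU
  hubV = concatMap atV

  shC : ℕ → ℕ → ℕ → Config → Config
  shC c μ ν = map (map₂ (map (sh 1 c μ ν)))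

  labels-sh : ∀ c μ ν cfg → labels (shC c μ ν cfg) ≡ map (sh 1 c μ ν) (labels cfg)
  labels-sh c μ ν cfg = trans (concatMap-map proj₂ _ cfg) (sym (map-concatMap _ proj₂ cfg))

  inner-sh : ∀ c μ ν cfg → inner (shC c μ ν cfg) ≡ map (sh 2 c μ ν) (inner cfg)
  inner-sh c μ ν cfg = trans (concatMap-map _ _ cfg)
    (trans (concatMap-cong (λ p → sums-sh c μ ν (proj₂ p)) cfg) (sym (map-concatMap _ _ cfg)))

  labels-step : ∀ c μ ν N cfg → labels (N ++ shC c μ ν cfg) ≡ labels N ++ map (sh 1 c μ ν) (labels cfg)
  labels-step c μ ν N cfg = trans (concatMap-++ proj₂ N _) (cong (labels N ++_) (labels-sh c μ ν cfg))

  inner-step : ∀ c μ ν N cfg → inner (N ++ shC c μ ν cfg) ≡ inner N ++ map (sh 2 c μ ν) (inner cfg)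
  inner-step c μ ν N cfg = trans (concatMap-++ (λ p → sums (proj₂ p)) N _) (cong (inner N ++_) (inner-sh c μ ν cfg))

  -- Small pendant labels put all sums at leaves at or below `P`, so that a single bound separates
  -- them from the remaining sums.
  data EndS : List Lab → Set where
    end  : ∀ {a} → EndS (S a ∷ [])
    more : ∀ {x y ys} → EndS (y ∷ ys) → EndS (x ∷ y ∷ ys)

  data PieceOK : Piece → Set where
    okU : ∀ {xs} → EndS xs → PieceOK (uK , xs)
    okV : ∀ {xs} → EndS xs → PieceOK (vK , xs)
    okC : ∀ {x xs} → PieceOK (cK , x ∷ xs)
    okR : ∀ {x xs} → PieceOK (rK , x ∷ xs)

  EndS-sh : ∀ c μ ν {xs} → EndS xs → EndS (map (sh 1 c μ ν) xs)
  EndS-sh c μ ν end      = end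
  EndS-sh c μ ν (more e) = more (EndS-sh c μ ν e)

  PieceOK-sh : ∀ c μ ν {p} → PieceOK p → PieceOK (map₂ (map (sh 1 c μ ν)) p)
  PieceOK-sh c μ ν (okU e) = okU (EndS-sh c μ ν e)
  PieceOK-sh c μ ν (okV e) = okV (EndS-sh c μ ν e)
  PieceOK-sh c μ ν okC     = okC
  PieceOK-sh c μ ν okR     = okR

  lst-sh : ∀ c μ ν x xs → lst (map (sh 1 c μ ν) (x ∷ xs)) ≡ sh 1 c μ ν (lst (x ∷ xs))
  lst-sh c μ ν x []       = refl
  lst-sh c μ ν x (y ∷ ys) = lst-sh c μ ν y ys

  hd-sh : ∀ c μ ν {xs} → EndS xs → hd (map (sh 1 c μ ν) xs) ≡ sh 1 c μ ν (hd xs)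
  hd-sh c μ ν end      = refl
  hd-sh c μ ν (more e) = refl

  hubU-sh : ∀ c μ ν {cfg} → All PieceOK cfg → hubU (shC c μ ν cfg) ≡ map (sh 1 c μ ν) (hubU cfg)
  hubU-sh c μ ν []           = refl
  hubU-sh c μ ν (okU e ∷ ps) = cong₂ _∷_ (hd-sh c μ ν e) (hubU-sh c μ ν ps)
  hubU-sh c μ ν (okV e ∷ ps) = hubU-sh c μ ν ps
  hubU-sh c μ ν (okC ∷ ps)   = cong₂ _∷_ refl (hubU-sh c μ ν ps)
  hubU-sh c μ ν (okR {x} {xs} ∷ ps) = cong₂ _∷_ (lst-sh c μ ν x xs) (hubU-sh c μ ν ps)

  hubV-sh : ∀ c μ ν {cfg} → All PieceOK cfg → hubV (shC c μ ν cfg) ≡ map (sh 1 c μ ν) (hubV cfg)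
  hubV-sh c μ ν []           = refl
  hubV-sh c μ ν (okU e ∷ ps) = hubV-sh c μ ν ps
  hubV-sh c μ ν (okV e ∷ ps) = cong₂ _∷_ (hd-sh c μ ν e) (hubV-sh c μ ν ps)
  hubV-sh c μ ν (okC {x} {xs} ∷ ps) = cong₂ _∷_ (lst-sh c μ ν x xs) (hubV-sh c μ ν ps)
  hubV-sh c μ ν (okR ∷ ps)   = cong₂ _∷_ refl (hubV-sh c μ ν ps)

  data Cls (P R m : ℕ) : Lab → Set where
    clsS : ∀ {a} → 1 ≤ a → a ≤ P → Cls P R m (S a)
    clsL : ∀ {a} → P < a → a ≤ R → Cls P R m (L a)
    clsQ : ∀ {a} → R < a → a ≤ m → Cls P R m (Q a)

  -- This is all that concerns vertices other than the hubs. Together `lab`, `cls` and `len` make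
  -- the labels a bijection onto `1,…,m`; `innP` puts the sums at vertices of degree two above the
  -- pendant labels.
  record Inv (P R m : ℕ) (cfg : Config) : Set where
    field
      P≤R    : P ≤ R
      R≤m    : R ≤ m
      lab    : AllPairs Compat (labels cfg)
      cls    : All (Cls P R m) (labels cfg)
      len    : length (labels cfg) ≡ m
      inn    : AllPairs Compat (inner cfg)
      innP   : All (λ w → P + lv w < val w) (inner cfg)
      pieces : All PieceOK cfg

  -- Room for new labels: c at the bottom of the S-labels, t at their top,
  -- d at the bottom of the L-labels and ν at the bottom of the Q-labels.
  module Step (P R m c t d ν : ℕ) where

    P′ μ R′ m′ : ℕ
    P′ = P + c + t
    μ  = t + d
    R′ = R + c + μ
    m′ = m + c + μ + ν

    data New : Lab → Set where
      newS : ∀ {a} → 1 ≤ a → a ≤ c → New (S a)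
      newT : ∀ {a} → P + c < a → a ≤ P′ → New (S a)
      newL : ∀ {a} → P′ < a → a ≤ P′ + d → New (L a)
      newQ : ∀ {a} → R′ < a → a ≤ R′ + ν → New (Q a)

    private
      shS : ∀ a → sh 1 c μ ν (S a) ≡ S (a + c)
      shS a = cong ⟨ 0 , 0 ,_⟩ (cong (a +_) (trans (+-identityʳ _) (+-identityʳ c)))
      shL : ∀ a → sh 1 c μ ν (L a) ≡ L (a + c + μ)
      shL a = cong ⟨ 1 , 0 ,_⟩ (lem a c μ) where
        lem : ∀ a c μ → a + (c + 0 + (μ + 0 + 0)) ≡ a + c + μ
        lem = solve-∀
      shQ : ∀ a → sh 1 c μ ν (Q a) ≡ Q (a + c + μ + ν)
      shQ a = cong ⟨ 1 , 1 ,_⟩ (lem a c μ ν) where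
        lem : ∀ a c μ ν → a + (c + 0 + (μ + 0 + (ν + 0))) ≡ a + c + μ + ν
        lem = solve-∀

    P′≤R′ : P ≤ R → P′ + d ≤ R′
    P′≤R′ h = lin 0 h (lem P R c t d) where
      lem : ∀ P R c t d → P + c + t + d + R + 0 ≡ R + c + (t + d) + P
      lem = solve-∀

    R′≤m′ : R ≤ m → R′ + ν ≤ m′
    R′≤m′ h = +-monoˡ-≤ ν (+-monoˡ-≤ μ (+-monoˡ-≤ c h))

    cls-sh : ∀ {x} → P ≤ R → R ≤ m → Cls P R m x → Cls P′ R′ m′ (sh 1 c μ ν x)
    cls-sh pr rm (clsS {a} p q) rewrite shS a =
      clsS (≤-trans p (m≤m+n a c)) (≤-trans (+-monoˡ-≤ c q) (m≤m+n _ t))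
    cls-sh pr rm (clsL {a} p q) rewrite shL a =
      clsL (lin d p (lem P a c t d)) (+-monoˡ-≤ μ (+-monoˡ-≤ c q)) where
        lem : ∀ P a c t d → suc (P + c + t) + a + d ≡ a + c + (t + d) + suc P
        lem = solve-∀
    cls-sh pr rm (clsQ {a} p q) rewrite shQ a =
      clsQ (lin ν p (lem R a c μ ν)) (+-monoˡ-≤ ν (+-monoˡ-≤ μ (+-monoˡ-≤ c q))) where
        lem : ∀ R a c μ ν → suc (R + c + μ) + a + ν ≡ a + c + μ + ν + suc R
        lem = solve-∀

    cls-new : ∀ {x} → P ≤ R → R ≤ m → New x → Cls P′ R′ m′ x
    cls-new pr rm (newS p q) = clsS p (≤-trans q (≤-trans (m≤n+m c P) (m≤m+n (P + c) t)))
    cls-new pr rm (newT p q) = clsS (≤-trans (s≤s z≤n) p) q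
    cls-new pr rm (newL p q) = clsL p (≤-trans q (P′≤R′ pr))
    cls-new pr rm (newQ p q) = clsQ p (≤-trans q (R′≤m′ rm))

    -- Within a class the new labels of one kind lie all below or all above the old ones; between
    -- two classes the order of the values agrees with that of `lv` and `tp`.
    new-old : ∀ {y x} → P ≤ R → R ≤ m → New y → Cls P R m x → Compat y (sh 1 c μ ν x)
    new-old {y} pr rm n (clsS {a} p′ q′) = subst (Compat y) (sym (shS a)) (cmp n)
      where
      ac≤ : a + c ≤ P + c
      ac≤ = +-monoˡ-≤ c q′
      cmp : ∀ {y} → New y → Compat y (S (a + c))
      cmp (newS p q) = inj₁ (z≤n , z≤n , ≤-<-trans q (m<n+m c p′))
      cmp (newT p q) = inj₂ (z≤n , z≤n , ≤-<-trans ac≤ p)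
      cmp (newL p q) = inj₂ (z≤n , z≤n , ≤-<-trans (≤-trans ac≤ (m≤m+n _ t)) p)
      cmp (newQ p q) = inj₂ (z≤n , z≤n , ≤-<-trans (≤-trans ac≤ (≤-trans (m≤m+n (P + c) t) (≤-trans (m≤m+n P′ d) (P′≤R′ pr)))) p)
    new-old {y} pr rm n (clsL {a} p′ q′) = subst (Compat y) (sym (shL a)) (cmp n)
      where
      lem : ∀ P a c t d → suc (P + c + t + d) + a + 0 ≡ a + c + (t + d) + suc P
      lem = solve-∀
      P′d< : P′ + d < a + c + μ
      P′d< = lin 0 p′ (lem P a c t d)
      cmp : ∀ {y} → New y → Compat y (L (a + c + μ))
      cmp (newS p q) = inj₁ (z≤n , z≤n , ≤-<-trans q (<-≤-trans (m<n+m c (≤-trans (s≤s z≤n) p′)) (m≤m+n _ μ)))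
      cmp (newT p q) = inj₁ (z≤n , z≤n , ≤-<-trans q (≤-<-trans (m≤m+n P′ d) P′d<))
      cmp (newL p q) = inj₁ (≤-refl , z≤n , ≤-<-trans q P′d<)
      cmp (newQ p q) = inj₂ (≤-refl , z≤n , ≤-<-trans (+-monoˡ-≤ μ (+-monoˡ-≤ c q′)) p)
    new-old {y} pr rm n (clsQ {a} p′ q′) = subst (Compat y) (sym (shQ a)) (inj₁ (cmp n))
      where
      P″ : P′ ≤ R′ + ν
      P″ = ≤-trans (m≤m+n P′ d) (≤-trans (P′≤R′ pr) (m≤m+n R′ ν))
      R″ : R′ + ν < a + c + μ + ν
      R″ = +-monoˡ-< ν (+-monoˡ-< μ (+-monoˡ-< c p′))
      cmp : ∀ {y} → New y → Below y (Q (a + c + μ + ν))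
      cmp (newS _ q) = z≤n , z≤n , ≤-<-trans (≤-trans q (≤-trans (≤-trans (m≤n+m c P) (m≤m+n (P + c) t)) P″)) R″
      cmp (newT _ q) = z≤n , z≤n , ≤-<-trans (≤-trans q P″) R″
      cmp (newL _ q) = ≤-refl , z≤n , ≤-<-trans (≤-trans q (≤-trans (P′≤R′ pr) (m≤m+n R′ ν))) R″
      cmp (newQ _ q) = ≤-refl , ≤-refl , ≤-<-trans q R″

    record NewOK (old : Config) (N : Config) : Set where
      field
        nlab    : AllPairs Compat (labels N)
        ncls    : All New (labels N)
        nlen    : length (labels N) ≡ c + μ + ν
        ninn    : AllPairs Compat (inner N)
        ninnP   : All (λ w → P′ + lv w < val w) (inner N)
        ncross  : All (λ w → All (λ x → Compat w (sh 2 c μ ν x)) (inner old)) (inner N)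
        -- The bound `P` rises by `c + t` and an old inner sum by at least `2 * c + lv w * μ`; the
        -- difference is what `innP` needs.
        nroom   : All (λ w → t ≤ c + lv w * μ) (inner old)
        npieces : All PieceOK N

    step : ∀ {cfg N} → Inv P R m cfg → NewOK cfg N → Inv P′ R′ m′ (N ++ shC c μ ν cfg)
    step {cfg} {N} I O = record
      { P≤R = ≤-trans (m≤m+n P′ d) (P′≤R′ P≤R)
      ; R≤m = ≤-trans (m≤m+n R′ ν) (R′≤m′ R≤m)
      ; lab = subst (AllPairs Compat) (sym el)
          (APₚ.++⁺ nlab (APₚ.map⁺ (AllPairs.map (Compat-sh 1 c μ ν) lab))
            (All.map (λ y → Allₚ.map⁺ (All.map (λ x → new-old P≤R R≤m y x) cls)) ncls))
      ; cls = subst (All _) (sym el)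
          (Allₚ.++⁺ (All.map (cls-new P≤R R≤m) ncls) (Allₚ.map⁺ (All.map (cls-sh P≤R R≤m) cls)))
      ; len = trans (cong length el) (trans (length-++ (labels N))
          (trans (cong₂ _+_ nlen (trans (length-map (sh 1 c μ ν) (labels cfg)) len)) (lem c μ ν m)))
      ; inn = subst (AllPairs Compat) (sym ei)
          (APₚ.++⁺ ninn (APₚ.map⁺ (AllPairs.map (Compat-sh 2 c μ ν) inn))
            (All.map Allₚ.map⁺ ncross))
      ; innP = subst (All _) (sym ei)
          (Allₚ.++⁺ ninnP (Allₚ.map⁺ (All.zipWith (λ {w} → up w) (innP , nroom))))
      ; pieces = Allₚ.++⁺ npieces (Allₚ.map⁺ (All.map (PieceOK-sh c μ ν) pieces))
      }
      where
      open Inv I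
      open NewOK O
      el : labels (N ++ shC c μ ν cfg) ≡ labels N ++ map (sh 1 c μ ν) (labels cfg)
      el = labels-step c μ ν N cfg
      ei : inner (N ++ shC c μ ν cfg) ≡ inner N ++ map (sh 2 c μ ν) (inner cfg)
      ei = inner-step c μ ν N cfg
      lem : ∀ c μ ν m → c + μ + ν + m ≡ m + c + μ + ν
      lem = solve-∀
      up : ∀ w → P + lv w < val w × t ≤ c + lv w * μ →
           P′ + lv w < val w + (2 * c + (lv w * μ + tp w * ν))
      up w (h , r) = lin (tp w * ν) (+-mono-≤ h r) (lem′ P (lv w) (val w) c t (lv w * μ) (tp w * ν))
        where
        lem′ : ∀ P l v c t x y →
          suc (P + c + t + l) + (v + (c + x)) + y ≡ v + (2 * c + (x + y)) + (suc (P + l) + t)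
        lem′ = solve-∀

-- Alternating labels on a leg or core, and the legality of their insertion.

module Zigzags where

  open import Data.Nat.Properties
  open import Data.Nat.Tactic.RingSolver using (solve-∀)
  open import Data.List.Properties using (++-identityʳ; length-++)
  open import Relation.Binary.PropositionalEquality using (_≡_; refl; sym; trans; cong; cong₂; subst)
  open Arithmetic
  open Labellings

  -- Doubling by recursion, so that lengths of zigzags reduce by two constructors at a time, which
  -- `j + j` would not do.
  twice : ℕ → ℕ
  twice zero    = zero
  twice (suc j) = suc (suc (twice j))

  twice≡ : ∀ j → twice j ≡ j + j
  twice≡ zero    = refl
  twice≡ (suc j) = cong suc (trans (cong suc (twice≡ j)) (sym (+-suc j j)))

  zSL zLS : ℕ → ℕ → ℕ → List Lab
  zSL a b zero    = []
  zSL a b (suc j) = S a ∷ L b ∷ zSL (suc a) (suc b) j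
  zLS a b zero    = []
  zLS a b (suc j) = L b ∷ S a ∷ zLS (suc a) (suc b) j

  data Rng (a A b B : ℕ) : Lab → Set where
    rS : ∀ {x} → a ≤ x → x < A → Rng a A b B (S x)
    rL : ∀ {x} → b ≤ x → x < B → Rng a A b B (L x)

  rng-low : ∀ {a a′ A b b′ B x} → a ≤ a′ → b ≤ b′ → Rng a′ A b′ B x → Rng a A b B x
  rng-low p q (rS h i) = rS (≤-trans p h) i
  rng-low p q (rL h i) = rL (≤-trans q h) i

  private
    +s≤⇒< : ∀ {a j A} → a + suc j ≤ A → a < A
    +s≤⇒< {a} {j} h = ≤-trans (s≤s (m≤m+n a j)) (≤-trans (≤-reflexive (sym (+-suc a j))) h)

    +s≤⇒ : ∀ {a j A} → a + suc j ≤ A → suc a + j ≤ A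
    +s≤⇒ {a} {j} h = ≤-trans (≤-reflexive (sym (+-suc a j))) h

  rng-zSL : ∀ a b j {A B} → a + j ≤ A → b + j ≤ B → All (Rng a A b B) (zSL a b j)
  rng-zSL a b zero    p q = []
  rng-zSL a b (suc j) p q = rS ≤-refl (+s≤⇒< p) ∷ rL ≤-refl (+s≤⇒< q)
    ∷ All.map (rng-low (n≤1+n a) (n≤1+n b)) (rng-zSL (suc a) (suc b) j (+s≤⇒ p) (+s≤⇒ q))

  rng-zLS : ∀ a b j {A B} → a + j ≤ A → b + j ≤ B → All (Rng a A b B) (zLS a b j)
  rng-zLS a b zero    p q = []
  rng-zLS a b (suc j) p q = rL ≤-refl (+s≤⇒< q) ∷ rS ≤-refl (+s≤⇒< p)
    ∷ All.map (rng-low (n≤1+n a) (n≤1+n b)) (rng-zLS (suc a) (suc b) j (+s≤⇒ p) (+s≤⇒ q))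

  S-below : ∀ {a A b B y} → a < b → Rng (suc a) A b B y → Compat (S a) y
  S-below h (rS p q) = inj₁ (z≤n , z≤n , p)
  S-below h (rL p q) = inj₁ (z≤n , z≤n , <-≤-trans h p)

  L-compat : ∀ {a A b B y} → A ≤ b → Rng a A (suc b) B y → Compat (L b) y
  L-compat h (rS p q) = inj₂ (z≤n , z≤n , <-≤-trans q h)
  L-compat h (rL p q) = inj₁ (≤-refl , z≤n , p)

  zSL-compat : ∀ a b j → a + j ≤ b → AllPairs Compat (zSL a b j)
  zSL-compat a b zero    h = []
  zSL-compat a b (suc j) h =
    (inj₁ (z≤n , z≤n , +s≤⇒< h) ∷ All.map (λ r → S-below (+s≤⇒< h) (rng-low ≤-refl (n≤1+n b) r)) r)
    ∷ All.map (L-compat (+s≤⇒ h)) r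
    ∷ zSL-compat (suc a) (suc b) j (m≤n⇒m≤1+n (+s≤⇒ h))
    where r = rng-zSL (suc a) (suc b) j ≤-refl ≤-refl

  zLS-compat : ∀ a b j → a + j ≤ b → AllPairs Compat (zLS a b j)
  zLS-compat a b zero    h = []
  zLS-compat a b (suc j) h =
    (inj₂ (z≤n , z≤n , +s≤⇒< h) ∷ All.map (L-compat (+s≤⇒ h)) r)
    ∷ All.map (λ r → S-below (+s≤⇒< h) (rng-low ≤-refl (n≤1+n b) r)) r
    ∷ zLS-compat (suc a) (suc b) j (m≤n⇒m≤1+n (+s≤⇒ h))
    where r = rng-zLS (suc a) (suc b) j ≤-refl ≤-refl

  len-zSL : ∀ a b j → length (zSL a b j) ≡ twice j
  len-zSL a b zero    = refl
  len-zSL a b (suc j) = cong (λ n → suc (suc n)) (len-zSL (suc a) (suc b) j)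

  len-zLS : ∀ a b j → length (zLS a b j) ≡ twice j
  len-zLS a b zero    = refl
  len-zLS a b (suc j) = cong (λ n → suc (suc n)) (len-zLS (suc a) (suc b) j)

  -- The pattern `L` is reused here for sums: one large label and no Q-label.
  up : ℕ → ℕ → List Lab
  up s zero    = []
  up s (suc k) = L s ∷ up (suc s) k

  -- From one sum to the next, one of the two labels is replaced by its successor in the same class,
  -- so the sums are consecutive numbers.
  sums-S∷zLS : ∀ a b j → sums (S a ∷ zLS (suc a) b j) ≡ up (a + b) (twice j)
  sums-S∷zLS a b zero    = refl
  sums-S∷zLS a b (suc j) = cong₂ (λ x ys → L (a + b) ∷ L x ∷ ys)
    (trans (+-suc b a) (cong suc (+-comm b a)))
    (trans (sums-S∷zLS (suc a) (suc b) j) (cong (λ n → up (suc n) (twice j)) (+-suc a b)))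

  sums-L∷zSL : ∀ a b j → sums (L b ∷ zSL a (suc b) j) ≡ up (a + b) (twice j)
  sums-L∷zSL a b zero    = refl
  sums-L∷zSL a b (suc j) = cong₂ _∷_ (cong ⟨ 1 , 0 ,_⟩ (+-comm b a)) (cong₂ _∷_ (cong ⟨ 1 , 0 ,_⟩ (+-suc a b))
    (trans (sums-L∷zSL (suc a) (suc b) j) (cong (λ n → up (suc n) (twice j)) (+-suc a b))))

  sums-zLS : ∀ a b j → sums (zLS a b (suc j)) ≡ up (a + b) (suc (twice j))
  sums-zLS a b j = cong₂ _∷_ (cong ⟨ 1 , 0 ,_⟩ (+-comm b a))
    (trans (sums-S∷zLS a (suc b) j) (cong (λ n → up n (twice j)) (+-suc a b)))

  data InUp (s e : ℕ) : Lab → Set where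
    inUp : ∀ {x} → s ≤ x → x < e → InUp s e (L x)

  in-up : ∀ s k {e} → s + k ≤ e → All (InUp s e) (up s k)
  in-up s zero    h = []
  in-up s (suc k) h = inUp ≤-refl (+s≤⇒< h)
    ∷ All.map (λ { (inUp p q) → inUp (≤-trans (n≤1+n s) p) q }) (in-up (suc s) k (+s≤⇒ h))

  up-compat : ∀ s k → AllPairs Compat (up s k)
  up-compat s zero    = []
  up-compat s (suc k) = All.map (λ { (inUp p q) → inj₁ (≤-refl , z≤n , p) }) (in-up (suc s) k ≤-refl)
    ∷ up-compat (suc s) k

  -- What an insertion has to know about a zigzag with `c` small and `d` large labels. Since each of
  -- its sums has one large label, `lo` is exactly `innP`; `hi` is the bound used against the old
  -- sums.
  record Zig (P′ c d : ℕ) (xs : List Lab) : Set where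
    field
      zlab : AllPairs Compat xs
      zrng : All (Rng 1 (suc c) (suc P′) (suc (P′ + d))) xs
      zlen : length xs ≡ c + d
      s k  : ℕ
      zsum : sums xs ≡ up s k
      lo   : suc P′ < s
      hi   : s + k ≤ suc (P′ + c + d)

  -- The lengths are `2j + 1`, `2j + 2` and `2j + 1`. A leg has to end in a small label, so parity
  -- decides the class of its hub label; an odd core can have large labels at both ends.
  legO legE coreO : ℕ → ℕ → List Lab
  legO  P′ j = S 1 ∷ zLS 2 (suc P′) j
  legE  P′ j = zLS 1 (suc P′) (suc j)
  coreO P′ j = L (suc P′) ∷ zSL 1 (suc (suc P′)) j

  -- A core of length two with the classes opposite to those of `legE`: the small label is at the
  -- first hub.
  coreS : ℕ → List Lab
  coreS P′ = S 1 ∷ L (suc P′) ∷ []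

  private
    2+ : ∀ P j → suc (suc P) + twice j ≡ suc (P + suc j + j)
    2+ P j rewrite twice≡ j = lem P j where
      lem : ∀ P j → suc (suc P) + (j + j) ≡ suc (P + suc j + j)
      lem = solve-∀

  legO-zig : ∀ P′ j → suc j ≤ P′ → Zig P′ (suc j) j (legO P′ j)
  legO-zig P′ j h = record
    { zlab = All.map (λ r → S-below (s≤s (≤-trans (s≤s z≤n) h)) r) r ∷ zLS-compat 2 (suc P′) j (s≤s h)
    ; zrng = rS ≤-refl (s≤s (s≤s z≤n)) ∷ All.map (rng-low (n≤1+n 1) ≤-refl) (rng-zLS 2 (suc P′) j ≤-refl ≤-refl)
    ; zlen = trans (cong suc (len-zLS 2 (suc P′) j)) (cong suc (twice≡ j))
    ; s = 1 + suc P′ ; k = twice j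
    ; zsum = sums-S∷zLS 1 (suc P′) j
    ; lo = ≤-refl
    ; hi = ≤-reflexive (2+ P′ j)
    }
    where r = rng-zLS 2 (suc P′) j ≤-refl ≤-refl

  legE-zig : ∀ P′ j → suc j ≤ P′ → Zig P′ (suc j) (suc j) (legE P′ j)
  legE-zig P′ j h = record
    { zlab = zLS-compat 1 (suc P′) (suc j) (s≤s h)
    ; zrng = rng-zLS 1 (suc P′) (suc j) ≤-refl ≤-refl
    ; zlen = trans (len-zLS 1 (suc P′) (suc j)) (twice≡ (suc j))
    ; s = 1 + suc P′ ; k = suc (twice j)
    ; zsum = sums-zLS 1 (suc P′) j
    ; lo = ≤-refl
    ; hi = ≤-reflexive (trans (+-suc (suc (suc P′)) (twice j)) (trans (cong suc (2+ P′ j))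
             (cong suc (sym (+-suc (P′ + suc j) j)))))
    }

  coreO-zig : ∀ P′ j → j ≤ P′ → Zig P′ j (suc j) (coreO P′ j)
  coreO-zig P′ j h = record
    { zlab = All.map (λ r → L-compat (s≤s h) r) (rng-zSL 1 (suc (suc P′)) j ≤-refl ≤-refl)
        ∷ zSL-compat 1 (suc (suc P′)) j (s≤s (m≤n⇒m≤1+n h))
    ; zrng = rL ≤-refl (s≤s (≤-trans (≤-reflexive (+-comm 1 P′)) (+-monoʳ-≤ P′ (s≤s z≤n))))
        ∷ All.map (rng-low ≤-refl (n≤1+n _)) (rng-zSL 1 (suc (suc P′)) j ≤-refl (≤-reflexive (cong suc (sym (+-suc P′ j)))))
    ; zlen = trans (cong suc (len-zSL 1 (suc (suc P′)) j)) (trans (cong suc (twice≡ j)) (sym (+-suc j j)))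
    ; s = 1 + suc P′ ; k = twice j
    ; zsum = sums-L∷zSL 1 (suc P′) j
    ; lo = ≤-refl
    ; hi = ≤-reflexive (trans (2+ P′ j) (cong suc (trans (cong (_+ j) (+-suc P′ j)) (sym (+-suc (P′ + j) j)))))
    }

  coreS-zig : ∀ P′ → 1 ≤ P′ → Zig P′ 1 1 (coreS P′)
  coreS-zig P′ h = record
    { zlab = (inj₁ (z≤n , z≤n , s≤s h) ∷ []) ∷ [] ∷ []
    ; zrng = rS ≤-refl ≤-refl ∷ rL ≤-refl (s≤s (≤-reflexive (+-comm 1 P′))) ∷ []
    ; zlen = refl
    ; s = 1 + suc P′ ; k = 1
    ; zsum = refl
    ; lo = ≤-refl
    ; hi = ≤-reflexive (lem P′)
    }
    where
    lem : ∀ P → 1 + suc P + 1 ≡ suc (P + 1 + 1)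
    lem = solve-∀

  EndS-zLS : ∀ x a b j → EndS (x ∷ zLS a b (suc j))
  EndS-zLS x a b zero    = more (more end)
  EndS-zLS x a b (suc j) = more (more (EndS-zLS (S a) (suc a) (suc b) j))

  EndS-legO : ∀ P′ j → EndS (legO P′ j)
  EndS-legO P′ zero    = end
  EndS-legO P′ (suc j) = EndS-zLS (S 1) 2 (suc P′) j

  EndS-tail : ∀ {x y ys} → EndS (x ∷ y ∷ ys) → EndS (y ∷ ys)
  EndS-tail (more e) = e

  EndS-legE : ∀ P′ j → EndS (legE P′ j)
  EndS-legE P′ j = EndS-tail (EndS-zLS (S 0) 1 (suc P′) j)

  -- An inner sum without a large label rises by no more than `2 * c` when a zigzag with no other
  -- new labels comes in, and need not remain above the new sums.
  Pure : Config → Set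
  Pure cfg = All (λ w → 1 ≤ lv w) (inner cfg)

  -- The sums of an S- and an L-label stay below P + R and those of an L- and a Q-label above it,
  -- which leaves room for the sum next to a new Q-label.
  data NW (P R : ℕ) : Lab → Set where
    sl : ∀ {a} → a ≤ P + R → NW P R ⟨ 1 , 0 , a ⟩
    lq : ∀ {a} → P + R + 2 ≤ a → NW P R ⟨ 2 , 1 , a ⟩

  -- The additional case is a small label next to a Q-label. It arises when an even leg of `v` gets
  -- a small hub label followed by a Q-label.
  data XW (P R : ℕ) : Lab → Set where
    nw : ∀ {w} → NW P R w → XW P R w
    sx : ∀ {a} → a ≤ P + R → XW P R ⟨ 1 , 1 , a ⟩

  NW-pure : ∀ {P R w} → NW P R w → 1 ≤ lv w
  NW-pure (sl _) = s≤s z≤n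
  NW-pure (lq _) = s≤s z≤n

  module _ {P R m c d : ℕ} where
    open Step P R m c 0 d 0

    private
      rng⇒new : ∀ {y} → Rng 1 (suc c) (suc P′) (suc (P′ + d)) y → New y
      rng⇒new (rS p (s≤s q)) = newS p q
      rng⇒new (rL p (s≤s q)) = newL p q

    insert-ok : ∀ {cfg K xs} → Inv P R m cfg → Pure cfg → Zig P′ c d xs → PieceOK (K , xs) →
                NewOK cfg ((K , xs) ∷ [])
    insert-ok {cfg} {K} {xs} I pure z ok = record
      { nlab    = subst (AllPairs Compat) (sym (++-identityʳ xs)) zlab
      ; ncls    = subst (All New) (sym (++-identityʳ xs)) (All.map rng⇒new zrng)
      ; nlen    = trans (cong length (++-identityʳ xs)) (trans zlen (sym (+-identityʳ _)))
      ; ninn    = subst (AllPairs Compat) (sym e) (up-compat s k)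
      ; ninnP   = subst (All _) (sym e) (All.map low (in-up s k ≤-refl))
      ; ncross  = subst (All _) (sym e) (All.map (λ i → All.zipWith (λ {w} → cross i w) (Inv.innP I , pure)) (in-up s k ≤-refl))
      ; nroom   = All.map (λ _ → z≤n) pure
      ; npieces = ok ∷ []
      }
      where
      open Zig z
      e : inner ((K , xs) ∷ []) ≡ up s k
      e = trans (++-identityʳ (sums xs)) zsum
      low : ∀ {w} → InUp s (s + k) w → P′ + lv w < val w
      low (inUp p q) = ≤-trans (s≤s (≤-reflexive (+-comm P′ 1))) (≤-trans lo p)
      cross : ∀ {y} → InUp s (s + k) y → ∀ w → P + lv w < val w × 1 ≤ lv w → Compat y (sh 2 c μ 0 w)
      cross (inUp {x} p q) w (h , l) = inj₁ (l , z≤n ,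
        ins-bound x P c d (lv w) (val w) (lv w * d) (tp w * 0) (≤-pred (≤-trans q hi)) h l
          (≤-trans (≤-reflexive (sym (*-identityˡ d))) (*-monoˡ-≤ d l)))

  private
    1*≤ : ∀ {l} μ → 1 ≤ l → μ ≤ l * μ
    1*≤ μ h = ≤-trans (≤-reflexive (sym (*-identityˡ μ))) (*-monoˡ-≤ μ h)

  module InsertQ {P R m c d : ℕ} where
    open Step P R m c 0 d 1

    private
      rng⇒new : ∀ {y} → Rng 1 (suc c) (suc P′) (suc (P′ + d)) y → New y
      rng⇒new (rS p (s≤s q)) = newS p q
      rng⇒new (rL p (s≤s q)) = newL p q

      c+d≤R′ : c + d ≤ R′
      c+d≤R′ = ≤-trans (m≤n+m (c + d) R) (≤-reflexive (sym (+-assoc R c d)))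

    -- The Q-label in front creates one sum with two large labels, of value `P′ + R′ + 2`. By `NW`
    -- it lies above all shifted sums with one large label and below all shifted sums with two.
    insertQ-ok : ∀ {cfg K ys} → Inv P R m cfg → All (NW P R) (inner cfg) →
                 Zig P′ c d (L (suc P′) ∷ ys) → PieceOK (K , Q (suc R′) ∷ L (suc P′) ∷ ys) →
                 NewOK cfg ((K , Q (suc R′) ∷ L (suc P′) ∷ ys) ∷ [])
    insertQ-ok {cfg} {K} {ys} I nws z ok = record
      { nlab    = subst (AllPairs Compat) (sym (++-identityʳ _)) (All.map top zrng ∷ zlab)
      ; ncls    = subst (All New) (sym (++-identityʳ _))
                    (newQ ≤-refl (≤-reflexive (+-comm 1 R′)) ∷ All.map rng⇒new zrng)
      ; nlen    = trans (cong length (++-identityʳ xs)) (trans (cong suc zlen) (+-comm 1 (c + d)))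
      ; ninn    = subst (AllPairs Compat) (sym e) (All.map (λ { (inUp p q) →
                    inj₂ (s≤s z≤n , z≤n , up<lq _ R′ P′ c d (≤-pred (≤-trans q hi)) c+d≤R′) }) (in-up s k ≤-refl)
                    ∷ up-compat s k)
      ; ninnP   = subst (All _) (sym e) (lq-new R′ P′ d d≥1 (≤-trans (m≤n+m d c) c+d≤R′)
                    ∷ All.map low (in-up s k ≤-refl))
      ; ncross  = subst (All _) (sym e) (All.map crossQ nws
                    ∷ All.map (λ i → All.zipWith (λ {w} → cross i w) (Inv.innP I , nws)) (in-up s k ≤-refl))
      ; nroom   = All.map (λ _ → z≤n) nws
      ; npieces = ok ∷ []
      }
      where
      open Zig z
      xs = Q (suc R′) ∷ L (suc P′) ∷ ys
      d≥1 : 1 ≤ d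
      -- The zigzag begins with the large label `suc P′`, so the range of its large labels is not
      -- empty.
      d≥1 with zrng
      ... | rL _ (s≤s q) ∷ _ = +-cancelˡ-≤ P′ 1 d (≤-trans (≤-reflexive (+-comm P′ 1)) q)
      e : inner ((K , xs) ∷ []) ≡ ⟨ 2 , 1 , suc R′ + suc P′ ⟩ ∷ up s k
      e = trans (++-identityʳ (sums xs)) (cong (_ ∷_) zsum)
      top : ∀ {y} → Rng 1 (suc c) (suc P′) (suc (P′ + d)) y → Compat (Q (suc R′)) y
      top (rS p q) = inj₂ (z≤n , z≤n , ≤-trans q (s≤s (≤-trans (m≤m+n c d) c+d≤R′)))
      top (rL p q) = inj₂ (≤-refl , z≤n , ≤-trans q (s≤s (P′≤R′ (Inv.P≤R I))))
      low : ∀ {w} → InUp s (s + k) w → P′ + lv w < val w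
      low (inUp p q) = ≤-trans (s≤s (≤-reflexive (+-comm P′ 1))) (≤-trans lo p)
      crossQ : ∀ {w} → NW P R w → Compat ⟨ 2 , 1 , suc R′ + suc P′ ⟩ (sh 2 c μ 1 w)
      crossQ (sl {a} h) = inj₂ (s≤s z≤n , z≤n , sl<lq a P R c d h)
      crossQ (lq {a} h) = inj₁ (≤-refl , ≤-refl , lq<lq a P R c d 0 h)
      cross : ∀ {y} → InUp s (s + k) y → ∀ w → P + lv w < val w × NW P R w → Compat y (sh 2 c μ 1 w)
      cross (inUp {x} p q) w (h , n) = inj₁ (NW-pure n , z≤n ,
        ins-bound x P c d (lv w) (val w) (lv w * d) (tp w * 1) (≤-pred (≤-trans q hi)) h (NW-pure n) (1*≤ d (NW-pure n)))

    lq-sums : ∀ {K ys} → (z : Zig P′ c d (L (suc P′) ∷ ys)) →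
      inner ((K , Q (suc R′) ∷ L (suc P′) ∷ ys) ∷ []) ≡ ⟨ 2 , 1 , suc R′ + suc P′ ⟩ ∷ up (Zig.s z) (Zig.k z)
    lq-sums z = trans (++-identityʳ _) (cong (_ ∷_) (Zig.zsum z))

  module _ {P R m c d ν : ℕ} where
    open Step P R m c 0 d ν

    NW-sh : ∀ {w} → NW P R w → NW P′ R′ (sh 2 c μ ν w)
    NW-sh (sl {a} h) = sl (sl-sh a P R c d h)
    NW-sh (lq {a} h) = lq (lq-sh a P R c d ν h)

    NW-up : ∀ {s k w} → s + k ≤ suc (P′ + c + d) → InUp s (s + k) w → NW P′ R′ w
    NW-up hi (inUp p q) = sl (up≤PR _ R′ P′ c d (≤-pred (≤-trans q hi))
      (≤-trans (m≤n+m (c + d) R) (≤-reflexive (sym (+-assoc R c d)))))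

  module XP (P R m j : ℕ) where
    open Step P R m (suc j) 2 (suc j) 1 public

    -- The hub label of the leg of `v` is one less than the label `P′` that `u` receives. The sums
    -- on the two sides of the Q-label are `P′ + R′` and `P′ + R′ + 2`, just below and just above
    -- the gap that `NW` keeps open.
    xpN : Config
    xpN = (vK , S (suc (P + suc j)) ∷ Q (suc R′) ∷ legE P′ j) ∷ (uK , S P′ ∷ []) ∷ []

    private
      c = suc j
      z : Zig P′ c c (legE P′ j)
      z = legE-zig P′ j (≤-trans (m≤n+m c P) (m≤m+n (P + c) 2))
      open Zig z
      rng⇒new : ∀ {y} → Rng 1 (suc c) (suc P′) (suc (P′ + c)) y → New y
      rng⇒new (rS p (s≤s q)) = newS p q
      rng⇒new (rL p (s≤s q)) = newL p q
      c≤P′ : c ≤ P + c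
      c≤P′ = m≤n+m c P
      P′≥ : P + c ≤ P′
      P′≥ = m≤m+n (P + c) 2

    module _ (pr : P ≤ R) where
      private
        P′R : P′ < suc R′
        P′R = s≤s (≤-trans (m≤m+n P′ c) (P′≤R′ pr))

        topx : ∀ {y} → Rng 1 (suc c) (suc P′) (suc (P′ + c)) y → Compat (S (suc (P + c))) y
        topx (rS p q) = inj₂ (z≤n , z≤n , ≤-trans q (s≤s c≤P′))
        topx (rL p q) = inj₁ (z≤n , z≤n , ≤-trans (s≤s (x≤P′ P c)) p)
        topp : ∀ {y} → Rng 1 (suc c) (suc P′) (suc (P′ + c)) y → Compat y (S P′)
        topp (rS p q) = inj₁ (z≤n , z≤n , ≤-trans q (≤-trans (s≤s c≤P′) (x≤P′ P c)))
        topp (rL p q) = inj₂ (z≤n , z≤n , p)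
        topq : ∀ {y} → Rng 1 (suc c) (suc P′) (suc (P′ + c)) y → Compat (Q (suc R′)) y
        topq (rS p q) = inj₂ (z≤n , z≤n , ≤-trans q (≤-trans (s≤s (≤-trans c≤P′ P′≥)) P′R))
        topq (rL p q) = inj₂ (≤-refl , z≤n , ≤-trans q (s≤s (P′≤R′ pr)))

        x<P′ : suc (P + c) < P′
        x<P′ = ≤-reflexive (+-comm 2 (P + c))

      xp-labels : AllPairs Compat (labels xpN)
      xp-labels =
        (inj₁ (z≤n , z≤n , ≤-trans (s≤s (x≤P′ P c)) P′R) ∷ Allₚ.++⁺ (All.map topx zrng) (inj₁ (z≤n , z≤n , x<P′) ∷ []))
        ∷ Allₚ.++⁺ (All.map topq zrng) (inj₂ (z≤n , z≤n , P′R) ∷ [])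
        ∷ APₚ.++⁺ zlab ([] ∷ []) (All.map (λ r → topp r ∷ []) zrng)

      xp-new : All New (labels xpN)
      xp-new = newT ≤-refl (x≤P′ P c) ∷ newQ ≤-refl (≤-reflexive (+-comm 1 R′))
        ∷ Allₚ.++⁺ (All.map rng⇒new zrng) (newT (≤-trans (s≤s (n≤1+n _)) x<P′) ≤-refl ∷ [])

    xp-inner : inner xpN ≡ ⟨ 1 , 1 , suc (P + c) + suc R′ ⟩ ∷ ⟨ 2 , 1 , suc R′ + suc P′ ⟩ ∷ up s k
    xp-inner = cong (λ zs → ⟨ 1 , 1 , suc (P + c) + suc R′ ⟩ ∷ ⟨ 2 , 1 , suc R′ + suc P′ ⟩ ∷ zs) (trans (++-identityʳ _) zsum)

    private
      c+c≤R′ : c + c ≤ R′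
      c+c≤R′ = ≤-trans (m≤n+m (c + c) R) (≤-trans (≤-reflexive (sym (+-assoc R c c))) (+-monoʳ-≤ (R + c) (m≤n+m c 2)))

    xp-ok : ∀ {cfg} → Inv P R m cfg → All (XW P R) (inner cfg) → NewOK cfg xpN
    xp-ok {cfg} I xws = record
      { nlab    = xp-labels (Inv.P≤R I)
      ; ncls    = xp-new (Inv.P≤R I)
      ; nlen    = trans (cong (λ n → suc (suc n)) (trans (length-++ (legE P′ j)) (cong (_+ 1) zlen))) (lem c)
      ; ninn    = subst (AllPairs Compat) (sym xp-inner)
          ((inj₁ (s≤s z≤n , ≤-refl , sx<lq P R c c) ∷ All.map (λ { (inUp p q) →
             inj₂ (≤-refl , z≤n , up<sx _ P R c c (≤-pred (≤-trans q hi))) }) (in-up s k ≤-refl))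
           ∷ All.map (λ { (inUp p q) →
             inj₂ (s≤s z≤n , z≤n , up<lq _ R′ P′ c c (≤-pred (≤-trans q hi)) c+c≤R′) }) (in-up s k ≤-refl)
           ∷ up-compat s k)
      ; ninnP   = subst (All _) (sym xp-inner) (sx-P P R c c (s≤s z≤n)
          ∷ lq-new R′ P′ c (s≤s z≤n) (≤-trans (m≤n+m c c) c+c≤R′) ∷ All.map low (in-up s k ≤-refl))
      ; ncross  = subst (All _) (sym xp-inner) (All.map crossX xws ∷ All.map crossQ xws
          ∷ All.map (λ i → All.zipWith (λ {w} → cross i w) (Inv.innP I , xws)) (in-up s k ≤-refl))
      ; nroom   = All.map room xws
      ; npieces = okV (more (EndS-zLS (Q (suc R′)) 1 (suc P′) j)) ∷ okU end ∷ []
      }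
      where
      lem : ∀ c → suc (suc (c + c + 1)) ≡ c + (2 + c) + 1
      lem = solve-∀
      pure : ∀ {w} → XW P R w → 1 ≤ lv w
      pure (nw n) = NW-pure n
      pure (sx _) = ≤-refl
      low : ∀ {w} → InUp s (s + k) w → P′ + lv w < val w
      low (inUp p q) = ≤-trans (s≤s (≤-reflexive (+-comm P′ 1))) (≤-trans lo p)
      room : ∀ {w} → XW P R w → 2 ≤ c + lv w * μ
      room {w} x = ≤-trans (≤-trans (m≤m+n 2 c) (1*≤ μ (pure x))) (m≤n+m _ c)
      crossX : ∀ {w} → XW P R w → Compat ⟨ 1 , 1 , suc (P + c) + suc R′ ⟩ (sh 2 c μ 1 w)
      crossX (nw (sl {a} h)) = inj₂ (≤-refl , z≤n , xp-sl a P R c c h)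
      crossX (nw (lq {a} h)) = inj₁ (s≤s z≤n , ≤-refl , <-trans (sx<lq P R c c) (xp-lq a P R c c h))
      crossX (sx {a} h)      = inj₂ (≤-refl , ≤-refl , xp-sx a P R c c h)
      crossQ : ∀ {w} → XW P R w → Compat ⟨ 2 , 1 , suc R′ + suc P′ ⟩ (sh 2 c μ 1 w)
      crossQ (nw (sl {a} h)) = inj₂ (s≤s z≤n , z≤n , <-trans (xp-sl a P R c c h) (sx<lq P R c c))
      crossQ (nw (lq {a} h)) = inj₁ (≤-refl , ≤-refl , xp-lq a P R c c h)
      crossQ (sx {a} h)      = inj₂ (s≤s z≤n , ≤-refl , <-trans (xp-sx a P R c c h) (sx<lq P R c c))
      cross : ∀ {y} → InUp s (s + k) y → ∀ w → P + lv w < val w × XW P R w → Compat y (sh 2 c μ 1 w)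
      cross (inUp {x} p q) w (h , n) = inj₁ (pure n , z≤n ,
        xp-bound x P c c (lv w) (val w) (lv w * μ) (tp w * 1) (≤-pred (≤-trans q hi)) h (pure n) (1*≤ μ (pure n)))

    xp-XW : ∀ {cfg} → All (XW P R) (inner cfg) → All (XW P′ R′) (inner (xpN ++ shC c μ 1 cfg))
    xp-XW {cfg} xws = subst (All _) (sym (inner-step c μ 1 xpN cfg))
      (Allₚ.++⁺ (subst (All _) (sym xp-inner) (sx (sx-val P R c c)
          ∷ nw (lq (≤-reflexive (lem R′ P′)))
          ∷ All.map (λ { (inUp p q) → nw (sl (up≤PR _ R′ P′ c c (≤-pred (≤-trans q hi)) c+c≤R′)) }) (in-up s k ≤-refl)))
        (Allₚ.map⁺ (All.map old xws)))
      where
      lem : ∀ R P → P + R + 2 ≡ suc R + suc P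
      lem = solve-∀
      old : ∀ {w} → XW P R w → XW P′ R′ (sh 2 c μ 1 w)
      old (nw (sl {a} h)) = nw (sl (xp-sl′ a P R c c 0 h z≤n))
      old (nw (lq {a} h)) = nw (lq (xp-lq′ a P R c c h))
      old (sx {a} h)      = sx (xp-sl′ a P R c c 1 h ≤-refl)

  module DoubleLeg (P R m : ℕ) where
    open Step P R m 2 1 0 0 public

    -- The leg of `v` gets the lowest label at the hub and the highest small one at the leaf. Its
    -- inner sum `P′ + 1` is thus just above all pendant labels and below all old sums, but as a sum
    -- of two small labels it violates `Pure`.
    dN : Config
    dN = (vK , S 1 ∷ S P′ ∷ []) ∷ (uK , S 2 ∷ []) ∷ []

    d-ok : ∀ {cfg} → Inv P R m cfg → NewOK cfg dN
    d-ok I = record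
      { nlab    = (inj₁ (z≤n , z≤n , 2≤P′) ∷ inj₁ (z≤n , z≤n , ≤-refl) ∷ []) ∷ (inj₂ (z≤n , z≤n , 3≤P′) ∷ []) ∷ [] ∷ []
      ; ncls    = newS ≤-refl (s≤s z≤n) ∷ newT (≤-reflexive (+-comm 1 (P + 2))) ≤-refl ∷ newS (s≤s z≤n) ≤-refl ∷ []
      ; nlen    = refl
      ; ninn    = [] ∷ []
      ; ninnP   = s≤s (≤-reflexive (+-identityʳ P′)) ∷ []
      ; ncross  = All.map (λ {w} h → inj₁ (z≤n , z≤n , d-cross P (lv w) (val w) _ h)) (Inv.innP I) ∷ []
      ; nroom   = All.map (λ _ → s≤s z≤n) (Inv.innP I)
      ; npieces = okV (more end) ∷ okU end ∷ []
      }
      where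
      3≤P′ : 3 ≤ P′
      3≤P′ = ≤-trans (m≤n+m 3 P) (≤-reflexive (sym (+-assoc P 2 1)))
      2≤P′ : 2 ≤ P′
      2≤P′ = ≤-trans (n≤1+n 2) 3≤P′

-- The hub sums under insertion, and the basic insertion steps.

module Insertion where

  open import Data.Nat.Properties
  open import Data.List.Properties using (concatMap-++; length-++; length-map; map-++; map-∘; map-cong)
  open import Relation.Binary.PropositionalEquality using (_≡_; refl; sym; trans; cong; subst; subst₂)
  open Arithmetic
  open Labellings
  open Zigzags

  totU totV : Config → Lab
  totU cfg = total (hubU cfg)
  totV cfg = total (hubV cfg)

  numU numV : Config → ℕ
  numU cfg = length (hubU cfg)
  numV cfg = length (hubV cfg)

  -- A hub sum rises by `c` per label and by `μ` per large label. Thus `nn` measures what `u` gains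
  -- in a shift and `lvs` what it can lose; the bound on `lv w` prevents an inner sum from
  -- overtaking `v`.
  record Ord (P : ℕ) (cfg : Config) : Set where
    field
      V<U : val (totV cfg) < val (totU cfg)
      P<V : P < val (totV cfg)
      W<V : All (λ w → val w < val (totV cfg) × lv w ≤ suc (lv (totV cfg))) (inner cfg)
      lvs : lv (totV cfg) ≤ lv (totU cfg) + 2
      3≤  : 3 ≤ numV cfg
      nn  : numV cfg < numU cfg

  module Hub {cfg : Config} (ok : All PieceOK cfg) (c μ ν : ℕ) (N : Config) where

    next : Config
    next = N ++ shC c μ ν cfg

    private
      eU : hubU next ≡ hubU N ++ map (sh 1 c μ ν) (hubU cfg)
      eU = trans (concatMap-++ atU N _) (cong (hubU N ++_) (hubU-sh c μ ν ok))
      eV : hubV next ≡ hubV N ++ map (sh 1 c μ ν) (hubV cfg)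
      eV = trans (concatMap-++ atV N _) (cong (hubV N ++_) (hubV-sh c μ ν ok))

    totU-next : totU next ≡ totU N ⊕ sh (numU cfg) c μ ν (totU cfg)
    totU-next = trans (cong total eU) (trans (total-++ (hubU N) _) (cong (totU N ⊕_) (total-sh c μ ν (hubU cfg))))

    totV-next : totV next ≡ totV N ⊕ sh (numV cfg) c μ ν (totV cfg)
    totV-next = trans (cong total eV) (trans (total-++ (hubV N) _) (cong (totV N ⊕_) (total-sh c μ ν (hubV cfg))))

    numU-next : numU next ≡ numU N + numU cfg
    numU-next = trans (cong length eU) (trans (length-++ (hubU N)) (cong (numU N +_) (length-map _ (hubU cfg))))

    numV-next : numV next ≡ numV N + numV cfg
    numV-next = trans (cong length eV) (trans (length-++ (hubV N)) (cong (numV N +_) (length-map _ (hubV cfg))))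

  -- Unlike `Kind` this forgets the direction in which the core is listed, so that the shape depends
  -- on the tree alone.
  data Tag : Set where
    uT vT cT : Tag

  tag : Kind → Tag
  tag uK = uT
  tag vK = vT
  tag cK = cT
  tag rK = cT

  shape : Config → List (Tag × ℕ)
  shape = map (λ p → tag (proj₁ p) , length (proj₂ p))

  shape-sh : ∀ c μ ν cfg → shape (shC c μ ν cfg) ≡ shape cfg
  shape-sh c μ ν cfg = trans (sym (map-∘ cfg)) (map-cong (λ p → cong (_ ,_) (length-map _ (proj₂ p))) cfg)

  shape-step : ∀ c μ ν N cfg → shape (N ++ shC c μ ν cfg) ≡ shape N ++ shape cfg
  shape-step c μ ν N cfg = trans (map-++ _ N _) (cong (shape N ++_) (shape-sh c μ ν cfg))

  spider : List ℕ → List ℕ → ℕ → List (Tag × ℕ)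
  spider U V κ = (cT , κ) ∷ map (uT ,_) U ++ map (vT ,_) V

  spider-u : ∀ x U V κ → (uT , x) ∷ spider U V κ ↭ spider (x ∷ U) V κ
  spider-u x U V κ = swap _ _ ↭-refl

  spider-v : ∀ x U V κ → (vT , x) ∷ spider U V κ ↭ spider U (x ∷ V) κ
  spider-v x U V κ = ↭-trans (swap _ _ ↭-refl) (prep _ (↭-sym (Perm.shift (vT , x) (map (uT ,_) U) _)))

  spider-resp : ∀ {U U′ V V′} κ → U ↭ U′ → V ↭ V′ → spider U V κ ↭ spider U′ V′ κ
  spider-resp κ p q = prep _ (Perm.++⁺ (Perm.map⁺ _ p) (Perm.map⁺ _ q))

  record Result (U V : List ℕ) (κ : ℕ) : Set where
    field
      {P R m} : ℕ
      cfg     : Config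
      inv     : Inv P R m cfg
      ord     : Ord P cfg
      shp     : shape cfg ↭ spider U V κ
      nU      : numU cfg ≡ suc (length U)
      nV      : numV cfg ≡ suc (length V)
      -- Inner sums of two small labels come only from `addD` and from one explicit configuration,
      -- where `u` has a leg of length one and `v` a leg of length two.
      pure    : 1 ∉ U ⊎ 2 ∉ V → Pure cfg

  Result-resp : ∀ {U U′ V V′ κ} → U ↭ U′ → V ↭ V′ → Result U V κ → Result U′ V′ κ
  Result-resp p q r = record
    { cfg = cfg ; inv = inv ; ord = ord
    ; shp = ↭-trans shp (spider-resp _ p q)
    ; nU = trans nU (cong suc (↭-length p)) ; nV = trans nV (cong suc (↭-length q))
    ; pure = pure ∘ Sum.map (_∘ ∈-resp-↭ p) (_∘ ∈-resp-↭ q) }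
    where open Result r

  Pure-step : ∀ c μ ν N cfg → Pure N → Pure cfg → Pure (N ++ shC c μ ν cfg)
  Pure-step c μ ν N cfg p q = subst (All _) (sym (inner-step c μ ν N cfg)) (Allₚ.++⁺ p (Allₚ.map⁺ q))

  one-ok : ∀ {P R m cfg} K → (∀ {xs} → EndS xs → PieceOK (K , xs)) → Inv P R m cfg →
           Step.NewOK P R m 1 0 0 0 cfg ((K , S 1 ∷ []) ∷ [])
  one-ok K ok I = record
    { nlab = [] ∷ [] ; ncls = newS ≤-refl ≤-refl ∷ [] ; nlen = refl
    ; ninn = [] ; ninnP = [] ; ncross = [] ; nroom = All.map (λ _ → z≤n) (Inv.innP I)
    ; npieces = ok end ∷ [] }
    where open Step

  -- The sum at v outgrows every inner sum when at least three labels at v are raised by c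
  -- and the raise μ of the L-labels is at most c.
  module Grow {P R m c d : ℕ} {cfg : Config} (I : Inv P R m cfg) (O : Ord P cfg) (d≤c : d ≤ c) (N : Config) where
    open Step P R m c 0 d 0
    open Ord O
    open Hub {cfg} (Inv.pieces I) c μ 0 N

    private
      3c : 3 * c ≤ numV cfg * c
      3c = *-monoˡ-≤ c 3≤

    V≥ : ∀ {x} → x < val (sh (numV cfg) c μ 0 (totV cfg)) → x < val (totV next)
    V≥ {x} h = subst (λ y → x < val y) (sym totV-next) (<-≤-trans h (m≤n+m _ (val (totV N))))

    lvV≥ : ∀ {x} → x ≤ suc (lv (totV cfg)) → x ≤ suc (lv (totV next))
    lvV≥ {x} h = subst (λ y → x ≤ suc (lv y)) (sym totV-next) (≤-trans h (s≤s (m≤n+m _ (lv (totV N)))))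

    P<V′ : P′ < val (totV next)
    P<V′ = V≥ (P-new (val (totV cfg)) P c _ _ P<V 3c)

    W<V′ : All (λ w → val w ≤ P′ + c + d × lv w ≤ 1) (inner N) →
           All (λ w → val w < val (totV next) × lv w ≤ suc (lv (totV next))) (inner next)
    W<V′ new = subst (All _) (sym (inner-step c μ 0 N cfg))
      (Allₚ.++⁺ (All.map (λ { {w} (h , l) → V≥ (w-new (val w) (val (totV cfg)) P c d _ _ h P<V 3c d≤c)
                                       , ≤-trans l (s≤s z≤n) }) new)
        (Allₚ.map⁺ (All.map (λ { {w} (h , l) → V≥ (w-old (val w) (val (totV cfg)) c d _ _ (tp (totV cfg) * 0) (lv w * d) (tp w)
            h 3c (*-monoˡ-≤ d l) d≤c)
          , lvV≥ l }) W<V)))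

  up-top : ∀ {P′ c d s k} → s + k ≤ suc (P′ + c + d) → All (λ w → val w ≤ P′ + c + d × lv w ≤ 1) (up s k)
  up-top {P′} {c} {d} {s} {k} hi = All.map (λ { (inUp p q) → ≤-pred (≤-trans q hi) , ≤-refl }) (in-up s k ≤-refl)

  zig-top : ∀ {P′ c d xs} K → Zig P′ c d xs → All (λ w → val w ≤ P′ + c + d × lv w ≤ 1) (inner ((K , xs) ∷ []))
  zig-top {P′} {c} {d} K z = Allₚ.++⁺ (subst (All _) (sym (Zig.zsum z)) (up-top {P′} {c} {d} {Zig.s z} {Zig.k z} (Zig.hi z))) []

  zig-pure : ∀ {P′ c d xs} K → Zig P′ c d xs → Pure ((K , xs) ∷ [])
  zig-pure K z = Allₚ.++⁺ (subst (All _) (sym (Zig.zsum z)) (All.map (λ { (inUp p q) → ≤-refl }) (in-up (Zig.s z) (Zig.k z) ≤-refl))) []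

  module _ {U V : List ℕ} {κ : ℕ} (r : Result U V κ) where
    open Result r
    open Ord ord
    open Inv inv using (pieces)

    private
      U₀ = totU cfg
      V₀ = totV cfg
      nv<nu : suc (length V) < length U → suc (numV cfg) < numU cfg
      nv<nu h = subst₂ _<_ (cong suc (sym nV)) (sym nU) (s≤s h)

    addU1 : Result (1 ∷ U) V κ
    addU1 = record
      { cfg  = next
      ; inv  = Step.step P R m 1 0 0 0 inv (one-ok uK okU inv)
      ; ord  = record
        { V<U = subst₂ (λ x y → val x < val y) (sym totV-next) (sym totU-next)
                  (uvU1 (val V₀) (val U₀) (numV cfg) (numU cfg) (lv V₀) (lv U₀) (tp V₀) (tp U₀) V<U nn)
        ; P<V = P<V′
        ; W<V = W<V′ []
        ; lvs = subst₂ (λ x y → lv x ≤ lv y + 2) (sym totV-next) (sym totU-next) lvs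
        ; 3≤  = subst (3 ≤_) (sym numV-next) 3≤
        ; nn  = subst₂ _<_ (sym numV-next) (sym numU-next) (m≤n⇒m≤1+n nn)
        }
      ; shp  = ↭-trans (↭-reflexive (shape-step 1 0 0 N cfg)) (↭-trans (prep _ shp) (spider-u 1 U V κ))
      ; nU   = trans numU-next (cong suc nU)
      ; nV   = trans numV-next nV
      ; pure = λ p → Pure-step 1 0 0 N cfg [] (pure (Sum.map₁ (_∘ there) p))
      }
      where
      N = (uK , S 1 ∷ []) ∷ []
      open Hub {cfg} pieces 1 0 0 N
      open Grow inv ord z≤n N

    -- The new label at `v` is only 1, so the shifts decide: two surplus large labels at `v` cost at
    -- most `2 * j`, while the two further labels that `u` has by the hypothesis on the degrees
    -- bring `2 * suc j`.
    addVodd : ∀ j → Pure cfg → suc (length V) < length U → Result U (suc (twice j) ∷ V) κ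
    addVodd j pu h = record
      { cfg  = next
      ; inv  = step inv (insert-ok inv pu z (okV (EndS-legO P′ j)))
      ; ord  = record
        { V<U = subst₂ (λ x y → val x < val y) (sym totV-next) (sym totU-next)
                  (uvV (val V₀) (val U₀) j (numV cfg * suc j) (numU cfg * suc j) (lv V₀ * j) (lv U₀ * j) (tp V₀) (tp U₀) V<U
                    (*-monoˡ-≤ (suc j) (nv<nu h))
                    (≤-trans (*-monoˡ-≤ j lvs) (≤-reflexive (*-distribʳ-+ j (lv U₀) 2))))
        ; P<V = P<V′
        ; W<V = W<V′ (zig-top vK z)
        ; lvs = subst₂ (λ x y → lv x ≤ lv y + 2) (sym totV-next) (sym totU-next) lvs
        ; 3≤  = subst (3 ≤_) (sym numV-next) (m≤n⇒m≤1+n 3≤)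
        ; nn  = subst₂ _<_ (sym numV-next) (sym numU-next) (nv<nu h)
        }
      ; shp  = ↭-trans (↭-reflexive (trans (shape-step (suc j) j 0 N cfg) (cong (λ n → (vT , n) ∷ shape cfg) (cong suc (len-zLS 2 (suc P′) j)))))
                 (↭-trans (prep _ shp) (spider-v _ U V κ))
      ; nU   = trans numU-next nU
      ; nV   = trans numV-next (cong suc nV)
      ; pure = λ _ → Pure-step (suc j) j 0 N cfg (zig-pure vK z) pu
      }
      where
      open Step P R m (suc j) 0 j 0
      N = (vK , legO P′ j) ∷ []
      z = legO-zig P′ j (≤-trans (m≤n+m (suc j) P) (≤-reflexive (sym (+-identityʳ _))))
      open Hub {cfg} pieces (suc j) j 0 N
      open Grow inv ord (n≤1+n j) N

    -- Here every label rises by 2 and every large one by 1 more. The additional label at `u` gains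
    -- 2, which repays two surplus large labels at `v`, and the new labels 2 and 1 favour `u`.
    addD : Result (1 ∷ U) (2 ∷ V) κ
    addD = record
      { cfg  = next
      ; inv  = step inv (d-ok inv)
      ; ord  = record
        { V<U = subst₂ (λ x y → val x < val y) (sym totV-next) (sym totU-next)
                  (uvD (val V₀) (val U₀) (numV cfg) (numU cfg) (lv V₀) (lv U₀) (tp V₀) (tp U₀) V<U nn lvs)
        ; P<V = subst (λ x → P′ < val x) (sym totV-next) (PD (val V₀) P _ _ P<V 6≤)
        ; W<V = subst₂ (λ x ws → All (λ w → val w < val x × lv w ≤ suc (lv x)) ws) (sym totV-next) (sym (inner-step 2 1 0 dN cfg))
                  ((wD (val V₀) P _ _ P<V 6≤ , z≤n)
                    ∷ Allₚ.map⁺ (All.map (λ { {w} (a , b) →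
                        wD-old (val w) (val V₀) (lv V₀) (lv w) (numV cfg) (tp w) 0 (tp V₀ * 0) a b 3≤ 3≤ , b }) W<V))
        ; lvs = subst₂ (λ x y → lv x ≤ lv y + 2) (sym totV-next) (sym totU-next) lvs
        ; 3≤  = subst (3 ≤_) (sym numV-next) (m≤n⇒m≤1+n 3≤)
        ; nn  = subst₂ _<_ (sym numV-next) (sym numU-next) (s≤s nn)
        }
      ; shp  = ↭-trans (↭-reflexive (shape-step 2 1 0 dN cfg)) (↭-trans (prep _ (prep _ shp))
                 (↭-trans (swap _ _ ↭-refl) (↭-trans (prep _ (spider-v 2 U V κ)) (spider-u 1 U (2 ∷ V) κ))))
      ; nU   = trans numU-next (cong suc nU)
      ; nV   = trans numV-next (cong suc nV)
      ; pure = λ { (inj₁ p) → ⊥-elim (p (here refl)) ; (inj₂ p) → ⊥-elim (p (here refl)) }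
      }
      where
      open DoubleLeg P R m
      open Hub {cfg} pieces 2 1 0 dN
      6≤ : 6 ≤ numV cfg * 2
      6≤ = *-monoˡ-≤ 2 3≤

  -- By l1 the shift of the L-labels does not favour v by more than one label, which the larger degree of u makes up for.
  module AddU {P R m : ℕ} {cfg : Config} (I : Inv P R m cfg) (O : Ord P cfg) (pu : Pure cfg)
              (l1 : lv (totV cfg) ≤ suc (lv (totU cfg))) where
    open Ord O

    module _ (c d : ℕ) (xs : List Lab) (d≤c : d ≤ c) (z : Zig (P + c + 0) c d xs) (e : EndS xs) where
      open Step P R m c 0 d 0

      private
        N : Config
        N = (uK , xs) ∷ []
        open Hub {cfg} (Inv.pieces I) c d 0 N
        open Grow I O d≤c N

      addU-inv : Inv P′ R′ m′ next
      addU-inv = step I (insert-ok I pu z (okU e))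

      addU-pure : Pure next
      addU-pure = Pure-step c d 0 N cfg (zig-pure uK z) pu

      addU-lv : lv (totV next) ≤ suc (lv (totU next))
      addU-lv = subst₂ (λ x y → lv x ≤ suc (lv y)) (sym totV-next) (sym totU-next)
        (≤-trans l1 (s≤s (m≤n+m _ (lv (totU N)))))

      addU-ord : Ord P′ next
      addU-ord = record
        { V<U = subst₂ (λ x y → val x < val y) (sym totV-next) (sym totU-next)
                  (uvU (val (totV cfg)) (val (totU cfg)) c d (numV cfg * c) (numU cfg * c) (lv (totV cfg) * d) (lv (totU cfg) * d)
                    (tp (totV cfg)) (tp (totU cfg)) (val (totU N)) V<U (*-monoˡ-≤ c nn)
                    (≤-trans (*-monoˡ-≤ d l1) (≤-reflexive (+-comm d _))) d≤c)
        ; P<V = P<V′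
        ; W<V = W<V′ (zig-top uK z)
        ; lvs = ≤-trans addU-lv (≤-trans (n≤1+n _) (≤-reflexive (+-comm 2 _)))
        ; 3≤  = subst (3 ≤_) (sym numV-next) 3≤
        ; nn  = subst₂ _<_ (sym numV-next) (sym numU-next) (m≤n⇒m≤1+n nn)
        }

-- Insertion with lengths as variables: linear forms for the sums.

module Symbolic where

  open import Data.Bool using (Bool; true; _∧_; T)
  open import Data.Bool.Properties using (T-∧)
  open import Data.Nat using (_≤ᵇ_)
  open import Data.Nat.Properties
  open import Data.Nat.Tactic.RingSolver using (solve-∀)
  open import Data.List.Relation.Unary.Any.Properties as Anyₚ using ()
  open import Function.Bundles using (Equivalence)
  open import Relation.Binary.PropositionalEquality using (_≡_; refl; sym; trans; cong; cong₂; subst; subst₂)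
  open Labellings
  open Zigzags
  open Insertion

  -- Linear forms with natural coefficients; the first coefficient is the constant term.
  Lin : Set
  Lin = List ℕ

  Env : Set
  Env = ℕ → ℕ

  dot : Lin → Env → ℕ
  dot []       ρ = 0
  dot (k ∷ ks) ρ = k * ρ 0 + dot ks (λ i → ρ (suc i))

  ev : Env → Lin → ℕ
  ev ρ []       = 0
  ev ρ (k ∷ ks) = k + dot ks ρ

  infixl 6 _+ᴸ_
  _+ᴸ_ : Lin → Lin → Lin
  []       +ᴸ ys       = ys
  (x ∷ xs) +ᴸ []       = x ∷ xs
  (x ∷ xs) +ᴸ (y ∷ ys) = (x + y) ∷ (xs +ᴸ ys)

  _·ᴸ_ : ℕ → Lin → Lin
  n ·ᴸ xs = map (n *_) xs

  #_ : ℕ → Lin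
  # n = n ∷ []

  private
    dot-+ : ∀ xs ys ρ → dot (xs +ᴸ ys) ρ ≡ dot xs ρ + dot ys ρ
    dot-+ []       ys       ρ = refl
    dot-+ (x ∷ xs) []       ρ = sym (+-identityʳ _)
    dot-+ (x ∷ xs) (y ∷ ys) ρ rewrite dot-+ xs ys (λ i → ρ (suc i)) = lem x y (ρ 0) _ _
      where
      lem : ∀ x y r a b → (x + y) * r + (a + b) ≡ x * r + a + (y * r + b)
      lem = solve-∀

    dot-· : ∀ n xs ρ → dot (n ·ᴸ xs) ρ ≡ n * dot xs ρ
    dot-· n []       ρ = sym (*-zeroʳ n)
    dot-· n (x ∷ xs) ρ rewrite dot-· n xs (λ i → ρ (suc i)) = lem n x (ρ 0) _
      where
      lem : ∀ n x r a → n * x * r + n * a ≡ n * (x * r + a)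
      lem = solve-∀

  ev-+ : ∀ ρ xs ys → ev ρ (xs +ᴸ ys) ≡ ev ρ xs + ev ρ ys
  ev-+ ρ []       ys       = refl
  ev-+ ρ (x ∷ xs) []       = sym (+-identityʳ _)
  ev-+ ρ (x ∷ xs) (y ∷ ys) rewrite dot-+ xs ys ρ = lem x y _ _
    where
    lem : ∀ x y a b → x + y + (a + b) ≡ x + a + (y + b)
    lem = solve-∀

  ev-· : ∀ ρ n xs → ev ρ (n ·ᴸ xs) ≡ n * ev ρ xs
  ev-· ρ n []       = sym (*-zeroʳ n)
  ev-· ρ n (x ∷ xs) rewrite dot-· n xs ρ = sym (*-distribˡ-+ n x _)

  ev-# : ∀ ρ n → ev ρ (# n) ≡ n
  ev-# ρ n = +-identityʳ n

  -- For an inequality meant to hold at all natural values this test loses nothing: setting all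
  -- variables to zero, or one of them large, shows that each coefficient has to be compared.
  leᴸ : Lin → Lin → Bool
  leᴸ []       ys       = true
  leᴸ (x ∷ xs) []       = (x ≤ᵇ 0) ∧ leᴸ xs []
  leᴸ (x ∷ xs) (y ∷ ys) = (x ≤ᵇ y) ∧ leᴸ xs ys

  ∧-T : ∀ {a b} → T (a ∧ b) → T a × T b
  ∧-T = Equivalence.to T-∧

  private
    le-dot : ∀ xs ys ρ → T (leᴸ xs ys) → dot xs ρ ≤ dot ys ρ
    le-dot []       ys       ρ t = z≤n
    le-dot (x ∷ xs) []       ρ t with p , q ← ∧-T t with z≤n ← ≤ᵇ⇒≤ x 0 p = le-dot xs [] _ q
    le-dot (x ∷ xs) (y ∷ ys) ρ t with p , q ← ∧-T t =
      +-mono-≤ (*-monoˡ-≤ (ρ 0) (≤ᵇ⇒≤ x y p)) (le-dot xs ys _ q)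

  le-ev : ∀ ρ xs ys → T (leᴸ xs ys) → ev ρ xs ≤ ev ρ ys
  le-ev ρ []       ys       t = z≤n
  le-ev ρ (x ∷ xs) []       t with p , q ← ∧-T t with z≤n ← ≤ᵇ⇒≤ x 0 p = le-dot xs [] ρ q
  le-ev ρ (x ∷ xs) (y ∷ ys) t with p , q ← ∧-T t = +-mono-≤ (≤ᵇ⇒≤ x y p) (le-dot xs ys ρ q)

  ltᴸ : Lin → Lin → Bool
  ltᴸ xs ys = leᴸ (# 1 +ᴸ xs) ys

  lt-ev : ∀ ρ xs ys → T (ltᴸ xs ys) → ev ρ xs < ev ρ ys
  lt-ev ρ xs ys t = subst (_≤ ev ρ ys) (ev-+ ρ (# 1) xs) (le-ev ρ (# 1 +ᴸ xs) ys t)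

  -- The numbers of large labels and of Q-labels in a sum do not depend on the lengths of the
  -- pieces; the value alone is a linear form.
  record SLab : Set where
    constructor ⟪_,_,_⟫
    field
      slv stp : ℕ
      sval    : Lin

  open SLab public

  evl : Env → SLab → Lab
  evl ρ x = ⟨ slv x , stp x , ev ρ (sval x) ⟩

  _⊕ˢ_ : SLab → SLab → SLab
  x ⊕ˢ y = ⟪ slv x + slv y , stp x + stp y , sval x +ᴸ sval y ⟫

  shˢ : ℕ → Lin → Lin → ℕ → SLab → SLab
  shˢ k c μ ν x = ⟪ slv x , stp x , sval x +ᴸ (k ·ᴸ c +ᴸ (slv x ·ᴸ μ +ᴸ # (stp x * ν))) ⟫

  evl-⊕ : ∀ ρ x y → evl ρ (x ⊕ˢ y) ≡ evl ρ x ⊕ evl ρ y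
  evl-⊕ ρ x y = cong ⟨ _ , _ ,_⟩ (ev-+ ρ (sval x) (sval y))

  evl-sh : ∀ ρ k c μ ν x → evl ρ (shˢ k c μ ν x) ≡ sh k (ev ρ c) (ev ρ μ) ν (evl ρ x)
  evl-sh ρ k c μ ν x = cong ⟨ _ , _ ,_⟩
    (trans (ev-+ ρ (sval x) _) (cong (ev ρ (sval x) +_)
      (trans (ev-+ ρ (k ·ᴸ c) _) (cong₂ _+_ (ev-· ρ k c)
        (trans (ev-+ ρ (slv x ·ᴸ μ) _) (cong₂ _+_ (ev-· ρ (slv x) μ) (ev-# ρ (stp x * ν))))))))

  -- E serves both as a leg and as a core of even length.
  data Pc : Set where
    One O E Qᵖ CO CS CQ : Pc

  isQ : Pc → ℕ
  isQ Qᵖ = 1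
  isQ CQ = 1
  isQ _  = 0

  lows mids : Pc → ℕ → ℕ
  lows One j = 1
  lows O  j = suc j
  lows E  j = suc j
  lows Qᵖ j = suc j
  lows CO j = j
  lows CS j = 1
  lows CQ j = j
  mids One j = 0
  mids O  j = j
  mids E  j = suc j
  mids Qᵖ j = suc j
  mids CO j = suc j
  mids CS j = 1
  mids CQ j = suc j

  lowsˢ midsˢ : Pc → Lin → Lin
  lowsˢ One j = # 1
  lowsˢ O  j = # 1 +ᴸ j
  lowsˢ E  j = # 1 +ᴸ j
  lowsˢ Qᵖ j = # 1 +ᴸ j
  lowsˢ CO j = j
  lowsˢ CS j = # 1
  lowsˢ CQ j = j
  midsˢ One j = []
  midsˢ O  j = j
  midsˢ E  j = # 1 +ᴸ j
  midsˢ Qᵖ j = # 1 +ᴸ j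
  midsˢ CO j = # 1 +ᴸ j
  midsˢ CS j = # 1
  midsˢ CQ j = # 1 +ᴸ j

  ev-suc : ∀ ρ j → ev ρ (# 1 +ᴸ j) ≡ suc (ev ρ j)
  ev-suc ρ j = ev-+ ρ (# 1) j

  lows-ev : ∀ ρ p j → ev ρ (lowsˢ p j) ≡ lows p (ev ρ j)
  lows-ev ρ One j = refl
  lows-ev ρ O  j = ev-suc ρ j
  lows-ev ρ E  j = ev-suc ρ j
  lows-ev ρ Qᵖ j = ev-suc ρ j
  lows-ev ρ CO j = refl
  lows-ev ρ CS j = refl
  lows-ev ρ CQ j = refl

  mids-ev : ∀ ρ p j → ev ρ (midsˢ p j) ≡ mids p (ev ρ j)
  mids-ev ρ One j = refl
  mids-ev ρ O  j = refl
  mids-ev ρ E  j = ev-suc ρ j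
  mids-ev ρ Qᵖ j = ev-suc ρ j
  mids-ev ρ CO j = ev-suc ρ j
  mids-ev ρ CS j = refl
  mids-ev ρ CQ j = ev-suc ρ j

  body : Pc → ℕ → ℕ → List Lab
  body One P′ j = S 1 ∷ []
  body O  P′ j = legO P′ j
  body E  P′ j = legE P′ j
  body Qᵖ P′ j = legE P′ j
  body CO P′ j = coreO P′ j
  body CS P′ j = coreS P′
  body CQ P′ j = coreO P′ j

  -- A Q-label in front turns `legE` into an odd leg with a large hub label, and `coreO` into an
  -- even core with large labels at both ends.
  list : Pc → ℕ → ℕ → ℕ → List Lab
  list Qᵖ P′ R′ j = Q (suc R′) ∷ legE P′ j
  list CQ P′ R′ j = Q (suc R′) ∷ coreO P′ j
  list p  P′ R′ j = body p P′ j

  size : Pc → ℕ → ℕ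
  size One j = 1
  size O  j = suc (twice j)
  size E  j = twice (suc j)
  size Qᵖ j = suc (twice (suc j))
  size CO j = suc (twice j)
  size CS j = 2
  size CQ j = twice (suc j)

  size-list : ∀ p P′ R′ j → length (list p P′ R′ j) ≡ size p j
  size-list One P′ R′ j = refl
  size-list O  P′ R′ j = cong suc (len-zLS 2 (suc P′) j)
  size-list E  P′ R′ j = len-zLS 1 (suc P′) (suc j)
  size-list Qᵖ P′ R′ j = cong suc (len-zLS 1 (suc P′) (suc j))
  size-list CO P′ R′ j = cong suc (len-zSL 1 (suc (suc P′)) j)
  size-list CS P′ R′ j = refl
  size-list CQ P′ R′ j = cong (λ n → suc (suc n)) (len-zSL 1 (suc (suc P′)) j)

  zig : ∀ p P′ j → lows p j ≤ P′ → Zig P′ (lows p j) (mids p j) (body p P′ j)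
  zig One P′ j = legO-zig P′ 0
  zig O  = legO-zig
  zig E  = legE-zig
  zig Qᵖ = legE-zig
  zig CO = coreO-zig
  zig CS P′ j = coreS-zig P′
  zig CQ = coreO-zig

  data Fits : Kind → Pc → Set where
    u1 : Fits uK One
    uO : Fits uK O
    uE : Fits uK E
    uQ : Fits uK Qᵖ
    v1 : Fits vK One
    vO : Fits vK O
    vE : Fits vK E
    vQ : Fits vK Qᵖ
    cO : Fits cK CO
    cE : Fits cK E
    cS : Fits cK CS
    cQ : Fits cK CQ
    rO : Fits rK CO
    rQ : Fits rK CQ

  fits-ok : ∀ {K p} → Fits K p → ∀ P′ R′ j → PieceOK (K , list p P′ R′ j)
  fits-ok u1 P′ R′ j = okU end
  fits-ok v1 P′ R′ j = okV end
  fits-ok uO P′ R′ j = okU (EndS-legO P′ j)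
  fits-ok uE P′ R′ j = okU (EndS-legE P′ j)
  fits-ok uQ P′ R′ j = okU (EndS-zLS _ 1 (suc P′) j)
  fits-ok vO P′ R′ j = okV (EndS-legO P′ j)
  fits-ok vE P′ R′ j = okV (EndS-legE P′ j)
  fits-ok vQ P′ R′ j = okV (EndS-zLS _ 1 (suc P′) j)
  fits-ok cO P′ R′ j = okC
  fits-ok cE P′ R′ j = okC
  fits-ok cS P′ R′ j = okC
  fits-ok cQ P′ R′ j = okC
  fits-ok rO P′ R′ j = okR
  fits-ok rQ P′ R′ j = okR

  headˢ lastˢ : Pc → Lin → Lin → Lin → SLab
  headˢ One P′ R′ j = ⟪ 0 , 0 , # 1 ⟫
  headˢ O  P′ R′ j = ⟪ 0 , 0 , # 1 ⟫
  headˢ E  P′ R′ j = ⟪ 1 , 0 , # 1 +ᴸ P′ ⟫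
  headˢ Qᵖ P′ R′ j = ⟪ 1 , 1 , # 1 +ᴸ R′ ⟫
  headˢ CO P′ R′ j = ⟪ 1 , 0 , # 1 +ᴸ P′ ⟫
  headˢ CS P′ R′ j = ⟪ 0 , 0 , # 1 ⟫
  headˢ CQ P′ R′ j = ⟪ 1 , 1 , # 1 +ᴸ R′ ⟫
  lastˢ E  P′ R′ j = ⟪ 0 , 0 , # 1 +ᴸ j ⟫
  lastˢ CS P′ R′ j = ⟪ 1 , 0 , # 1 +ᴸ P′ ⟫
  -- This is the last label of `CO` and `CQ`; a leg contributes to its hub by its head alone.
  lastˢ _  P′ R′ j = ⟪ 1 , 0 , # 1 +ᴸ (P′ +ᴸ j) ⟫

  hd-ev : ∀ ρ p P′ R′ j → hd (list p (ev ρ P′) (ev ρ R′) (ev ρ j)) ≡ evl ρ (headˢ p P′ R′ j)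
  hd-ev ρ One P′ R′ j = refl
  hd-ev ρ O  P′ R′ j = refl
  hd-ev ρ E  P′ R′ j = cong ⟨ 1 , 0 ,_⟩ (sym (ev-suc ρ P′))
  hd-ev ρ Qᵖ P′ R′ j = cong ⟨ 1 , 1 ,_⟩ (sym (ev-suc ρ R′))
  hd-ev ρ CO P′ R′ j = cong ⟨ 1 , 0 ,_⟩ (sym (ev-suc ρ P′))
  hd-ev ρ CS P′ R′ j = refl
  hd-ev ρ CQ P′ R′ j = cong ⟨ 1 , 1 ,_⟩ (sym (ev-suc ρ R′))

  private
    lst-zLS : ∀ x a b j → lst (x ∷ zLS a b (suc j)) ≡ S (a + j)
    lst-zLS x a b zero    = cong ⟨ 0 , 0 ,_⟩ (sym (+-identityʳ a))
    lst-zLS x a b (suc j) = trans (lst-zLS (S a) (suc a) (suc b) j) (cong ⟨ 0 , 0 ,_⟩ (sym (+-suc a j)))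

    lst-coreO : ∀ x a b j → lst (x ∷ L b ∷ zSL a (suc b) j) ≡ L (b + j)
    lst-coreO x a b zero    = cong ⟨ 1 , 0 ,_⟩ (sym (+-identityʳ b))
    lst-coreO x a b (suc j) = trans (lst-coreO (S a) (suc a) (suc b) j) (cong ⟨ 1 , 0 ,_⟩ (sym (+-suc b j)))

  data Core : Pc → Set where
    coO : Core CO
    coE : Core E
    coS : Core CS
    coQ : Core CQ

  lst-ev : ∀ ρ {p} → Core p → ∀ P′ R′ j → lst (list p (ev ρ P′) (ev ρ R′) (ev ρ j)) ≡ evl ρ (lastˢ p P′ R′ j)
  lst-ev ρ coO P′ R′ j = trans (lst-coreO (S 0) 1 (suc (ev ρ P′)) (ev ρ j))
    (cong ⟨ 1 , 0 ,_⟩ (sym (trans (ev-suc ρ (P′ +ᴸ j)) (cong suc (ev-+ ρ P′ j)))))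
  lst-ev ρ coE P′ R′ j = trans (lst-zLS (S 0) 1 (suc (ev ρ P′)) (ev ρ j)) (cong ⟨ 0 , 0 ,_⟩ (sym (ev-suc ρ j)))
  lst-ev ρ coS P′ R′ j = cong ⟨ 1 , 0 ,_⟩ (sym (ev-suc ρ P′))
  lst-ev ρ coQ P′ R′ j = trans (lst-coreO (Q (suc (ev ρ R′))) 1 (suc (ev ρ P′)) (ev ρ j))
    (cong ⟨ 1 , 0 ,_⟩ (sym (trans (ev-suc ρ (P′ +ᴸ j)) (cong suc (ev-+ ρ P′ j)))))

  record Item : Set where
    constructor item
    field
      {kd} : Kind
      {pc} : Pc
      fit  : Fits kd pc
      sz   : Lin

  -- Enough data to evaluate all later insertions. Upper bounds `topsˢ` stand for the inner sums,
  -- with a single one for all sums of a zigzag, because shifts preserve `≼`.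
  record Summary : Set where
    field
      Pˢ Rˢ     : Lin
      nUˢ nVˢ   : ℕ
      Uˢ Vˢ     : SLab
      topsˢ     : List SLab

  open Summary public

  zeroˢ : SLab
  zeroˢ = ⟪ 0 , 0 , [] ⟫

  start : Summary
  start = record { Pˢ = [] ; Rˢ = [] ; nUˢ = 0 ; nVˢ = 0 ; Uˢ = zeroˢ ; Vˢ = zeroˢ ; topsˢ = [] }

  sideU sideV : Kind → SLab → SLab → SLab
  sideU uK h l = h
  sideU vK h l = zeroˢ
  sideU cK h l = h
  sideU rK h l = l
  sideV uK h l = zeroˢ
  sideV vK h l = h
  sideV cK h l = l
  sideV rK h l = h

  cntU cntV : Kind → ℕ
  cntU vK = 0
  cntU _  = 1
  cntV uK = 0
  cntV _  = 1

  newTops : Pc → Lin → Lin → Lin → List SLab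
  newTops One x P′ R′ = []
  newTops Qᵖ  x P′ R′ = ⟪ 1 , 0 , x ⟫ ∷ ⟪ 2 , 1 , (# 1 +ᴸ R′) +ᴸ (# 1 +ᴸ P′) ⟫ ∷ []
  newTops CQ  x P′ R′ = ⟪ 1 , 0 , x ⟫ ∷ ⟪ 2 , 1 , (# 1 +ᴸ R′) +ᴸ (# 1 +ᴸ P′) ⟫ ∷ []
  newTops _   x P′ R′ = ⟪ 1 , 0 , x ⟫ ∷ []

  stepˢ : Item → Summary → Summary
  stepˢ (item {K} {p} _ j) s = record
    { Pˢ = P′ ; Rˢ = R′
    ; nUˢ = cntU K + nUˢ s ; nVˢ = cntV K + nVˢ s
    ; Uˢ = sideU K h l ⊕ˢ shˢ (nUˢ s) c d (isQ p) (Uˢ s)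
    ; Vˢ = sideV K h l ⊕ˢ shˢ (nVˢ s) c d (isQ p) (Vˢ s)
    ; topsˢ = newTops p (P′ +ᴸ c +ᴸ d) P′ R′ ++ map (shˢ 2 c d (isQ p)) (topsˢ s)
    }
    where
    c = lowsˢ p j
    d = midsˢ p j
    P′ = Pˢ s +ᴸ c
    R′ = Rˢ s +ᴸ c +ᴸ d
    h = headˢ p P′ R′ j
    l = lastˢ p P′ R′ j

  -- The head of the list is inserted last. As `fill` accumulates its items in reverse, the first
  -- slot of a rule is the first to be inserted.
  run : List Item → Summary
  run []        = start
  run (i ∷ is) = stepˢ i (run is)

  stepX : Lin → Summary → Summary
  stepX j s = record
    { Pˢ = P′ ; Rˢ = R′
    ; nUˢ = suc (nUˢ s) ; nVˢ = suc (nVˢ s)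
    ; Uˢ = ⟪ 0 , 0 , P′ ⟫ ⊕ˢ shˢ (nUˢ s) c μ 1 (Uˢ s)
    ; Vˢ = ⟪ 0 , 0 , # 1 +ᴸ (Pˢ s +ᴸ c) ⟫ ⊕ˢ shˢ (nVˢ s) c μ 1 (Vˢ s)
    ; topsˢ = ⟪ 1 , 1 , (# 1 +ᴸ (Pˢ s +ᴸ c)) +ᴸ (# 1 +ᴸ R′) ⟫ ∷ ⟪ 2 , 1 , (# 1 +ᴸ R′) +ᴸ (# 1 +ᴸ P′) ⟫
              ∷ ⟪ 1 , 0 , P′ +ᴸ c +ᴸ c ⟫ ∷ map (shˢ 2 c μ 1) (topsˢ s)
    }
    where
    c = # 1 +ᴸ j
    μ = # 2 +ᴸ c
    P′ = Pˢ s +ᴸ c +ᴸ # 2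
    R′ = Rˢ s +ᴸ c +ᴸ μ

  runX : List Lin → Summary → Summary
  runX []       s = s
  runX (j ∷ js) s = stepX j (runX js s)

  infix 4 _≼_
  -- A bound in all three components, since a bound on the value alone would not survive a shift.
  _≼_ : Lab → Lab → Set
  w ≼ t = lv w ≤ lv t × tp w ≤ tp t × val w ≤ val t

  ≼-sh : ∀ k c μ ν {w t} → w ≼ t → sh k c μ ν w ≼ sh k c μ ν t
  ≼-sh k c μ ν (a , b , h) = a , b , +-mono-≤ h (+-monoʳ-≤ (k * c) (+-mono-≤ (*-monoˡ-≤ μ a) (*-monoˡ-≤ ν b)))

  -- The predicate `Wp` is `NW` as long as Q-labels have only large neighbours, and `XW` once
  -- `stepX` has put a small label next to one.
  record Nuc (Wp : ℕ → ℕ → Lab → Set) (ρ : Env) (s : Summary) (shp : List (Tag × ℕ)) : Set where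
    field
      cfg  : Config
      m    : ℕ
      inv  : Inv (ev ρ (Pˢ s)) (ev ρ (Rˢ s)) m cfg
      nws  : All (Wp (ev ρ (Pˢ s)) (ev ρ (Rˢ s))) (inner cfg)
      eU   : totU cfg ≡ evl ρ (Uˢ s)
      eV   : totV cfg ≡ evl ρ (Vˢ s)
      nU   : numU cfg ≡ nUˢ s
      nV   : numV cfg ≡ nVˢ s
      tops : All (λ w → Any (λ t → w ≼ evl ρ t) (topsˢ s)) (inner cfg)
      shpe : shape cfg ≡ shp

  shapeᴵ : Env → Item → Tag × ℕ
  shapeᴵ ρ (item {K} {p} _ j) = tag K , size p (ev ρ j)

  private
    ⊕-0 : ∀ x → x ⊕ ⟨ 0 , 0 , 0 ⟩ ≡ x
    ⊕-0 ⟨ l , q , v ⟩ rewrite +-identityʳ l | +-identityʳ q | +-identityʳ v = refl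

    end-U : ∀ ρ {K p} → Fits K p → ∀ P′ R′ j →
      totU ((K , list p (ev ρ P′) (ev ρ R′) (ev ρ j)) ∷ []) ≡ evl ρ (sideU K (headˢ p P′ R′ j) (lastˢ p P′ R′ j))
    end-U ρ u1 P′ R′ j = refl
    end-U ρ v1 P′ R′ j = refl
    end-U ρ uO P′ R′ j = trans (⊕-0 _) (hd-ev ρ O P′ R′ j)
    end-U ρ uE P′ R′ j = trans (⊕-0 _) (hd-ev ρ E P′ R′ j)
    end-U ρ uQ P′ R′ j = trans (⊕-0 _) (hd-ev ρ Qᵖ P′ R′ j)
    end-U ρ vO P′ R′ j = refl
    end-U ρ vE P′ R′ j = refl
    end-U ρ vQ P′ R′ j = refl
    end-U ρ cO P′ R′ j = trans (⊕-0 _) (hd-ev ρ CO P′ R′ j)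
    end-U ρ cE P′ R′ j = trans (⊕-0 _) (hd-ev ρ E P′ R′ j)
    end-U ρ cS P′ R′ j = trans (⊕-0 _) (hd-ev ρ CS P′ R′ j)
    end-U ρ cQ P′ R′ j = trans (⊕-0 _) (hd-ev ρ CQ P′ R′ j)
    end-U ρ rO P′ R′ j = trans (⊕-0 _) (lst-ev ρ coO P′ R′ j)
    end-U ρ rQ P′ R′ j = trans (⊕-0 _) (lst-ev ρ coQ P′ R′ j)

    end-V : ∀ ρ {K p} → Fits K p → ∀ P′ R′ j →
      totV ((K , list p (ev ρ P′) (ev ρ R′) (ev ρ j)) ∷ []) ≡ evl ρ (sideV K (headˢ p P′ R′ j) (lastˢ p P′ R′ j))
    end-V ρ v1 P′ R′ j = refl
    end-V ρ u1 P′ R′ j = refl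
    end-V ρ vO P′ R′ j = trans (⊕-0 _) (hd-ev ρ O P′ R′ j)
    end-V ρ vE P′ R′ j = trans (⊕-0 _) (hd-ev ρ E P′ R′ j)
    end-V ρ vQ P′ R′ j = trans (⊕-0 _) (hd-ev ρ Qᵖ P′ R′ j)
    end-V ρ uO P′ R′ j = refl
    end-V ρ uE P′ R′ j = refl
    end-V ρ uQ P′ R′ j = refl
    end-V ρ rO P′ R′ j = trans (⊕-0 _) (hd-ev ρ CO P′ R′ j)
    end-V ρ rQ P′ R′ j = trans (⊕-0 _) (hd-ev ρ CQ P′ R′ j)
    end-V ρ cO P′ R′ j = trans (⊕-0 _) (lst-ev ρ coO P′ R′ j)
    end-V ρ cE P′ R′ j = trans (⊕-0 _) (lst-ev ρ coE P′ R′ j)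
    end-V ρ cS P′ R′ j = trans (⊕-0 _) (lst-ev ρ coS P′ R′ j)
    end-V ρ cQ P′ R′ j = trans (⊕-0 _) (lst-ev ρ coQ P′ R′ j)

    cnt-U : ∀ K xs → numU ((K , xs) ∷ []) ≡ cntU K
    cnt-U uK xs = refl
    cnt-U vK xs = refl
    cnt-U cK xs = refl
    cnt-U rK xs = refl

    cnt-V : ∀ K xs → numV ((K , xs) ∷ []) ≡ cntV K
    cnt-V uK xs = refl
    cnt-V vK xs = refl
    cnt-V cK xs = refl
    cnt-V rK xs = refl

    +0 : ∀ {a b c d} → a ≡ b + c → c ≡ d → a ≡ b + d + 0
    +0 {b = b} {d = d} p q = trans p (trans (cong (b +_) q) (sym (+-identityʳ (b + d))))

  record StepOK (P R m c d ν : ℕ) (cfg : Config) (K : Kind) (xs : List Lab) (ts : ℕ → ℕ → List Lab) : Set where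
    open Step P R m c 0 d ν
    field
      ok   : NewOK cfg ((K , xs) ∷ [])
      nwN  : All (NW P′ R′) (inner ((K , xs) ∷ []))
      topN : All (λ w → Any (w ≼_) (ts P′ R′)) (inner ((K , xs) ∷ []))

  topZ topQ : ℕ → ℕ → ℕ → ℕ → List Lab
  topZ c d P′ R′ = ⟨ 1 , 0 , P′ + c + d ⟩ ∷ []
  topQ c d P′ R′ = ⟨ 1 , 0 , P′ + c + d ⟩ ∷ ⟨ 2 , 1 , suc R′ + suc P′ ⟩ ∷ []

  tops₀ : Pc → ℕ → ℕ → ℕ → ℕ → List Lab
  tops₀ One c d P′ R′ = []
  tops₀ Qᵖ  c d P′ R′ = topQ c d P′ R′
  tops₀ CQ  c d P′ R′ = topQ c d P′ R′
  tops₀ _   c d P′ R′ = topZ c d P′ R′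

  private
    zig-step : ∀ {P R m c d cfg K xs} → Inv P R m cfg → All (NW P R) (inner cfg) →
      Zig (P + c + 0) c d xs → PieceOK (K , xs) → StepOK P R m c d 0 cfg K xs (topZ c d)
    zig-step {P} {R} {m} {c} {d} {K = K} I nws z ok = record
      { ok   = insert-ok I (All.map NW-pure nws) z ok
      ; nwN  = Allₚ.++⁺ (subst (All _) (sym (Zig.zsum z)) (All.map (NW-up {P} {R} {m} {c} {d} {0} (Zig.hi z)) (in-up _ _ ≤-refl))) []
      ; topN = Allₚ.++⁺ (subst (All _) (sym (Zig.zsum z)) (All.map (λ { (inUp p q) → here (≤-refl , z≤n , ≤-pred (≤-trans q (Zig.hi z))) }) (in-up _ _ ≤-refl))) []
      }

    zigQ-step : ∀ {P R m c d cfg K ys} (let open Step P R m c 0 d 1) → Inv P R m cfg → All (NW P R) (inner cfg) →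
      Zig P′ c d (L (suc P′) ∷ ys) → PieceOK (K , Q (suc R′) ∷ L (suc P′) ∷ ys) →
      StepOK P R m c d 1 cfg K (Q (suc R′) ∷ L (suc P′) ∷ ys) (topQ c d)
    zigQ-step {P} {R} {m} {c} {d} {K = K} I nws z ok = record
      { ok   = insertQ-ok I nws z ok
      ; nwN  = subst (All _) (sym (lq-sums {K} z)) (lq (≤-reflexive (lem R′ P′)) ∷ All.map (NW-up {P} {R} {m} {c} {d} {1} (Zig.hi z)) (in-up _ _ ≤-refl))
      ; topN = subst (All _) (sym (lq-sums {K} z)) (there (here (≤-refl , ≤-refl , ≤-refl))
          ∷ All.map (λ { (inUp p q) → here (≤-refl , z≤n , ≤-pred (≤-trans q (Zig.hi z))) }) (in-up _ _ ≤-refl))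
      }
      where
      open Step P R m c 0 d 1
      open InsertQ {P} {R} {m} {c} {d}
      lem : ∀ R P → P + R + 2 ≡ suc R + suc P
      lem = solve-∀

  pc-step : ∀ {P R m cfg K p} j → Fits K p → Inv P R m cfg → All (NW P R) (inner cfg) →
    (let open Step P R m (lows p j) 0 (mids p j) (isQ p)) →
    StepOK P R m (lows p j) (mids p j) (isQ p) cfg K (list p P′ R′ j) (tops₀ p (lows p j) (mids p j))
  pc-step {P} {R} {m} {cfg} {K} {p} j f I nws = go p f
    where
    lo≤ : ∀ p → lows p j ≤ P + lows p j + 0
    lo≤ p = ≤-trans (m≤n+m _ P) (≤-reflexive (sym (+-identityʳ _)))
    go : ∀ p → Fits K p → (let open Step P R m (lows p j) 0 (mids p j) (isQ p)) →
      StepOK P R m (lows p j) (mids p j) (isQ p) cfg K (list p P′ R′ j) (tops₀ p (lows p j) (mids p j))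
    go One f = record { ok = insert-ok I (All.map NW-pure nws) (zig One _ j (lo≤ One)) (fits-ok f 0 0 j) ; nwN = [] ; topN = [] }
    go O  f = zig-step I nws (zig O _ j (lo≤ O)) (fits-ok f _ 0 j)
    go E  f = zig-step I nws (zig E _ j (lo≤ E)) (fits-ok f _ 0 j)
    go CO f = zig-step {c = j} {d = suc j} I nws (zig CO _ j (lo≤ CO)) (fits-ok f _ 0 j)
    go CS f = zig-step I nws (zig CS _ j (lo≤ CS)) (fits-ok f _ 0 j)
    go Qᵖ f = zigQ-step I nws (zig Qᵖ _ j (lo≤ Qᵖ)) (fits-ok f _ _ j)
    go CQ f = zigQ-step I nws (zig CQ _ j (lo≤ CQ)) (fits-ok f _ _ j)

  -- Evaluation commutes with each operation in `stepˢ`, so a symbolic summary describes the actual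
  -- insertion in every environment.
  nuc-step : ∀ {ρ s shp} i → Nuc NW ρ s shp → Nuc NW ρ (stepˢ i s) (shapeᴵ ρ i ∷ shp)
  nuc-step {ρ} {s} {shp} (item {K} {p} f jˢ) n = record
    { cfg  = next
    ; m    = m′
    ; inv  = subst₂ (λ a b → Inv a b m′ next) (sym eP) (sym eR) (step inv (StepOK.ok S₀))
    ; nws  = subst₂ (λ a b → All (NW a b) (inner next)) (sym eP) (sym eR)
               (subst (All _) (sym (inner-step c d ν N cfg))
                 (Allₚ.++⁺ (StepOK.nwN S₀) (Allₚ.map⁺ (All.map (NW-sh {m = m} {ν = ν}) nws))))
    ; eU   = trans totU-next (trans (cong₂ _⊕_ (hub totU (λ P′ R′ j → sideU K (headˢ p P′ R′ j) (lastˢ p P′ R′ j)) (end-U ρ f)) (shE (Uˢ s) eU nU)) (sym (evl-⊕ ρ (sideU K (headˢ p P₁ R₁ jˢ) (lastˢ p P₁ R₁ jˢ)) (shˢ (nUˢ s) cˢ dˢ ν (Uˢ s)))))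
    ; eV   = trans totV-next (trans (cong₂ _⊕_ (hub totV (λ P′ R′ j → sideV K (headˢ p P′ R′ j) (lastˢ p P′ R′ j)) (end-V ρ f)) (shE (Vˢ s) eV nV)) (sym (evl-⊕ ρ (sideV K (headˢ p P₁ R₁ jˢ) (lastˢ p P₁ R₁ jˢ)) (shˢ (nVˢ s) cˢ dˢ ν (Vˢ s)))))
    ; nU   = trans numU-next (cong₂ _+_ (cnt-U K _) nU)
    ; nV   = trans numV-next (cong₂ _+_ (cnt-V K _) nV)
    ; tops = subst (All _) (sym (inner-step c d ν N cfg))
               (Allₚ.++⁺ (All.map (λ a → Anyₚ.++⁺ˡ {xs = newTops p (P₁ +ᴸ cˢ +ᴸ dˢ) P₁ R₁} (conv p a)) (StepOK.topN S₀))
                 (Allₚ.map⁺ (All.map (λ {w} a → Anyₚ.++⁺ʳ (newTops p (P₁ +ᴸ cˢ +ᴸ dˢ) P₁ R₁) (Anyₚ.map⁺ (Any.map (λ {t} h →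
                    subst (sh 2 c d ν w ≼_) (sym (shE₂ t)) (≼-sh 2 c d ν h)) a))) tops)))
    ; shpe = trans (shape-step c d ν N cfg) (cong₂ _∷_ (cong (tag K ,_) (size-list p P′ R′ j)) shpe)
    }
    where
    open Nuc n
    j = ev ρ jˢ
    c = lows p j
    d = mids p j
    ν = isQ p
    cˢ = lowsˢ p jˢ
    dˢ = midsˢ p jˢ
    P₁ = Pˢ s +ᴸ cˢ
    R₁ = Rˢ s +ᴸ cˢ +ᴸ dˢ
    open Step (ev ρ (Pˢ s)) (ev ρ (Rˢ s)) m c 0 d ν
    N : Config
    N = (K , list p P′ R′ j) ∷ []
    S₀ = pc-step {cfg = cfg} j f inv nws
    open Hub {cfg} (Inv.pieces inv) c d ν N
    eP : ev ρ P₁ ≡ P′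
    eP = +0 (ev-+ ρ (Pˢ s) cˢ) (lows-ev ρ p jˢ)
    eR : ev ρ R₁ ≡ R′
    eR = trans (ev-+ ρ (Rˢ s +ᴸ cˢ) dˢ) (cong₂ _+_ (trans (ev-+ ρ (Rˢ s) cˢ) (cong (ev ρ (Rˢ s) +_) (lows-ev ρ p jˢ))) (mids-ev ρ p jˢ))
    hub : (f : Config → Lab) (g : Lin → Lin → Lin → SLab) →
      (∀ P′ R′ j → f ((K , list p (ev ρ P′) (ev ρ R′) (ev ρ j)) ∷ []) ≡ evl ρ (g P′ R′ j)) → f N ≡ evl ρ (g P₁ R₁ jˢ)
    hub f g h = trans (cong₂ (λ a b → f ((K , list p a b j) ∷ [])) (sym eP) (sym eR)) (h P₁ R₁ jˢ)
    shE : ∀ {k k′ x} y → x ≡ evl ρ y → k ≡ k′ → sh k c d ν x ≡ evl ρ (shˢ k′ cˢ dˢ ν y)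
    shE {k} {x = x} y refl refl = sym (trans (evl-sh ρ k cˢ dˢ ν y) (cong₂ (λ a b → sh k a b ν x) (lows-ev ρ p jˢ) (mids-ev ρ p jˢ)))
    shE₂ : ∀ y → evl ρ (shˢ 2 cˢ dˢ ν y) ≡ sh 2 c d ν (evl ρ y)
    shE₂ y = sym (shE {2} y refl refl)
    top₀ : evl ρ ⟪ 1 , 0 , P₁ +ᴸ cˢ +ᴸ dˢ ⟫ ≡ ⟨ 1 , 0 , P′ + c + d ⟩
    top₀ = cong ⟨ 1 , 0 ,_⟩ (trans (ev-+ ρ (P₁ +ᴸ cˢ) dˢ) (cong₂ _+_ (trans (ev-+ ρ P₁ cˢ) (cong₂ _+_ eP (lows-ev ρ p jˢ))) (mids-ev ρ p jˢ)))
    top₁ : evl ρ ⟪ 2 , 1 , (# 1 +ᴸ R₁) +ᴸ (# 1 +ᴸ P₁) ⟫ ≡ ⟨ 2 , 1 , suc R′ + suc P′ ⟩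
    top₁ = cong ⟨ 2 , 1 ,_⟩ (trans (ev-+ ρ (# 1 +ᴸ R₁) (# 1 +ᴸ P₁))
      (cong₂ _+_ (trans (ev-suc ρ R₁) (cong suc eR)) (trans (ev-suc ρ P₁) (cong suc eP))))
    convZ : ∀ {w} → Any (w ≼_) (topZ c d P′ R′) → Any (λ t → w ≼ evl ρ t) (⟪ 1 , 0 , P₁ +ᴸ cˢ +ᴸ dˢ ⟫ ∷ [])
    convZ {w} (here h) = here (subst (w ≼_) (sym top₀) h)
    convQ : ∀ {w} → Any (w ≼_) (topQ c d P′ R′) → Any (λ t → w ≼ evl ρ t)
      (⟪ 1 , 0 , P₁ +ᴸ cˢ +ᴸ dˢ ⟫ ∷ ⟪ 2 , 1 , (# 1 +ᴸ R₁) +ᴸ (# 1 +ᴸ P₁) ⟫ ∷ [])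
    convQ {w} (here h)         = here (subst (w ≼_) (sym top₀) h)
    convQ {w} (there (here h)) = there (here (subst (w ≼_) (sym top₁) h))
    conv : ∀ q {w} → Any (w ≼_) (tops₀ q c d P′ R′) → Any (λ t → w ≼ evl ρ t) (newTops q (P₁ +ᴸ cˢ +ᴸ dˢ) P₁ R₁)
    conv O  = convZ
    conv E  = convZ
    conv Qᵖ = convQ
    conv CO = convZ
    conv CS = convZ
    conv CQ = convQ

  nuc-start : ∀ ρ → Nuc NW ρ start []
  nuc-start ρ = record
    { cfg = [] ; m = 0
    ; inv = record { P≤R = z≤n ; R≤m = z≤n ; lab = [] ; cls = [] ; len = refl ; inn = [] ; innP = [] ; pieces = [] }
    ; nws = [] ; eU = refl ; eV = refl ; nU = refl ; nV = refl ; tops = [] ; shpe = refl }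

  nuc-run : ∀ ρ is → Nuc NW ρ (run is) (map (shapeᴵ ρ) is)
  nuc-run ρ []       = nuc-start ρ
  nuc-run ρ (i ∷ is) = nuc-step i (nuc-run ρ is)

  nuc-weaken : ∀ {ρ s shp} → Nuc NW ρ s shp → Nuc XW ρ s shp
  nuc-weaken n = record
    { cfg = cfg ; m = m ; inv = inv ; nws = All.map nw nws ; eU = eU ; eV = eV ; nU = nU ; nV = nV ; tops = tops ; shpe = shpe }
    where open Nuc n

  nuc-stepX : ∀ {ρ s shp} jˢ → Nuc XW ρ s shp →
              Nuc XW ρ (stepX jˢ s) ((vT , twice (suc (suc (ev ρ jˢ)))) ∷ (uT , 1) ∷ shp)
  nuc-stepX {ρ} {s} {shp} jˢ n = record
    { cfg  = next
    ; m    = m′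
    ; inv  = subst₂ (λ a b → Inv a b m′ next) (sym eP) (sym eR) (step inv (xp-ok inv nws))
    ; nws  = subst₂ (λ a b → All (XW a b) (inner next)) (sym eP) (sym eR) (xp-XW {cfg} nws)
    ; eU   = trans totU-next (trans (cong₂ _⊕_ (trans (⊕-0 _) (cong ⟨ 0 , 0 ,_⟩ (sym eP))) (shE (Uˢ s) eU nU))
               (sym (evl-⊕ ρ ⟪ 0 , 0 , P₁ ⟫ (shˢ (nUˢ s) cˢ μˢ 1 (Uˢ s)))))
    ; eV   = trans totV-next (trans (cong₂ _⊕_ (trans (⊕-0 _) (cong ⟨ 0 , 0 ,_⟩ (sym ex))) (shE (Vˢ s) eV nV))
               (sym (evl-⊕ ρ ⟪ 0 , 0 , # 1 +ᴸ (Pˢ s +ᴸ cˢ) ⟫ (shˢ (nVˢ s) cˢ μˢ 1 (Vˢ s)))))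
    ; nU   = trans numU-next (cong suc nU)
    ; nV   = trans numV-next (cong suc nV)
    ; tops = subst (All _) (sym (inner-step c μ 1 xpN cfg))
               (Allₚ.++⁺ (subst (All _) (sym xp-inner)
                   (here (≤-refl , ≤-refl , ≤-reflexive (sym (trans (ev-+ ρ (# 1 +ᴸ (Pˢ s +ᴸ cˢ)) (# 1 +ᴸ R₁)) (cong₂ _+_ ex eR+))))
                   ∷ there (here (≤-refl , ≤-refl , ≤-reflexive (sym (trans (ev-+ ρ (# 1 +ᴸ R₁) (# 1 +ᴸ P₁)) (cong₂ _+_ eR+ (trans (ev-suc ρ P₁) (cong suc eP)))))))
                   ∷ All.map (λ { (inUp p q) → there (there (here (≤-refl , z≤n , ≤-trans (≤-pred (≤-trans q (Zig.hi z))) (≤-reflexive (sym e₃))))) }) (in-up _ (Zig.k z) ≤-refl)))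
                 (Allₚ.map⁺ (All.map (λ {w} a → there (there (there (Anyₚ.map⁺ (Any.map (λ {t} h →
                    subst (sh 2 c μ 1 w ≼_) (shE {2} t refl refl) (≼-sh 2 c μ 1 h)) a))))) tops)))
    ; shpe = trans (shape-step c μ 1 xpN cfg) (cong₂ (λ a b → (vT , a) ∷ (uT , 1) ∷ b) (cong (λ n → suc (suc n)) (len-zLS 1 (suc P′) (suc j))) shpe)
    }
    where
    open Nuc n
    j = ev ρ jˢ
    c = suc j
    cˢ = # 1 +ᴸ jˢ
    μˢ = # 2 +ᴸ cˢ
    P₁ = Pˢ s +ᴸ cˢ +ᴸ # 2
    R₁ = Rˢ s +ᴸ cˢ +ᴸ μˢ
    open XP (ev ρ (Pˢ s)) (ev ρ (Rˢ s)) m j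
    z = legE-zig P′ j (≤-trans (m≤n+m c (ev ρ (Pˢ s))) (m≤m+n (ev ρ (Pˢ s) + c) 2))
    open Hub {cfg} (Inv.pieces inv) c μ 1 xpN
    ec : ev ρ cˢ ≡ c
    ec = ev-suc ρ jˢ
    eμ : ev ρ μˢ ≡ μ
    eμ = trans (ev-+ ρ (# 2) cˢ) (cong (2 +_) ec)
    ePc : ev ρ (Pˢ s +ᴸ cˢ) ≡ ev ρ (Pˢ s) + c
    ePc = trans (ev-+ ρ (Pˢ s) cˢ) (cong (ev ρ (Pˢ s) +_) ec)
    eP : ev ρ P₁ ≡ P′
    eP = trans (ev-+ ρ (Pˢ s +ᴸ cˢ) (# 2)) (cong (_+ 2) ePc)
    eR : ev ρ R₁ ≡ R′
    eR = trans (ev-+ ρ (Rˢ s +ᴸ cˢ) μˢ) (cong₂ _+_ (trans (ev-+ ρ (Rˢ s) cˢ) (cong (ev ρ (Rˢ s) +_) ec)) eμ)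
    eR+ : ev ρ (# 1 +ᴸ R₁) ≡ suc R′
    eR+ = trans (ev-suc ρ R₁) (cong suc eR)
    ex : ev ρ (# 1 +ᴸ (Pˢ s +ᴸ cˢ)) ≡ suc (ev ρ (Pˢ s) + c)
    ex = trans (ev-suc ρ (Pˢ s +ᴸ cˢ)) (cong suc ePc)
    e₃ : ev ρ (P₁ +ᴸ cˢ +ᴸ cˢ) ≡ P′ + c + c
    e₃ = trans (ev-+ ρ (P₁ +ᴸ cˢ) cˢ) (cong₂ _+_ (trans (ev-+ ρ P₁ cˢ) (cong₂ _+_ eP ec)) ec)
    shE : ∀ {k k′ x} y → x ≡ evl ρ y → k ≡ k′ → sh k c μ 1 x ≡ evl ρ (shˢ k′ cˢ μˢ 1 y)
    shE {k} {x = x} y refl refl = sym (trans (evl-sh ρ k cˢ μˢ 1 y) (cong₂ (λ a b → sh k a b 1 x) ec eμ))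

  checkTops : SLab → List SLab → Bool
  checkTops v []       = true
  checkTops v (t ∷ ts) = (ltᴸ (sval t) (sval v) ∧ (slv t ≤ᵇ suc (slv v))) ∧ checkTops v ts

  tops-below : ∀ ρ v {ws} ts → T (checkTops v ts) → All (λ w → Any (λ t → w ≼ evl ρ t) ts) ws →
               All (λ w → val w < ev ρ (sval v) × lv w ≤ suc (slv v)) ws
  tops-below ρ v ts c = All.map (λ a → go ts c a)
    where
    go : ∀ ts {w} → T (checkTops v ts) → Any (λ t → w ≼ evl ρ t) ts → val w < ev ρ (sval v) × lv w ≤ suc (slv v)
    go (t ∷ ts) c (here (l , _ , h)) with p , q ← ∧-T {ltᴸ (sval t) (sval v) ∧ (slv t ≤ᵇ suc (slv v))} c with p₁ , p₂ ← ∧-T {ltᴸ (sval t) (sval v)} p =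
      ≤-<-trans h (lt-ev ρ (sval t) (sval v) p₁) , ≤-trans l (≤ᵇ⇒≤ _ _ p₂)
    go (t ∷ ts) c (there a) = go ts (proj₂ (∧-T {ltᴸ (sval t) (sval v) ∧ (slv t ≤ᵇ suc (slv v))} c)) a

  checkOrd : ℕ → Summary → Bool
  checkOrd gap s = ltᴸ (sval (Vˢ s)) (sval (Uˢ s)) ∧ (ltᴸ (Pˢ s) (sval (Vˢ s)) ∧
    (checkTops (Vˢ s) (topsˢ s) ∧ ((slv (Vˢ s) ≤ᵇ slv (Uˢ s) + gap) ∧ ((3 ≤ᵇ nVˢ s) ∧ (suc (nVˢ s) ≤ᵇ nUˢ s)))))

  -- The surplus `gap` of large labels at `v` is kept as a parameter: `Ord` tolerates two, but
  -- adding zigzags at `u` afterwards requires one.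
  nuc-ord : ∀ {Wp ρ s shp} gap → gap ≤ 2 → T (checkOrd gap s) → (n : Nuc Wp ρ s shp) →
            Ord (ev ρ (Pˢ s)) (Nuc.cfg n) × lv (totV (Nuc.cfg n)) ≤ lv (totU (Nuc.cfg n)) + gap
  nuc-ord {ρ = ρ} {s} gap g≤2 t n
    with t₁ , t ← ∧-T {ltᴸ (sval (Vˢ s)) (sval (Uˢ s))} t
    with t₂ , t ← ∧-T {ltᴸ (Pˢ s) (sval (Vˢ s))} t
    with t₃ , t ← ∧-T {checkTops (Vˢ s) (topsˢ s)} t
    with t₄ , t ← ∧-T {slv (Vˢ s) ≤ᵇ slv (Uˢ s) + gap} t
    with t₅ , t₆ ← ∧-T {3 ≤ᵇ nVˢ s} t = record
    { V<U = subst₂ (λ x y → val x < val y) (sym eV) (sym eU) (lt-ev ρ (sval (Vˢ s)) (sval (Uˢ s)) t₁)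
    ; P<V = subst (λ x → ev ρ (Pˢ s) < val x) (sym eV) (lt-ev ρ (Pˢ s) (sval (Vˢ s)) t₂)
    ; W<V = subst (λ x → All (λ w → val w < val x × lv w ≤ suc (lv x)) (inner cfg)) (sym eV) (tops-below ρ (Vˢ s) (topsˢ s) t₃ tops)
    ; lvs = ≤-trans lvg (+-monoʳ-≤ (lv (totU cfg)) g≤2)
    ; 3≤  = subst (3 ≤_) (sym nV) (≤ᵇ⇒≤ 3 (nVˢ s) t₅)
    ; nn  = subst₂ _<_ (sym nV) (sym nU) (≤ᵇ⇒≤ _ _ t₆)
    } , lvg
    where
    open Nuc n
    lvg : lv (totV cfg) ≤ lv (totU cfg) + gap
    lvg = subst₂ (λ x y → lv x ≤ lv y + gap) (sym eV) (sym eU) (≤ᵇ⇒≤ _ _ t₄)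

-- Finite tables of insertion orders for small degrees.

module Tables where

  open import Data.Bool using (Bool; true; false; _∧_; _∨_; not; T; if_then_else_)
  open import Data.Bool.Properties using (T?)
  open import Data.Maybe using (Maybe; just; nothing; is-just)
  open import Data.Nat.Properties
  open import Data.List.Properties using (++-identityʳ)
  open import Relation.Nullary using (yes; no)
  open import Relation.Binary.PropositionalEquality using (_≡_; refl; sym; cong)
  open Labellings
  open Zigzags
  open Insertion
  open Symbolic

  data Hub₂ : Set where
    hu hv : Hub₂

  data Ty : Set where
    I Od Ev : Ty

  data Mode : Set where
    modeO modeE modeS modeQ : Mode

  -- A slot asks for a leg of a hub of length 1, of odd length (with hub label S or Q),
  -- of even length, or for the core, listed from u (true) or from v (false).
  data Slot : Set where
    leg₁ legᵒ legᵠ legᵉ : Hub₂ → Slot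
    core                : Bool → Mode → Slot

  data SPiece : Set where
    leg  : Hub₂ → Ty → Lin → SPiece
    coreᵒ coreᵉ : Lin → SPiece

  tagH : Hub₂ → Tag
  tagH hu = uT
  tagH hv = vT

  lenT : Ty → ℕ → ℕ
  lenT I  j = 1
  lenT Od j = suc (twice (suc j))
  lenT Ev j = twice (suc j)

  shapeP : Env → SPiece → Tag × ℕ
  shapeP ρ (leg h t e) = tagH h , lenT t (ev ρ e)
  shapeP ρ (coreᵒ e)   = cT , suc (twice (ev ρ e))
  shapeP ρ (coreᵉ e)   = cT , twice (suc (ev ρ e))

  Makes : SPiece → Set
  Makes p = Σ Item λ i → ∀ ρ → shapeᴵ ρ i ≡ shapeP ρ p

  make : Slot → (p : SPiece) → Maybe (Makes p)
  make (leg₁ hu) (leg hu I e)  = just (item u1 [] , λ ρ → refl)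
  make (leg₁ hv) (leg hv I e)  = just (item v1 [] , λ ρ → refl)
  -- The type `Od` stands for length `2e + 3`. For `legO` this means the parameter `e + 1`, whereas
  -- in `Qᵖ` the Q-label accounts for the additional edge.
  make (legᵒ hu) (leg hu Od e) = just (item uO (# 1 +ᴸ e) , λ ρ → cong (λ n → uT , suc (twice n)) (ev-suc ρ e))
  make (legᵒ hv) (leg hv Od e) = just (item vO (# 1 +ᴸ e) , λ ρ → cong (λ n → vT , suc (twice n)) (ev-suc ρ e))
  make (legᵠ hu) (leg hu Od e) = just (item uQ e , λ ρ → refl)
  make (legᵠ hv) (leg hv Od e) = just (item vQ e , λ ρ → refl)
  make (legᵉ hu) (leg hu Ev e) = just (item uE e , λ ρ → refl)
  make (legᵉ hv) (leg hv Ev e) = just (item vE e , λ ρ → refl)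
  make (core true  modeO) (coreᵒ e)  = just (item cO e , λ ρ → refl)
  make (core false modeO) (coreᵒ e)  = just (item rO e , λ ρ → refl)
  make (core true  modeE) (coreᵉ e)  = just (item cE e , λ ρ → refl)
  -- The form `[]` is zero, so that this matches a core of length exactly two.
  make (core true  modeS) (coreᵉ []) = just (item cS [] , λ ρ → refl)
  make (core true  modeQ) (coreᵉ e)  = just (item cQ e , λ ρ → refl)
  make (core false modeQ) (coreᵉ e)  = just (item rQ e , λ ρ → refl)
  make _ _ = nothing

  Picks : List SPiece → Set
  Picks ps = Σ Item λ i → Σ (List SPiece) λ rest → ∀ ρ → map (shapeP ρ) ps ↭ shapeᴵ ρ i ∷ map (shapeP ρ) rest

  pick : Slot → (ps : List SPiece) → Maybe (Picks ps)
  pick s []       = nothing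
  pick s (p ∷ ps) with make s p
  ... | just (i , e) = just (i , ps , λ ρ → ↭-reflexive (cong (_∷ map (shapeP ρ) ps) (sym (e ρ))))
  ... | nothing with pick s ps
  ...   | just (i , rest , q) = just (i , p ∷ rest , λ ρ → ↭-trans (prep _ (q ρ)) (swap _ _ ↭-refl))
  ...   | nothing             = nothing

  Fills : List SPiece → List Item → Set
  Fills ps acc = Σ (List Item) λ is → ∀ ρ → map (shapeᴵ ρ) is ↭ map (shapeP ρ) ps ++ map (shapeᴵ ρ) acc

  -- Each slot takes the first piece it accepts, or is skipped.
  fill : List Slot → (ps : List SPiece) (acc : List Item) → Maybe (Fills ps acc)
  fill []       []       acc = just (acc , λ ρ → ↭-refl)
  fill []       (_ ∷ _)  acc = nothing
  fill (s ∷ ss) ps       acc with pick s ps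
  ... | nothing = fill ss ps acc
  ... | just (i , rest , q) with fill ss rest (i ∷ acc)
  ...   | nothing       = nothing
  ...   | just (is , f) = just (is , λ ρ → ↭-trans (f ρ)
            (↭-trans (Perm.shift (shapeᴵ ρ i) (map (shapeP ρ) rest) (map (shapeᴵ ρ) acc))
                     (Perm.++⁺ʳ (map (shapeᴵ ρ) acc) (↭-sym (q ρ)))))

  Solved : (Summary → Bool) → List SPiece → Set
  Solved chk ps = Σ (List Item) λ is → T (chk (run is)) × (∀ ρ → map (shapeᴵ ρ) is ↭ map (shapeP ρ) ps)

  search : (chk : Summary → Bool) → List (List Slot) → (ps : List SPiece) → Maybe (Solved chk ps)
  search chk []       ps = nothing
  search chk (r ∷ rs) ps with fill r ps []
  ... | nothing = search chk rs ps
  ... | just (is , f) with T? (chk (run is))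
  ...   | yes t = just (is , t , λ ρ → ↭-trans (f ρ) (↭-reflexive (++-identityʳ _)))
  ...   | no _  = search chk rs ps

  found : ∀ {A : Set} (x : Maybe A) → is-just x ≡ true → A
  found (just y) _ = y

  allTy : (Ty → Bool) → Bool
  allTy f = f I ∧ (f Od ∧ f Ev)

  ∧-true : ∀ {a b} → a ∧ b ≡ true → a ≡ true × b ≡ true
  ∧-true {true} e = refl , e

  allTy-sound : ∀ f → allTy f ≡ true → ∀ t → f t ≡ true
  allTy-sound f h I  = proj₁ (∧-true {f I} h)
  allTy-sound f h Od = proj₁ (∧-true {f Od} (proj₂ (∧-true {f I} h)))
  allTy-sound f h Ev = proj₂ (∧-true {f Od} (proj₂ (∧-true {f I} h)))

  -- Cores of length 1, 3 + 2i, 2 and 4 + 2i.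
  data CoreTy : Set where
    k1 k3 k2 k4 : CoreTy

  allCore : (CoreTy → Bool) → Bool
  allCore f = f k1 ∧ (f k3 ∧ (f k2 ∧ f k4))

  allCore-sound : ∀ f → allCore f ≡ true → ∀ k → f k ≡ true
  allCore-sound f h k1 = proj₁ (∧-true {f k1} h)
  allCore-sound f h k3 = proj₁ (∧-true {f k3} (proj₂ (∧-true {f k1} h)))
  allCore-sound f h k2 = proj₁ (∧-true {f k2} (proj₂ (∧-true {f k3} (proj₂ (∧-true {f k1} h)))))
  allCore-sound f h k4 = proj₂ (∧-true {f k2} (proj₂ (∧-true {f k3} (proj₂ (∧-true {f k1} h)))))

  var : ℕ → Lin
  var i = 0 ∷ unit i
    where
    unit : ℕ → List ℕ
    unit zero    = 1 ∷ []
    unit (suc i) = 0 ∷ unit i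

  corePiece : CoreTy → SPiece
  corePiece k1 = coreᵒ []
  corePiece k3 = coreᵒ (# 1 +ᴸ var 0)
  corePiece k2 = coreᵉ []
  corePiece k4 = coreᵉ (# 1 +ᴸ var 0)

  eqTy : Ty → Ty → Bool
  eqTy I  I  = true
  eqTy Od Od = true
  eqTy Ev Ev = true
  eqTy _  _  = false

  -- The second of two legs of the same type is taken to be the longer one.
  second : Ty → Ty → Lin → Lin → Lin
  second s t x y = if eqTy s t then x +ᴸ y else y

  isI : Ty → Bool
  isI I = true
  isI _ = false

  u₁ uᵒ uᵠ uᵉ v₁ vᵒ vᵠ vᵉ : Slot
  u₁ = leg₁ hu
  uᵒ = legᵒ hu
  uᵠ = legᵠ hu
  uᵉ = legᵉ hu
  v₁ = leg₁ hv
  vᵒ = legᵒ hv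
  vᵠ = legᵠ hv
  vᵉ = legᵉ hv

  -- These are candidate orders only. Correctness rests on the check made by `search`, which passes
  -- over a rule that does not fit.
  rules₃₂ : List (List Slot)
  rules₃₂ =
      (v₁ ∷ u₁ ∷ u₁ ∷ u₁ ∷ core true modeO ∷ vᵒ ∷ v₁ ∷ uᵉ ∷ vᵉ ∷ uᵠ ∷ uᵒ ∷ uᵉ ∷ uᵒ ∷ uᵉ ∷ vᵠ ∷ vᵉ ∷ [])
    ∷ (u₁ ∷ u₁ ∷ v₁ ∷ u₁ ∷ core true modeO ∷ vᵉ ∷ uᵉ ∷ uᵒ ∷ vᵉ ∷ vᵒ ∷ uᵠ ∷ vᵒ ∷ uᵉ ∷ v₁ ∷ uᵠ ∷ uᵉ ∷ [])
    ∷ (u₁ ∷ u₁ ∷ u₁ ∷ core false modeO ∷ vᵉ ∷ vᵉ ∷ [])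
    ∷ (v₁ ∷ v₁ ∷ u₁ ∷ vᵒ ∷ u₁ ∷ uᵉ ∷ uᵉ ∷ core false modeQ ∷ uᵠ ∷ uᵉ ∷ vᵉ ∷ uᵒ ∷ u₁ ∷ vᵠ ∷ uᵠ ∷ vᵉ ∷ [])
    ∷ (uᵠ ∷ v₁ ∷ uᵠ ∷ u₁ ∷ v₁ ∷ u₁ ∷ uᵉ ∷ uᵉ ∷ u₁ ∷ uᵉ ∷ core true modeE ∷ vᵉ ∷ vᵉ ∷ uᵠ ∷ vᵠ ∷ vᵠ ∷ [])
    ∷ (u₁ ∷ u₁ ∷ core true modeQ ∷ vᵠ ∷ vᵒ ∷ u₁ ∷ [])
    ∷ []

  pieces₃₂ : Ty → Ty → Ty → Ty → Ty → CoreTy → List SPiece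
  pieces₃₂ t₁ t₂ t₃ s₁ s₂ k = leg hu t₁ (var 1) ∷ leg hu t₂ (var 2) ∷ leg hu t₃ (var 3)
    ∷ leg hv s₁ (var 4) ∷ leg hv s₂ (second s₁ s₂ (var 4) (var 5)) ∷ corePiece k ∷ []

  -- Further zigzags at `u`, which require a surplus of at most one, are added only if `u` has no
  -- leg of length one. With three such legs the weaker bound suffices.
  gap₃₂ : Ty → Ty → Ty → ℕ
  gap₃₂ t₁ t₂ t₃ = if isI t₁ ∧ (isI t₂ ∧ isI t₃) then 2 else 1

  -- For this family `exception` separates short legs and small differences of the two even legs
  -- before it consults the rules.
  exceptional : Ty → Ty → Ty → Ty → Ty → CoreTy → Bool
  exceptional I I I Ev Ev k1 = true
  exceptional _ _ _ _  _  _  = false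

  search₃₂ : ∀ t₁ t₂ t₃ s₁ s₂ k → Maybe (Solved (checkOrd (gap₃₂ t₁ t₂ t₃)) (pieces₃₂ t₁ t₂ t₃ s₁ s₂ k))
  search₃₂ t₁ t₂ t₃ s₁ s₂ k = search (checkOrd (gap₃₂ t₁ t₂ t₃)) rules₃₂ (pieces₃₂ t₁ t₂ t₃ s₁ s₂ k)

  someI₃₂ : Ty → Ty → Ty → Ty → Ty → Bool
  someI₃₂ t₁ t₂ t₃ s₁ s₂ = isI t₁ ∨ (isI t₂ ∨ (isI t₃ ∨ (isI s₁ ∨ isI s₂)))

  -- Combinations without a leg of length one are accepted outright, since there all pendant edges
  -- can be removed.
  entry₃₂ : Ty → Ty → Ty → Ty → Ty → CoreTy → Bool
  entry₃₂ t₁ t₂ t₃ s₁ s₂ k =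
    not (someI₃₂ t₁ t₂ t₃ s₁ s₂) ∨ (exceptional t₁ t₂ t₃ s₁ s₂ k ∨ is-just (search₃₂ t₁ t₂ t₃ s₁ s₂ k))

  private
    all₅ : Ty → Ty → Ty → Ty → Ty → Bool
    all₅ t₁ t₂ t₃ s₁ s₂ = allCore (entry₃₂ t₁ t₂ t₃ s₁ s₂)
    all₄ : Ty → Ty → Ty → Ty → Bool
    all₄ t₁ t₂ t₃ s₁ = allTy (all₅ t₁ t₂ t₃ s₁)
    all₃ : Ty → Ty → Ty → Bool
    all₃ t₁ t₂ t₃ = allTy (all₄ t₁ t₂ t₃)
    all₂ : Ty → Ty → Bool
    all₂ t₁ t₂ = allTy (all₃ t₁ t₂)
    all₁ : Ty → Bool
    all₁ t₁ = allTy (all₂ t₁)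

    -- Verified by evaluation of all 972 combinations: five legs of three types each and four types
    -- of core.
    table₃₂ : allTy all₁ ≡ true
    table₃₂ = refl

  every₃₂ : ∀ t₁ t₂ t₃ s₁ s₂ k → entry₃₂ t₁ t₂ t₃ s₁ s₂ k ≡ true
  every₃₂ t₁ t₂ t₃ s₁ s₂ = allCore-sound (entry₃₂ t₁ t₂ t₃ s₁ s₂) (allTy-sound (all₅ t₁ t₂ t₃ s₁)
    (allTy-sound (all₄ t₁ t₂ t₃) (allTy-sound (all₃ t₁ t₂) (allTy-sound (all₂ t₁) (allTy-sound all₁ table₃₂ t₁) t₂) t₃) s₁) s₂)

  -- As no order of the two hubs is prescribed, either may get the larger sum.
  checkAbove : SLab → List SLab → Bool
  checkAbove h []       = true
  checkAbove h (t ∷ ts) = ltᴸ (sval t) (sval h) ∧ checkAbove h ts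

  check₂₂ : Summary → Bool
  check₂₂ s = (ltᴸ (sval (Vˢ s)) (sval (Uˢ s)) ∨ ltᴸ (sval (Uˢ s)) (sval (Vˢ s))) ∧
    ((ltᴸ (Pˢ s) (sval (Vˢ s)) ∧ checkAbove (Vˢ s) (topsˢ s)) ∧ (ltᴸ (Pˢ s) (sval (Uˢ s)) ∧ checkAbove (Uˢ s) (topsˢ s)))

  rules₂₂ : List (List Slot)
  rules₂₂ =
      (v₁ ∷ v₁ ∷ u₁ ∷ u₁ ∷ uᵉ ∷ core true modeO ∷ uᵉ ∷ vᵉ ∷ vᵠ ∷ uᵠ ∷ uᵒ ∷ vᵒ ∷ vᵉ ∷ [])
    ∷ (u₁ ∷ u₁ ∷ core true modeO ∷ v₁ ∷ vᵠ ∷ [])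
    ∷ (v₁ ∷ v₁ ∷ u₁ ∷ u₁ ∷ core true modeE ∷ vᵠ ∷ vᵉ ∷ vᵠ ∷ uᵉ ∷ vᵉ ∷ uᵉ ∷ uᵠ ∷ uᵒ ∷ [])
    ∷ (vᵉ ∷ core false modeQ ∷ uᵠ ∷ u₁ ∷ v₁ ∷ [])
    ∷ (u₁ ∷ u₁ ∷ vᵒ ∷ core true modeQ ∷ vᵠ ∷ [])
    ∷ (u₁ ∷ u₁ ∷ core true modeQ ∷ vᵠ ∷ vᵒ ∷ [])
    ∷ (u₁ ∷ u₁ ∷ v₁ ∷ core true modeS ∷ vᵒ ∷ [])
    ∷ (u₁ ∷ u₁ ∷ v₁ ∷ core true modeQ ∷ vᵠ ∷ [])
    ∷ []

  -- At each hub the leg that may be the longer one of its type is listed first, so that `pick`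
  -- hands it to the earlier slot.
  pieces₂₂ : Ty → Ty → Ty → Ty → CoreTy → List SPiece
  pieces₂₂ t₁ t₂ s₁ s₂ k = leg hu t₂ (second t₁ t₂ (var 1) (var 2)) ∷ leg hu t₁ (var 1)
    ∷ leg hv s₂ (second s₁ s₂ (var 3) (var 4)) ∷ leg hv s₁ (var 3) ∷ corePiece k ∷ []

  search₂₂ : ∀ t₁ t₂ s₁ s₂ k → Maybe (Solved check₂₂ (pieces₂₂ t₁ t₂ s₁ s₂ k))
  search₂₂ t₁ t₂ s₁ s₂ k = search check₂₂ rules₂₂ (pieces₂₂ t₁ t₂ s₁ s₂ k)

  -- With equal degrees either hub can play the part of `u`; a solution for the exchanged roles is
  -- carried back by `raw-swap`.
  entry₂₂ : Ty → Ty → Ty → Ty → CoreTy → Bool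
  entry₂₂ t₁ t₂ s₁ s₂ k = not (isI t₁ ∨ (isI t₂ ∨ (isI s₁ ∨ isI s₂))) ∨
    (is-just (search₂₂ t₁ t₂ s₁ s₂ k) ∨ is-just (search₂₂ s₁ s₂ t₁ t₂ k))

  private
    any₄ : Ty → Ty → Ty → Ty → Bool
    any₄ t₁ t₂ s₁ s₂ = allCore (entry₂₂ t₁ t₂ s₁ s₂)
    any₃ : Ty → Ty → Ty → Bool
    any₃ t₁ t₂ s₁ = allTy (any₄ t₁ t₂ s₁)
    any₂ : Ty → Ty → Bool
    any₂ t₁ t₂ = allTy (any₃ t₁ t₂)
    any₁ : Ty → Bool
    any₁ t₁ = allTy (any₂ t₁)

    table₂₂ : allTy any₁ ≡ true
    table₂₂ = refl

  every₂₂ : ∀ t₁ t₂ s₁ s₂ k → entry₂₂ t₁ t₂ s₁ s₂ k ≡ true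
  every₂₂ t₁ t₂ s₁ s₂ = allCore-sound (entry₂₂ t₁ t₂ s₁ s₂) (allTy-sound (any₄ t₁ t₂ s₁)
    (allTy-sound (any₃ t₁ t₂) (allTy-sound (any₂ t₁) (allTy-sound any₁ table₂₂ t₁) t₂) s₁) s₂)

-- Forgetting the classes, and extending all legs by one edge.

module Extension where

  open import Data.Bool using (true; false; T)
  open import Data.Nat using (_≤ᵇ_)
  open import Data.Nat.Properties
  open import Data.List.Properties using (concatMap-map; map-concatMap; length-++; length-map; map-++; map-∘; ++-identityʳ; ++-assoc)
  open import Data.List.Membership.Propositional.Properties using (∈-map⁺)
  open import Data.Nat.Tactic.RingSolver using (solve-∀)
  open import Data.List.Relation.Binary.Permutation.Propositional using (refl; trans)
  open import Data.Product using (map₂)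
  open import Relation.Binary.Definitions using (Symmetric; tri<; tri≈; tri>)
  open import Relation.Binary.PropositionalEquality as ≡ using (_≡_; _≢_; cong; cong₂; subst; subst₂)
  open Arithmetic
  open Labellings
  open Zigzags
  open Insertion

  AllPairs-resp-↭ : ∀ {A : Set} {R : A → A → Set} → Symmetric R → ∀ {xs ys} → xs ↭ ys → AllPairs R xs → AllPairs R ys
  AllPairs-resp-↭ s refl         ps                       = ps
  AllPairs-resp-↭ s (prep x p)   (a ∷ ps)                 = All-resp-↭ p a ∷ AllPairs-resp-↭ s p ps
  AllPairs-resp-↭ s (swap x y p) ((r ∷ a) ∷ b ∷ ps)       = (s r ∷ All-resp-↭ p b) ∷ All-resp-↭ p a ∷ AllPairs-resp-↭ s p ps
  AllPairs-resp-↭ s (trans p q)  ps                       = AllPairs-resp-↭ s q (AllPairs-resp-↭ s p ps)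

  AllPairs-++⁻ : ∀ {A : Set} {R : A → A → Set} xs {ys} → AllPairs R (xs ++ ys) →
                 AllPairs R xs × AllPairs R ys × All (λ x → All (R x) ys) xs
  AllPairs-++⁻ []       ps       = [] , ps , []
  AllPairs-++⁻ (x ∷ xs) (a ∷ ps) with p , q , r ← AllPairs-++⁻ xs ps =
    Allₚ.++⁻ˡ xs a ∷ p , q , Allₚ.++⁻ʳ xs a ∷ r

  Differ : Lab → Lab → Set
  Differ x y = val x ≢ val y

  Compat⇒Differ : ∀ {x y} → Compat x y → Differ x y
  Compat⇒Differ (inj₁ (_ , _ , h)) e = <-irrefl e h
  Compat⇒Differ (inj₂ (_ , _ , h)) e = <-irrefl (≡.sym e) h

  end-of : Piece → List Lab
  end-of (uK , xs) = lst xs ∷ []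
  end-of (vK , xs) = lst xs ∷ []
  end-of (cK , xs) = []
  end-of (rK , xs) = []

  ends : Config → List Lab
  ends = concatMap end-of

  -- Only inequalities between values remain, and hubs of equal degree are allowed. No classes need
  -- to be remembered for `Extend`, because it turns every old label into a large one.
  record Raw (U V : List ℕ) (κ : ℕ) : Set where
    field
      cfg    : Config
      pieces : All PieceOK cfg
      diff   : AllPairs Differ (labels cfg)
      range  : All (λ x → 1 ≤ val x × val x ≤ length (labels cfg)) (labels cfg)
      innD   : AllPairs Differ (inner cfg)
      low    : All (λ w → All (λ e → val e < val w) (ends cfg)) (inner cfg)
      inU    : All (λ w → val w < val (totU cfg)) (inner cfg)
      inV    : All (λ w → val w < val (totV cfg)) (inner cfg)
      endU   : All (λ e → val e < val (totU cfg)) (ends cfg)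
      endV   : All (λ e → val e < val (totV cfg)) (ends cfg)
      hubs   : (length V < length U × val (totV cfg) < val (totU cfg)) ⊎
               (length V ≡ length U × val (totV cfg) ≢ val (totU cfg))
      shp    : shape cfg ↭ spider U V κ
      nU     : numU cfg ≡ suc (length U)
      nV     : numV cfg ≡ suc (length V)

  EndS-∈ : ∀ {xs} → EndS xs → lst xs ∈ xs × lv (lst xs) ≡ 0
  EndS-∈ end      = here ≡.refl , ≡.refl
  EndS-∈ (more e) with p , q ← EndS-∈ e = there p , q

  ends-labels : ∀ {P : Lab → Set} {cfg} → All PieceOK cfg → All P (labels cfg) → All (λ e → P e × lv e ≡ 0) (ends cfg)
  ends-labels []           ps = []
  ends-labels (okU {xs} e ∷ os) ps with p , q ← EndS-∈ e = (All.lookup (Allₚ.++⁻ˡ xs ps) p , q) ∷ ends-labels os (Allₚ.++⁻ʳ xs ps)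
  ends-labels (okV {xs} e ∷ os) ps with p , q ← EndS-∈ e = (All.lookup (Allₚ.++⁻ˡ xs ps) p , q) ∷ ends-labels os (Allₚ.++⁻ʳ xs ps)
  ends-labels (okC {x} {xs} ∷ os) ps = ends-labels os (Allₚ.++⁻ʳ (x ∷ xs) ps)
  ends-labels (okR {x} {xs} ∷ os) ps = ends-labels os (Allₚ.++⁻ʳ (x ∷ xs) ps)

  ends-diff : ∀ {cfg} → All PieceOK cfg → AllPairs Differ (labels cfg) → AllPairs Differ (ends cfg)
  ends-diff []           ps = []
  ends-diff (okU {xs} e ∷ os) ps with _ , q , r ← AllPairs-++⁻ xs ps =
    All.map proj₁ (ends-labels os (All.lookup r (proj₁ (EndS-∈ e)))) ∷ ends-diff os q
  ends-diff (okV {xs} e ∷ os) ps with _ , q , r ← AllPairs-++⁻ xs ps =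
    All.map proj₁ (ends-labels os (All.lookup r (proj₁ (EndS-∈ e)))) ∷ ends-diff os q
  ends-diff (okC {x} {xs} ∷ os) ps = ends-diff os (proj₁ (proj₂ (AllPairs-++⁻ (x ∷ xs) ps)))
  ends-diff (okR {x} {xs} ∷ os) ps = ends-diff os (proj₁ (proj₂ (AllPairs-++⁻ (x ∷ xs) ps)))

  inv-raw : ∀ {P R m U V κ cfg} → Inv P R m cfg →
    All (λ w → val w < val (totU cfg)) (inner cfg) → All (λ w → val w < val (totV cfg)) (inner cfg) →
    P < val (totU cfg) → P < val (totV cfg) →
    (length V < length U × val (totV cfg) < val (totU cfg)) ⊎ (length V ≡ length U × val (totV cfg) ≢ val (totU cfg)) →
    shape cfg ↭ spider U V κ → numU cfg ≡ suc (length U) → numV cfg ≡ suc (length V) → Raw U V κ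
  inv-raw {P} {R} {m} {cfg = cfg} I wu wv pu pv h s nu nv = record
    { cfg = cfg ; pieces = pieces
    ; diff = AllPairs.map Compat⇒Differ lab
    ; range = All.map (λ c → map₂ (λ h → ≤-trans h (≤-reflexive (≡.sym len))) (rng c)) cls
    ; innD = AllPairs.map Compat⇒Differ inn
    ; low = All.map (λ {w} h → All.map (λ e → ≤-<-trans e (≤-<-trans (m≤m+n P (lv w)) h)) e≤P) innP
    ; inU = wu ; inV = wv
    ; endU = All.map (λ e → ≤-<-trans e pu) e≤P
    ; endV = All.map (λ e → ≤-<-trans e pv) e≤P
    ; hubs = h ; shp = s ; nU = nu ; nV = nv }
    where
    open Inv I
    rng : ∀ {x} → Cls P R m x → 1 ≤ val x × val x ≤ m
    rng (clsS p q) = p , ≤-trans q (≤-trans P≤R R≤m)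
    rng (clsL p q) = ≤-trans (s≤s z≤n) p , ≤-trans q R≤m
    rng (clsQ p q) = ≤-trans (s≤s z≤n) p , q
    S≤P : ∀ {x} → Cls P R m x × lv x ≡ 0 → val x ≤ P
    S≤P (clsS _ q , _) = q
    e≤P : All (λ e → val e ≤ P) (ends cfg)
    e≤P = All.map S≤P (ends-labels pieces cls)

  result-raw : ∀ {U V κ} → length V < length U → Result U V κ → Raw U V κ
  result-raw h r = inv-raw inv (All.map (λ { (a , _) → <-trans a V<U }) W<V) (All.map proj₁ W<V)
    (<-trans P<V V<U) P<V (inj₁ (h , V<U)) shp nU nV
    where
    open Result r
    open Ord ord

  -- The new leg makes the degrees equal, so `Ord` cannot hold any longer and the outcome is a
  -- `Raw`.
  addV1-raw : ∀ {U V κ} → Result U V κ → suc (length V) ≡ length U → Raw U (1 ∷ V) κ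
  addV1-raw {U} {V} {κ} r h = inv-raw (Step.step P R m 1 0 0 0 inv (one-ok vK okV inv))
    (All.map (λ { (a , _) → <-trans a V<U′ }) (W<V′ [])) (All.map proj₁ (W<V′ [])) (<-trans P<V′ V<U′) P<V′
    (inj₂ (h , λ e → <-irrefl e V<U′))
    (↭-trans (↭-reflexive (shape-step 1 0 0 N cfg)) (↭-trans (prep _ shp) (spider-v 1 U V κ)))
    (≡.trans numU-next nU) (≡.trans numV-next (cong suc nV))
    where
    open Result r
    open Ord ord
    N = (vK , S 1 ∷ []) ∷ []
    open Hub {cfg} (Inv.pieces inv) 1 0 0 N
    open Grow inv ord z≤n N
    V<U′ : val (totV next) < val (totU next)
    V<U′ = subst₂ (λ x y → val x < val y) (≡.sym totV-next) (≡.sym totU-next)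
      (uvV1 (val (totV cfg)) (val (totU cfg)) (numV cfg) (numU cfg) (lv (totV cfg)) (lv (totU cfg)) (tp (totV cfg)) (tp (totU cfg)) V<U nn)

  swapK : Kind → Kind
  swapK uK = vK
  swapK vK = uK
  swapK cK = rK
  swapK rK = cK

  swapC : Config → Config
  swapC = map (λ p → swapK (proj₁ p) , proj₂ p)

  concatMap-swap : ∀ {f g : Piece → List Lab} → (∀ p → f (swapK (proj₁ p) , proj₂ p) ≡ g p) → ∀ cfg → concatMap f (swapC cfg) ≡ concatMap g cfg
  concatMap-swap h []        = ≡.refl
  concatMap-swap h (p ∷ cfg) = cong₂ _++_ (h p) (concatMap-swap h cfg)

  swapT : Tag × ℕ → Tag × ℕ
  swapT (uT , n) = vT , n
  swapT (vT , n) = uT , n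
  swapT (cT , n) = cT , n

  raw-swap : ∀ {U V κ} → length U ≡ length V → Raw U V κ → Raw V U κ
  raw-swap {U} {V} {κ} h r = record
    { cfg = swapC cfg
    ; pieces = Allₚ.map⁺ (All.map ok pieces)
    ; diff = subst (AllPairs Differ) (≡.sym eL) diff
    ; range = subst (λ ls → All (λ x → 1 ≤ val x × val x ≤ length ls) ls) (≡.sym eL) range
    ; innD = subst (AllPairs Differ) (≡.sym eI) innD
    ; low = subst₂ (λ ws es → All (λ w → All (λ e → val e < val w) es) ws) (≡.sym eI) (≡.sym eE) low
    ; inU = subst₂ (λ ws u → All (λ w → val w < val u) ws) (≡.sym eI) (≡.sym eU) inV
    ; inV = subst₂ (λ ws u → All (λ w → val w < val u) ws) (≡.sym eI) (≡.sym eV) inU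
    ; endU = subst₂ (λ ws u → All (λ w → val w < val u) ws) (≡.sym eE) (≡.sym eU) endV
    ; endV = subst₂ (λ ws u → All (λ w → val w < val u) ws) (≡.sym eE) (≡.sym eV) endU
    ; hubs = inj₂ (h , λ e → nh hubs (≡.trans (≡.sym (cong val eU)) (≡.trans (≡.sym e) (cong val eV))))
    ; shp = ↭-trans (↭-reflexive (shape-swap cfg)) (↭-trans (Perm.map⁺ swapT shp) (prep _
        (↭-trans (↭-reflexive (≡.trans (map-++ swapT (map (uT ,_) U) _) (cong₂ _++_ (≡.sym (map-∘ U)) (≡.sym (map-∘ V)))))
                 (Perm.++-comm (map (vT ,_) U) (map (uT ,_) V)))))
    ; nU = ≡.trans (cong length eHU) nV
    ; nV = ≡.trans (cong length eHV) nU
    }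
    where
    open Raw r
    ok : ∀ {p} → PieceOK p → PieceOK (swapK (proj₁ p) , proj₂ p)
    ok (okU e) = okV e
    ok (okV e) = okU e
    ok okC     = okR
    ok okR     = okC
    eL = concatMap-swap {proj₂} (λ _ → ≡.refl) cfg
    eI = concatMap-swap {λ p → sums (proj₂ p)} (λ _ → ≡.refl) cfg
    eE : ends (swapC cfg) ≡ ends cfg
    eE = concatMap-swap {end-of} {end-of} (λ { (uK , _) → ≡.refl ; (vK , _) → ≡.refl ; (cK , _) → ≡.refl ; (rK , _) → ≡.refl }) cfg
    eHU : hubU (swapC cfg) ≡ hubV cfg
    eHU = concatMap-swap {atU} {atV} (λ { (uK , _) → ≡.refl ; (vK , _) → ≡.refl ; (cK , _) → ≡.refl ; (rK , _) → ≡.refl }) cfg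
    eHV : hubV (swapC cfg) ≡ hubU cfg
    eHV = concatMap-swap {atV} {atU} (λ { (uK , _) → ≡.refl ; (vK , _) → ≡.refl ; (cK , _) → ≡.refl ; (rK , _) → ≡.refl }) cfg
    eU = cong total eHU
    eV = cong total eHV
    nh : (length V < length U × val (totV cfg) < val (totU cfg)) ⊎ (length V ≡ length U × val (totV cfg) ≢ val (totU cfg)) → val (totV cfg) ≢ val (totU cfg)
    nh (inj₁ (_ , a)) e = <-irrefl e a
    nh (inj₂ (_ , a)) = a
    shape-swap : ∀ cfg → shape (swapC cfg) ≡ map swapT (shape cfg)
    shape-swap []               = ≡.refl
    shape-swap ((uK , _) ∷ cfg) = cong (_ ∷_) (shape-swap cfg)
    shape-swap ((vK , _) ∷ cfg) = cong (_ ∷_) (shape-swap cfg)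
    shape-swap ((cK , _) ∷ cfg) = cong (_ ∷_) (shape-swap cfg)
    shape-swap ((rK , _) ∷ cfg) = cong (_ ∷_) (shape-swap cfg)

  -- On the pendant labels themselves this count is strictly increasing and takes values in `1,…,t`.
  -- It serves to order the new pendant labels like the old ones.
  rank : List ℕ → ℕ → ℕ
  rank []       x = 0
  rank (e ∷ es) x with e ≤ᵇ x
  ... | true  = suc (rank es x)
  ... | false = rank es x

  rank-≤ : ∀ es x → rank es x ≤ length es
  rank-≤ []       x = z≤n
  rank-≤ (e ∷ es) x with e ≤ᵇ x
  ... | true  = s≤s (rank-≤ es x)
  ... | false = m≤n⇒m≤1+n (rank-≤ es x)

  rank-mono : ∀ es {x y} → x ≤ y → rank es x ≤ rank es y
  rank-mono []       h = z≤n
  rank-mono (e ∷ es) {x} {y} h with e ≤ᵇ x in p | e ≤ᵇ y in q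
  ... | true  | true  = s≤s (rank-mono es h)
  ... | false | true  = m≤n⇒m≤1+n (rank-mono es h)
  ... | false | false = rank-mono es h
  ... | true  | false = ⊥-elim (subst T q (≤⇒≤ᵇ (≤-trans (≤ᵇ⇒≤ e x (subst T (≡.sym p) _)) h)))

  rank-< : ∀ es {x y} → x < y → y ∈ es → rank es x < rank es y
  rank-< (e ∷ es) {x} {y} h (here ≡.refl) with y ≤ᵇ x in p | y ≤ᵇ y in q
  ... | true  | _     = ⊥-elim (<⇒≱ h (≤ᵇ⇒≤ y x (subst T (≡.sym p) _)))
  ... | false | true  = s≤s (rank-mono es (<⇒≤ h))
  ... | false | false = ⊥-elim (subst T q (≤⇒≤ᵇ (≤-refl {y})))
  rank-< (e ∷ es) {x} {y} h (there i) with e ≤ᵇ x in p | e ≤ᵇ y in q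
  ... | true  | true  = s≤s (rank-< es h i)
  ... | false | true  = m≤n⇒m≤1+n (rank-< es h i)
  ... | false | false = rank-< es h i
  ... | true  | false = ⊥-elim (subst T q (≤⇒≤ᵇ (≤-trans (≤ᵇ⇒≤ e x (subst T (≡.sym p) _)) (<⇒≤ h))))

  rank-pos : ∀ es {x} → x ∈ es → 1 ≤ rank es x
  rank-pos (e ∷ es) {x} (here ≡.refl) with x ≤ᵇ x in q
  ... | true  = s≤s z≤n
  ... | false = ⊥-elim (subst T q (≤⇒≤ᵇ (≤-refl {x})))
  rank-pos (e ∷ es) {x} (there i) with e ≤ᵇ x
  ... | true  = s≤s z≤n
  ... | false = rank-pos es i

  concatMap-split : ∀ {A B : Set} (f g : A → List B) xs → concatMap (λ x → f x ++ g x) xs ↭ concatMap f xs ++ concatMap g xs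
  concatMap-split f g []       = ↭-refl
  concatMap-split f g (x ∷ xs) = ↭-trans (Perm.++⁺ˡ (f x ++ g x) (concatMap-split f g xs))
    (↭-trans (↭-reflexive (++-assoc (f x) (g x) _))
    (↭-trans (Perm.++⁺ˡ (f x) (Perm.shifts (g x) (concatMap f xs)))
             (↭-reflexive (≡.sym (++-assoc (f x) (concatMap f xs) _)))))

  -- A total weight of the tags is invariant under permutation; suitable weights read the hub
  -- degrees and the number of leaves off the shape.
  weigh : (Tag → ℕ) → List (Tag × ℕ) → ℕ
  weigh w []            = 0
  weigh w ((t , _) ∷ s) = w t + weigh w s

  weigh-↭ : ∀ w {s s′} → s ↭ s′ → weigh w s ≡ weigh w s′
  weigh-↭ w refl         = ≡.refl
  weigh-↭ w (prep _ p)   = cong (w _ +_) (weigh-↭ w p)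
  weigh-↭ w (trans p q)  = ≡.trans (weigh-↭ w p) (weigh-↭ w q)
  weigh-↭ w (swap (x , _) (y , _) p) = ≡.trans (cong (λ a → w x + (w y + a)) (weigh-↭ w p)) (lem (w x) (w y) _)
    where
    lem : ∀ x y a → x + (y + a) ≡ y + (x + a)
    lem = solve-∀

  weigh-spider : ∀ w U V κ → weigh w (spider U V κ) ≡ w cT + (length U * w uT + length V * w vT)
  weigh-spider w []      V κ = cong (w cT +_) (go V)
    where
    go : ∀ V → weigh w (map (vT ,_) V) ≡ length V * w vT
    go []      = ≡.refl
    go (x ∷ V) = cong (w vT +_) (go V)
  weigh-spider w (x ∷ U) V κ = ≡.trans (lem₁ (w cT) (w uT) (weigh w (map (uT ,_) U ++ map (vT ,_) V)))
    (≡.trans (cong (w uT +_) (weigh-spider w U V κ)) (lem₂ (w cT) (w uT) (length U * w uT) (length V * w vT)))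
    where
    lem₁ : ∀ c u a → c + (u + a) ≡ u + (c + a)
    lem₁ = solve-∀
    lem₂ : ∀ c u a b → u + (c + (a + b)) ≡ c + (u + a + b)
    lem₂ = solve-∀

  isLeg isU isV : Tag → ℕ
  isLeg cT = 0
  isLeg _  = 1
  isU vT = 0
  isU _  = 1
  isV uT = 0
  isV _  = 1

  weigh-ends : ∀ cfg → weigh isLeg (shape cfg) ≡ length (ends cfg)
  weigh-ends []               = ≡.refl
  weigh-ends ((uK , _) ∷ cfg) = cong suc (weigh-ends cfg)
  weigh-ends ((vK , _) ∷ cfg) = cong suc (weigh-ends cfg)
  weigh-ends ((cK , _) ∷ cfg) = weigh-ends cfg
  weigh-ends ((rK , _) ∷ cfg) = weigh-ends cfg

  weigh-numU : ∀ cfg → weigh isU (shape cfg) ≡ numU cfg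
  weigh-numU []               = ≡.refl
  weigh-numU ((uK , _) ∷ cfg) = cong suc (weigh-numU cfg)
  weigh-numU ((vK , _) ∷ cfg) = weigh-numU cfg
  weigh-numU ((cK , _) ∷ cfg) = cong suc (weigh-numU cfg)
  weigh-numU ((rK , _) ∷ cfg) = cong suc (weigh-numU cfg)

  weigh-numV : ∀ cfg → weigh isV (shape cfg) ≡ numV cfg
  weigh-numV []               = ≡.refl
  weigh-numV ((uK , _) ∷ cfg) = weigh-numV cfg
  weigh-numV ((vK , _) ∷ cfg) = cong suc (weigh-numV cfg)
  weigh-numV ((cK , _) ∷ cfg) = cong suc (weigh-numV cfg)
  weigh-numV ((rK , _) ∷ cfg) = cong suc (weigh-numV cfg)

  shape-ends : ∀ {U V κ} cfg → shape cfg ↭ spider U V κ → length (ends cfg) ≡ length U + length V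
  shape-ends {U} {V} {κ} cfg p = ≡.trans (≡.sym (weigh-ends cfg)) (≡.trans (weigh-↭ isLeg p)
    (≡.trans (weigh-spider isLeg U V κ) (cong₂ _+_ (*-identityʳ (length U)) (*-identityʳ (length V)))))

  shape-numU : ∀ {U V κ} cfg → shape cfg ↭ spider U V κ → numU cfg ≡ suc (length U)
  shape-numU {U} {V} {κ} cfg p = ≡.trans (≡.sym (weigh-numU cfg)) (≡.trans (weigh-↭ isU p)
    (≡.trans (weigh-spider isU U V κ) (cong suc (≡.trans (cong₂ _+_ (*-identityʳ (length U)) (*-zeroʳ (length V))) (+-identityʳ _)))))

  shape-numV : ∀ {U V κ} cfg → shape cfg ↭ spider U V κ → numV cfg ≡ suc (length V)
  shape-numV {U} {V} {κ} cfg p = ≡.trans (≡.sym (weigh-numV cfg)) (≡.trans (weigh-↭ isV p)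
    (≡.trans (weigh-spider isV U V κ) (cong suc (cong₂ _+_ (*-zeroʳ (length U)) (*-identityʳ (length V))))))

  -- All legs are extended by one edge; the new pendant labels 1,…,t follow the order of the old
  -- ones, and all old labels are raised by t and become L-labels.
  module Extend {U V : List ℕ} {κ : ℕ} (r : Raw U V κ) (3≤t : 3 ≤ length U + length V) (1≤V : 1 ≤ length V) (V≤U : length V ≤ length U) where
    open Raw r

    es : List ℕ
    es = map val (ends cfg)

    t : ℕ
    t = length (ends cfg)

    t≡ : t ≡ length U + length V
    t≡ = shape-ends {U} {V} {κ} cfg shp

    3≤ : 3 ≤ t
    3≤ = subst (3 ≤_) (≡.sym t≡) 3≤t

    rk : Lab → ℕ
    rk e = rank es (val e)

    rk≤t : ∀ e → rk e ≤ t
    rk≤t e = ≤-trans (rank-≤ es (val e)) (≤-reflexive (length-map val (ends cfg)))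

    raise raise₂ newEnd endSum : Lab → Lab
    raise x  = L (val x + t)
    raise₂ w = ⟨ 2 , 0 , val w + (t + t) ⟩
    newEnd e = S (rk e)
    endSum e = L (val e + t + rk e)

    grow : Piece → Piece
    grow (k , xs) = k , map raise xs ++ map newEnd (end-of (k , xs))

    cfg′ : Config
    cfg′ = map grow cfg

    raise-⊕ : ∀ x y → raise x ⊕ raise y ≡ raise₂ (x ⊕ y)
    raise-⊕ x y = cong ⟨ 2 , 0 ,_⟩ (lem (val x) (val y) t)
      where
      lem : ∀ x y t → x + t + (y + t) ≡ x + y + (t + t)
      lem = solve-∀

    sums-raise : ∀ xs → sums (map raise xs) ≡ map raise₂ (sums xs)
    sums-raise []           = ≡.refl
    sums-raise (x ∷ [])     = ≡.refl
    sums-raise (x ∷ y ∷ zs) = cong₂ _∷_ (raise-⊕ x y) (sums-raise (y ∷ zs))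

    sums-leg : ∀ x xs e → sums (map raise (x ∷ xs) ++ S e ∷ []) ≡ map raise₂ (sums (x ∷ xs)) ++ L (val (lst (x ∷ xs)) + t + e) ∷ []
    sums-leg x []       e = ≡.refl
    sums-leg x (y ∷ ys) e = cong₂ _∷_ (raise-⊕ x y) (sums-leg y ys e)

    labels′ : labels cfg′ ↭ map raise (labels cfg) ++ map newEnd (ends cfg)
    labels′ = ↭-trans (↭-reflexive (concatMap-map proj₂ grow cfg))
      (↭-trans (concatMap-split (λ p → map raise (proj₂ p)) (λ p → map newEnd (end-of p)) cfg)
        (↭-reflexive (≡.sym (cong₂ _++_ (map-concatMap raise proj₂ cfg) (map-concatMap newEnd end-of cfg)))))

    sums-grow : ∀ {p} → PieceOK p → sums (proj₂ (grow p)) ≡ map raise₂ (sums (proj₂ p)) ++ map endSum (end-of p)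
    sums-grow (okU {x ∷ xs} _) = sums-leg x xs _
    sums-grow (okV {x ∷ xs} _) = sums-leg x xs _
    sums-grow (okC {x} {xs})   = ≡.trans (cong sums (++-identityʳ _)) (≡.trans (sums-raise (x ∷ xs)) (≡.sym (++-identityʳ _)))
    sums-grow (okR {x} {xs})   = ≡.trans (cong sums (++-identityʳ _)) (≡.trans (sums-raise (x ∷ xs)) (≡.sym (++-identityʳ _)))

    inner′ : inner cfg′ ↭ map raise₂ (inner cfg) ++ map endSum (ends cfg)
    inner′ = ↭-trans (↭-reflexive (go pieces))
      (↭-trans (concatMap-split (λ p → map raise₂ (sums (proj₂ p))) (λ p → map endSum (end-of p)) cfg)
        (↭-reflexive (≡.sym (cong₂ _++_ (map-concatMap raise₂ (λ p → sums (proj₂ p)) cfg) (map-concatMap endSum end-of cfg)))))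
      where
      go : ∀ {c} → All PieceOK c → inner (map grow c) ≡ concatMap (λ p → map raise₂ (sums (proj₂ p)) ++ map endSum (end-of p)) c
      go []       = ≡.refl
      go (o ∷ os) = cong₂ _++_ (sums-grow o) (go os)

    hubU′ : hubU cfg′ ≡ map raise (hubU cfg)
    hubU′ = go pieces
      where
      lst-raise : ∀ x xs → lst (map raise (x ∷ xs) ++ []) ≡ raise (lst (x ∷ xs))
      lst-raise x []       = ≡.refl
      lst-raise x (y ∷ ys) = lst-raise y ys
      go : ∀ {c} → All PieceOK c → hubU (map grow c) ≡ map raise (hubU c)
      go []                   = ≡.refl
      go (okU {x ∷ xs} _ ∷ os) = cong (raise x ∷_) (go os)
      go (okV {x ∷ xs} _ ∷ os) = go os
      go (okC {x} ∷ os)       = cong (raise x ∷_) (go os)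
      go (okR {x} {xs} ∷ os)  = cong₂ _∷_ (lst-raise x xs) (go os)

    hubV′ : hubV cfg′ ≡ map raise (hubV cfg)
    hubV′ = go pieces
      where
      lst-raise : ∀ x xs → lst (map raise (x ∷ xs) ++ []) ≡ raise (lst (x ∷ xs))
      lst-raise x []       = ≡.refl
      lst-raise x (y ∷ ys) = lst-raise y ys
      go : ∀ {c} → All PieceOK c → hubV (map grow c) ≡ map raise (hubV c)
      go []                   = ≡.refl
      go (okU {x ∷ xs} _ ∷ os) = go os
      go (okV {x ∷ xs} _ ∷ os) = cong (raise x ∷_) (go os)
      go (okC {x} {xs} ∷ os)  = cong₂ _∷_ (lst-raise x xs) (go os)
      go (okR {x} ∷ os)       = cong (raise x ∷_) (go os)

    total-raise : ∀ xs → total (map raise xs) ≡ ⟨ length xs , 0 , val (total xs) + length xs * t ⟩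
    total-raise []       = ≡.refl
    total-raise (x ∷ xs) rewrite total-raise xs = cong ⟨ suc (length xs) , 0 ,_⟩ (lem (val x) (val (total xs)) t (length xs * t))
      where
      lem : ∀ x y t z → x + t + (y + z) ≡ x + y + (t + z)
      lem = solve-∀

    totU′ : totU cfg′ ≡ ⟨ numU cfg , 0 , val (totU cfg) + numU cfg * t ⟩
    totU′ = ≡.trans (cong total hubU′) (total-raise (hubU cfg))

    totV′ : totV cfg′ ≡ ⟨ numV cfg , 0 , val (totV cfg) + numV cfg * t ⟩
    totV′ = ≡.trans (cong total hubV′) (total-raise (hubV cfg))

    rise : ∀ e {e′} → e′ ∈ ends cfg → val e < val e′ → rk e < rk e′
    rise e i h = rank-< es h (∈-map⁺ val i)

    ends! : AllPairs (λ e e′ → Differ e e′ × e ∈ ends cfg × e′ ∈ ends cfg) (ends cfg)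
    ends! = go (ends-diff pieces diff) (λ i → i)
      where
      go : ∀ {xs} → AllPairs Differ xs → (∀ {x} → x ∈ xs → x ∈ ends cfg) →
           AllPairs (λ e e′ → Differ e e′ × e ∈ ends cfg × e′ ∈ ends cfg) xs
      go []       f = []
      go (d ∷ ds) f = All.tabulate (λ i → All.lookup d i , f (here ≡.refl) , f (there i)) ∷ go ds (f ∘ there)

    -- There are no Q-labels, hence `R = m`. As all old labels get the same class, their mere
    -- difference already gives `Compat`.
    inv′ : Inv t (length (labels cfg) + t) (length (labels cfg) + t) cfg′
    inv′ = record
      { P≤R = m≤n+m t _
      ; R≤m = ≤-refl
      ; lab = AllPairs-resp-↭ Compat-sym (↭-sym labels′) (APₚ.++⁺
          (APₚ.map⁺ (AllPairs.map (λ {x} {y} → cmpL x y) diff))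
          (APₚ.map⁺ (AllPairs.map (λ {x} {y} → cmpS x y) ends!))
          (Allₚ.map⁺ (All.map (λ {x} h → Allₚ.map⁺ (All.universal (λ e → inj₂ (z≤n , z≤n , ≤-<-trans (rk≤t e) (m<n+m t (proj₁ h)))) (ends cfg))) range)))
      ; cls = All-resp-↭ (↭-sym labels′) (Allₚ.++⁺
          (Allₚ.map⁺ (All.map (λ { {x} (a , b) → clsL (m<n+m t a) (+-monoˡ-≤ t b) }) range))
          (Allₚ.map⁺ (All.tabulate (λ {e} i → clsS (rank-pos es (∈-map⁺ val i)) (rk≤t e)))))
      ; len = ≡.trans (↭-length labels′) (≡.trans (length-++ (map raise (labels cfg)))
          (cong₂ _+_ (length-map raise (labels cfg)) (length-map newEnd (ends cfg))))
      ; inn = AllPairs-resp-↭ Compat-sym (↭-sym inner′) (APₚ.++⁺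
          (APₚ.map⁺ (AllPairs.map (λ {x} {y} → cmp₂ x y) innD))
          (APₚ.map⁺ (AllPairs.map (λ {x} {y} → cmpE x y) ends!))
          -- The old label at a leaf is below every old inner sum; the new sum there adds `t` and a
          -- rank of at most `t`, while the inner sum gains `2t`.
          (Allₚ.map⁺ (All.map (λ {w} h → Allₚ.map⁺ (All.map (λ {e} q → inj₂ (s≤s z≤n , z≤n , b-end<in (val e) t (rk e) (val w) (rk≤t e) q)) h)) low)))
      ; innP = All-resp-↭ (↭-sym inner′) (Allₚ.++⁺
          -- An old inner sum now has two large labels, so the claim is `t + 2 < val w + 2t`; at
          -- least three leaves make it true.
          (Allₚ.map⁺ (All.universal (λ w → b-in2P (val w) t 3≤) (inner cfg)))
          (Allₚ.map⁺ (All.tabulate (λ {e} i → b-inP (val e) t (rk e) (proj₁ (proj₁ (All.lookup (ends-labels pieces range) i))) (rank-pos es (∈-map⁺ val i))))))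
      ; pieces = Allₚ.map⁺ (All.map ok pieces)
      }
      where
      cmpL : ∀ x y → Differ x y → Compat (raise x) (raise y)
      cmpL x y d with <-cmp (val x) (val y)
      ... | tri< h _ _ = inj₁ (≤-refl , z≤n , +-monoˡ-< t h)
      ... | tri≈ _ h _ = ⊥-elim (d h)
      ... | tri> _ _ h = inj₂ (≤-refl , z≤n , +-monoˡ-< t h)
      cmp₂ : ∀ x y → Differ x y → Compat (raise₂ x) (raise₂ y)
      cmp₂ x y d with <-cmp (val x) (val y)
      ... | tri< h _ _ = inj₁ (≤-refl , z≤n , +-monoˡ-< (t + t) h)
      ... | tri≈ _ h _ = ⊥-elim (d h)
      ... | tri> _ _ h = inj₂ (≤-refl , z≤n , +-monoˡ-< (t + t) h)
      cmpS : ∀ x y → Differ x y × x ∈ ends cfg × y ∈ ends cfg → Compat (newEnd x) (newEnd y)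
      cmpS x y (d , i , j) with <-cmp (val x) (val y)
      ... | tri< h _ _ = inj₁ (z≤n , z≤n , rise x j h)
      ... | tri≈ _ h _ = ⊥-elim (d h)
      ... | tri> _ _ h = inj₂ (z≤n , z≤n , rise y i h)
      cmpE : ∀ x y → Differ x y × x ∈ ends cfg × y ∈ ends cfg → Compat (endSum x) (endSum y)
      cmpE x y (d , i , j) with <-cmp (val x) (val y)
      ... | tri< h _ _ = inj₁ (≤-refl , z≤n , +-mono-< (+-monoˡ-< t h) (rise x j h))
      ... | tri≈ _ h _ = ⊥-elim (d h)
      ... | tri> _ _ h = inj₂ (≤-refl , z≤n , +-mono-< (+-monoˡ-< t h) (rise y i h))
      EndS-snoc : ∀ xs {a} → EndS (xs ++ S a ∷ [])
      EndS-snoc []           = end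
      EndS-snoc (x ∷ [])     = more end
      EndS-snoc (x ∷ y ∷ ys) = more (EndS-snoc (y ∷ ys))
      ok : ∀ {p} → PieceOK p → PieceOK (grow p)
      ok (okU {xs} _) = okU (EndS-snoc (map raise xs))
      ok (okV {xs} _) = okV (EndS-snoc (map raise xs))
      ok okC          = okC
      ok okR          = okR

    private
      2t≤V : 2 * t ≤ numV cfg * t
      2t≤V = *-monoˡ-≤ t (subst (2 ≤_) (≡.sym nV) (s≤s 1≤V))
      2t≤U : 2 * t ≤ numU cfg * t
      2t≤U = *-monoˡ-≤ t (subst (2 ≤_) (≡.sym nU) (s≤s (≤-trans 1≤V V≤U)))

      below : ∀ {h n} → All (λ w → val w < h) (inner cfg) → All (λ e → val e < h) (ends cfg) → 2 * t ≤ n →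
              All (λ w → val w < h + n × lv w ≤ 2) (inner cfg′)
      below {h} {n} a b c = All-resp-↭ (↭-sym inner′) (Allₚ.++⁺
        (Allₚ.map⁺ (All.map (λ {w} p → b-hub (val w) h t n p c , ≤-refl) a))
        (Allₚ.map⁺ (All.map (λ {e} p → b-hubE (val e) h t (rk e) n p (rk≤t e) c , s≤s z≤n) b)))

      t<hub : ∀ {h n} → 1 ≤ h → 2 * t ≤ n → t < h + n
      t<hub {h} {n} p c = b-hubP 0 h t n p c

      some : ∀ {h} xs → 1 ≤ length xs → All (λ (e : Lab) → val e < h) xs → 1 ≤ h
      some (x ∷ xs) p (q ∷ _) = ≤-trans (s≤s z≤n) q

      1≤t : 1 ≤ t
      1≤t = ≤-trans (s≤s z≤n) 3≤

      t<U : t < val (totU cfg) + numU cfg * t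
      t<U = t<hub (some (ends cfg) 1≤t endU) 2t≤U
      t<V : t < val (totV cfg) + numV cfg * t
      t<V = t<hub (some (ends cfg) 1≤t endV) 2t≤V

      sucT : Tag × ℕ → Tag × ℕ
      sucT (uT , n) = uT , suc n
      sucT (vT , n) = vT , suc n
      sucT (cT , n) = cT , n

      shape′ : ∀ c → shape (map grow c) ≡ map sucT (shape c)
      shape′ []              = ≡.refl
      shape′ ((uK , xs) ∷ c) = cong₂ _∷_ (cong (uT ,_) (≡.trans (length-++ (map raise xs)) (≡.trans (+-comm _ 1) (cong suc (length-map raise xs))))) (shape′ c)
      shape′ ((vK , xs) ∷ c) = cong₂ _∷_ (cong (vT ,_) (≡.trans (length-++ (map raise xs)) (≡.trans (+-comm _ 1) (cong suc (length-map raise xs))))) (shape′ c)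
      shape′ ((cK , xs) ∷ c) = cong₂ _∷_ (cong (cT ,_) (≡.trans (length-++ (map raise xs)) (≡.trans (+-identityʳ _) (length-map raise xs)))) (shape′ c)
      shape′ ((rK , xs) ∷ c) = cong₂ _∷_ (cong (cT ,_) (≡.trans (length-++ (map raise xs)) (≡.trans (+-identityʳ _) (length-map raise xs)))) (shape′ c)

      shp′ : shape cfg′ ↭ spider (map suc U) (map suc V) κ
      shp′ = ↭-trans (↭-reflexive (shape′ cfg)) (↭-trans (Perm.map⁺ sucT shp) (↭-reflexive (cong ((cT , κ) ∷_)
        (≡.trans (map-++ sucT (map (uT ,_) U) _) (cong₂ _++_ (≡.trans (≡.sym (map-∘ U)) (map-∘ U)) (≡.trans (≡.sym (map-∘ V)) (map-∘ V)))))))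

      numU′ : numU cfg′ ≡ numU cfg
      numU′ = ≡.trans (cong length hubU′) (length-map raise (hubU cfg))
      numV′ : numV cfg′ ≡ numV cfg
      numV′ = ≡.trans (cong length hubV′) (length-map raise (hubV cfg))

      nU′ : numU cfg′ ≡ suc (length (map suc U))
      nU′ = ≡.trans numU′ (≡.trans nU (cong suc (≡.sym (length-map suc U))))
      nV′ : numV cfg′ ≡ suc (length (map suc V))
      nV′ = ≡.trans numV′ (≡.trans nV (cong suc (≡.sym (length-map suc V))))

    -- Hubs of equal degree rise by the same amount, so their sums stay distinct.
    extend-raw : length V ≡ length U → Raw (map suc U) (map suc V) κ
    extend-raw e = inv-raw inv′
      (subst (λ u → All (λ w → val w < val u) (inner cfg′)) (≡.sym totU′) (All.map proj₁ (below inU endU 2t≤U)))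
      (subst (λ u → All (λ w → val w < val u) (inner cfg′)) (≡.sym totV′) (All.map proj₁ (below inV endV 2t≤V)))
      (subst (λ u → t < val u) (≡.sym totU′) t<U) (subst (λ u → t < val u) (≡.sym totV′) t<V)
      (inj₂ (≡.trans (length-map suc V) (≡.trans e (≡.sym (length-map suc U))) , differ hubs)) shp′ nU′ nV′
      where
      nn : numV cfg ≡ numU cfg
      nn = ≡.trans nV (≡.trans (cong suc e) (≡.sym nU))
      differ : (length V < length U × val (totV cfg) < val (totU cfg)) ⊎ (length V ≡ length U × val (totV cfg) ≢ val (totU cfg)) →
               val (totV cfg′) ≢ val (totU cfg′)
      differ (inj₁ (h , _)) _ = <-irrefl e h
      differ (inj₂ (_ , h)) q = h (+-cancelʳ-≡ (numV cfg * t) _ _ (≡.trans (≡.trans (≡.sym (cong val totV′)) (≡.trans q (cong val totU′)))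
        (cong (λ n → val (totU cfg) + n * t) (≡.sym nn))))

    extend-result : length V < length U → 2 ≤ length V → Result (map suc U) (map suc V) κ
    extend-result h 2≤V = record
      { cfg = cfg′
      ; inv = inv′
      ; ord = record
        { V<U = subst₂ (λ x y → val x < val y) (≡.sym totV′) (≡.sym totU′) (+-mono-<-≤ (less hubs) (*-monoˡ-≤ t (<⇒≤ nn)))
        ; P<V = subst (λ u → t < val u) (≡.sym totV′) t<V
        ; W<V = subst (λ u → All (λ w → val w < val u × lv w ≤ suc (lv u)) (inner cfg′)) (≡.sym totV′)
                  (All.map (map₂ (λ q → ≤-trans q (m≤n⇒m≤1+n (≤-trans (n≤1+n 2) 3≤n)))) (below inV endV 2t≤V))
        ; lvs = subst₂ (λ x y → lv x ≤ lv y + 2) (≡.sym totV′) (≡.sym totU′) (≤-trans (<⇒≤ nn) (m≤m+n _ 2))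
        ; 3≤  = subst (3 ≤_) (≡.sym numV′) 3≤n
        ; nn  = subst₂ _<_ (≡.sym numV′) (≡.sym numU′) nn
        }
      ; shp = shp′ ; nU = nU′ ; nV = nV′
      ; pure = λ _ → All-resp-↭ (↭-sym inner′) (Allₚ.++⁺ (Allₚ.map⁺ (All.universal (λ _ → s≤s z≤n) (inner cfg)))
                                                     (Allₚ.map⁺ (All.universal (λ _ → ≤-refl) (ends cfg))))
      }
      where
      nn : numV cfg < numU cfg
      nn = subst₂ _<_ (≡.sym nV) (≡.sym nU) (s≤s h)
      3≤n : 3 ≤ numV cfg
      3≤n = subst (3 ≤_) (≡.sym nV) (s≤s 2≤V)
      less : (length V < length U × val (totV cfg) < val (totU cfg)) ⊎ (length V ≡ length U × val (totV cfg) ≢ val (totU cfg)) →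
             val (totV cfg) < val (totU cfg)
      less (inj₁ (_ , q)) = q
      less (inj₂ (e , _)) = ⊥-elim (<-irrefl e h)

-- The base case with three legs at `u` and two at `v`.

module SmallDegrees where

  open import Data.Bool using (true; false; _∧_; _∨_; not; T)
  open import Data.Maybe using (Maybe; just; nothing; _>>=_)
  open import Data.Nat using (_≤?_; _<?_)
  open import Data.Nat.Properties
  open import Data.Nat.Tactic.RingSolver using (solve-∀)
  open import Relation.Nullary using (Dec; yes; no)
  open import Relation.Binary.PropositionalEquality using (_≡_; refl; trans; cong; cong₂; subst)
  open Labellings
  open Zigzags
  open Insertion
  open Symbolic
  open Tables
  open Extension

  halves : ∀ n → (∃ λ j → n ≡ twice j) ⊎ (∃ λ j → n ≡ suc (twice j))
  halves zero    = inj₁ (0 , refl)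
  halves (suc n) with halves n
  ... | inj₁ (j , e) = inj₂ (j , cong suc e)
  ... | inj₂ (j , e) = inj₁ (suc j , cong suc e)

  legView : ∀ x → 1 ≤ x → ∃₂ λ t j → x ≡ lenT t j
  legView 1             h = I , 0 , refl
  legView (suc (suc n)) h with halves n
  ... | inj₁ (j , e) = Ev , j , cong (suc ∘ suc) e
  ... | inj₂ (j , e) = Od , j , cong (suc ∘ suc) e

  coreLen : CoreTy → ℕ → ℕ
  coreLen k1 i = 1
  coreLen k3 i = suc (twice (suc i))
  coreLen k2 i = 2
  coreLen k4 i = twice (suc (suc i))

  coreView : ∀ κ → 1 ≤ κ → ∃₂ λ k i → κ ≡ coreLen k i
  coreView 1                   h = k1 , 0 , refl
  coreView 2                   h = k2 , 0 , refl
  coreView (suc (suc (suc n))) h with halves n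
  ... | inj₁ (j , e) = k3 , j , cong (suc ∘ suc ∘ suc) e
  ... | inj₂ (j , e) = k4 , j , cong (suc ∘ suc ∘ suc) e

  env : List ℕ → Env
  env []       _       = 0
  env (x ∷ xs) zero    = x
  env (x ∷ xs) (suc i) = env xs i

  +00 : ∀ x → x + 0 + 0 ≡ x
  +00 x = trans (+-identityʳ _) (+-identityʳ x)

  ev-second : ∀ ρ s t x y {k l} → ev ρ x ≡ k → (eqTy s t ≡ true → ev ρ y + k ≡ l) → (eqTy s t ≡ false → ev ρ y ≡ l) →
              ev ρ (second s t x y) ≡ l
  ev-second ρ s t x y ex e₁ e₂ with eqTy s t
  ... | true  = trans (ev-+ ρ x y) (trans (+-comm (ev ρ x) (ev ρ y)) (trans (cong (ev ρ y +_) ex) (e₁ refl)))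
  ... | false = e₂ refl

  -- The value of the variable that describes the longer of two legs.
  excess : Ty → Ty → ℕ → ℕ → ℕ
  excess s t k l with eqTy s t
  ... | true  = l Data.Nat.∸ k
  ... | false = l

  excess-true : ∀ s t {k l} → k ≤ l → eqTy s t ≡ true → excess s t k l + k ≡ l
  excess-true s t h e with eqTy s t
  excess-true s t h refl | true = m∸n+n≡m h

  excess-false : ∀ s t {k l} → eqTy s t ≡ false → excess s t k l ≡ l
  excess-false s t e with eqTy s t
  excess-false s t refl | false = refl

  core-shape : ∀ ρ k i → ρ 0 ≡ i → shapeP ρ (corePiece k) ≡ (cT , coreLen k i)
  core-shape ρ k1 i e    = refl
  core-shape ρ k3 i refl = cong (λ n → cT , suc (twice (suc n))) (+00 (ρ 0))
  core-shape ρ k2 i e    = refl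
  core-shape ρ k4 i refl = cong (λ n → cT , twice (suc (suc n))) (+00 (ρ 0))

  -- The two additions to a `Result`, with `gap` equal to one, are what inserting further legs of
  -- `u` as zigzags requires.
  Strong : List ℕ → List ℕ → ℕ → ℕ → Set
  Strong U V κ gap = Σ (Result U V κ) λ r → Pure (Result.cfg r) × lv (totV (Result.cfg r)) ≤ lv (totU (Result.cfg r)) + gap

  solved : ∀ {U V κ gap ps} ρ → gap ≤ 2 → Solved (checkOrd gap) ps → map (shapeP ρ) ps ↭ spider U V κ → Strong U V κ gap
  solved {U} {V} {κ} {gap} ρ g (is , t , f) p = record
    { cfg = cfg ; inv = inv ; ord = proj₁ o
    ; shp = s ; nU = shape-numU {U} {V} {κ} cfg s ; nV = shape-numV {U} {V} {κ} cfg s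
    ; pure = λ _ → All.map NW-pure nws } , All.map NW-pure nws , proj₂ o
    where
    n = nuc-run ρ is
    open Nuc n
    o = nuc-ord gap g t n
    s = ↭-trans (↭-reflexive shpe) (↭-trans (f ρ) p)

  pieces₃₂-shape : ∀ t₁ t₂ t₃ s₁ s₂ k i j₁ j₂ j₃ k₁ k₂ → k₁ ≤ k₂ →
    map (shapeP (env (i ∷ j₁ ∷ j₂ ∷ j₃ ∷ k₁ ∷ excess s₁ s₂ k₁ k₂ ∷ []))) (pieces₃₂ t₁ t₂ t₃ s₁ s₂ k) ↭
    spider (lenT t₁ j₁ ∷ lenT t₂ j₂ ∷ lenT t₃ j₃ ∷ []) (lenT s₁ k₁ ∷ lenT s₂ k₂ ∷ []) (coreLen k i)
  pieces₃₂-shape t₁ t₂ t₃ s₁ s₂ k i j₁ j₂ j₃ k₁ k₂ h = ↭-trans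
    (↭-reflexive (cong₂ _∷_ (lg uT t₁ j₁) (cong₂ _∷_ (lg uT t₂ j₂) (cong₂ _∷_ (lg uT t₃ j₃) (cong₂ _∷_ (lg vT s₁ k₁)
      (cong₂ _∷_ (cong (λ n → vT , lenT s₂ n) sec) (cong (_∷ []) (core-shape _ k i refl))))))))
    (Perm.++-comm (_ ∷ _ ∷ _ ∷ _ ∷ _ ∷ []) _)
    where
    ρ = env (i ∷ j₁ ∷ j₂ ∷ j₃ ∷ k₁ ∷ excess s₁ s₂ k₁ k₂ ∷ [])
    lg : ∀ T t j → (T , lenT t (j + 0 + 0)) ≡ (T , lenT t j)
    lg T t j = cong (λ n → T , lenT t n) (+00 j)
    sec : ev ρ (second s₁ s₂ (var 4) (var 5)) ≡ k₂
    sec = ev-second ρ s₁ s₂ (var 4) (var 5) (+00 k₁)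
      (λ e → trans (cong (_+ k₁) (+00 _)) (excess-true s₁ s₂ h e))
      (λ e → trans (+00 _) (excess-false s₁ s₂ e))

  private
    dec⇒may : ∀ {A : Set} → Dec A → Maybe A
    dec⇒may (yes a) = just a
    dec⇒may (no _)  = nothing

    allM : ∀ {A : Set} {B : A → Set} → (∀ x → Maybe (B x)) → ∀ xs → Maybe (All B xs)
    allM f []       = just []
    allM f (x ∷ xs) = f x >>= λ p → allM f xs >>= λ ps → just (p ∷ ps)

    pairsM : ∀ {A : Set} {B : A → A → Set} → (∀ x y → Maybe (B x y)) → ∀ xs → Maybe (AllPairs B xs)
    pairsM f []       = just []
    pairsM f (x ∷ xs) = allM (f x) xs >>= λ p → pairsM f xs >>= λ ps → just (p ∷ ps)

    below? : ∀ x y → Maybe (Below x y)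
    below? x y = dec⇒may (lv x ≤? lv y) >>= λ a → dec⇒may (tp x ≤? tp y) >>= λ b →
      dec⇒may (val x <? val y) >>= λ c → just (a , b , c)

    compat? : ∀ x y → Maybe (Compat x y)
    compat? x y with below? x y | below? y x
    ... | just p  | _       = just (inj₁ p)
    ... | nothing | just p  = just (inj₂ p)
    ... | nothing | nothing = nothing

    cls? : ∀ P m x → Maybe (Cls P m m x)
    cls? P m (S a) = dec⇒may (1 ≤? a) >>= λ p → dec⇒may (a ≤? P) >>= λ q → just (clsS p q)
    cls? P m (L a) = dec⇒may (P <? a) >>= λ p → dec⇒may (a ≤? m) >>= λ q → just (clsL p q)
    cls? P m _     = nothing

    endS? : ∀ xs → Maybe (EndS xs)
    endS? []            = nothing
    endS? (S a ∷ [])    = just end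
    endS? (_ ∷ [])      = nothing
    endS? (x ∷ y ∷ ys)  = endS? (y ∷ ys) >>= λ e → just (more e)

    piece? : ∀ p → Maybe (PieceOK p)
    piece? (uK , xs)     = endS? xs >>= λ e → just (okU e)
    piece? (vK , xs)     = endS? xs >>= λ e → just (okV e)
    piece? (cK , x ∷ xs) = just okC
    piece? (rK , x ∷ xs) = just okR
    piece? _             = nothing

    -- Partial decision procedures validate explicit configurations by computation. These contain no
    -- Q-labels, so `R` is `m`.
    inv? : ∀ P m cfg → Maybe (Inv P m m cfg)
    inv? P m cfg =
      dec⇒may (P ≤? m) >>= λ a → pairsM compat? (labels cfg) >>= λ b → allM (cls? P m) (labels cfg) >>= λ c →
      dec⇒may (length (labels cfg) Data.Nat.≟ m) >>= λ d → pairsM compat? (inner cfg) >>= λ e →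
      allM (λ w → dec⇒may (P + lv w <? val w)) (inner cfg) >>= λ f → allM piece? cfg >>= λ g →
      just (record { P≤R = a ; R≤m = ≤-refl ; lab = b ; cls = c ; len = d ; inn = e ; innP = f ; pieces = g })

    ord? : ∀ P cfg → Maybe (Ord P cfg)
    ord? P cfg =
      dec⇒may (val (totV cfg) <? val (totU cfg)) >>= λ a → dec⇒may (P <? val (totV cfg)) >>= λ b →
      allM (λ w → dec⇒may (val w <? val (totV cfg)) >>= λ p → dec⇒may (lv w ≤? suc (lv (totV cfg))) >>= λ q → just (p , q)) (inner cfg) >>= λ c →
      dec⇒may (lv (totV cfg) ≤? lv (totU cfg) + 2) >>= λ d → dec⇒may (3 ≤? numV cfg) >>= λ e →
      dec⇒may (numV cfg <? numU cfg) >>= λ f →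
      just (record { V<U = a ; P<V = b ; W<V = c ; lvs = d ; 3≤ = e ; nn = f })

    pure? : ∀ cfg → Maybe (Pure cfg)
    pure? cfg = allM (λ w → dec⇒may (1 ≤? lv w)) (inner cfg)

    -- The subscripts are the lengths of the two legs of `v`; the core and the legs of `u` have
    -- length one.
    cfg₂₂ cfg₂₄ cfg₄₄ cfg₄₆ : Config
    cfg₂₂ = (cK , L 7 ∷ []) ∷ (uK , S 6 ∷ []) ∷ (uK , S 5 ∷ []) ∷ (uK , S 2 ∷ [])
      ∷ (vK , L 8 ∷ S 1 ∷ []) ∷ (vK , S 4 ∷ S 3 ∷ []) ∷ []
    cfg₂₄ = (cK , L 7 ∷ []) ∷ (uK , S 6 ∷ []) ∷ (uK , S 5 ∷ []) ∷ (uK , S 4 ∷ [])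
      ∷ (vK , L 10 ∷ S 3 ∷ []) ∷ (vK , S 2 ∷ L 9 ∷ L 8 ∷ S 1 ∷ []) ∷ []
    cfg₄₄ = (cK , L 10 ∷ []) ∷ (uK , S 3 ∷ []) ∷ (uK , S 4 ∷ []) ∷ (uK , S 6 ∷ [])
      ∷ (vK , S 5 ∷ L 12 ∷ L 9 ∷ S 2 ∷ []) ∷ (vK , S 7 ∷ L 11 ∷ L 8 ∷ S 1 ∷ []) ∷ []
    cfg₄₆ = (cK , L 12 ∷ []) ∷ (uK , S 6 ∷ []) ∷ (uK , S 7 ∷ []) ∷ (uK , S 1 ∷ [])
      ∷ (vK , S 8 ∷ L 13 ∷ L 9 ∷ S 2 ∷ []) ∷ (vK , S 5 ∷ L 14 ∷ L 10 ∷ S 3 ∷ L 11 ∷ S 4 ∷ []) ∷ []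

  -- The difference of the two parameters is 0, 1 or at least 2. In the first two cases the legs
  -- depend on one variable; there the parameters 0 and 1 are settled by explicit labellings and
  -- larger ones by the rules. The third case needs two variables.
  exception : ∀ k₁ k₂ → k₁ ≤ k₂ → Result (1 ∷ 1 ∷ 1 ∷ []) (lenT Ev k₁ ∷ lenT Ev k₂ ∷ []) 1
  exception k₁ k₂ h = subst (λ k → Result _ (lenT Ev k₁ ∷ lenT Ev k ∷ []) 1) (m∸n+n≡m h) (go (k₂ Data.Nat.∸ k₁) k₁)
    where
    ones : List SPiece
    ones = leg hu I [] ∷ leg hu I [] ∷ leg hu I [] ∷ coreᵒ [] ∷ []
    sym₂ : Lin → Lin → List SPiece
    sym₂ x y = ones ++ leg hv Ev x ∷ leg hv Ev y ∷ []
    row : ℕ → ℕ → List (Tag × ℕ)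
    row a b = (uT , 1) ∷ (uT , 1) ∷ (uT , 1) ∷ (cT , 1) ∷ (vT , lenT Ev a) ∷ (vT , lenT Ev b) ∷ []
    perm : ∀ a b → row a b ↭ spider (1 ∷ 1 ∷ 1 ∷ []) (lenT Ev a ∷ lenT Ev b ∷ []) 1
    perm a b = Perm.shift (cT , 1) ((uT , 1) ∷ (uT , 1) ∷ (uT , 1) ∷ []) _
    go : ∀ d k → Result (1 ∷ 1 ∷ 1 ∷ []) (lenT Ev k ∷ lenT Ev (d + k) ∷ []) 1
    go 0 0 = record { cfg = cfg₂₂ ; inv = found (inv? 6 8 cfg₂₂) refl ; ord = found (ord? 6 cfg₂₂) refl
      ; shp = ↭-refl ; nU = refl ; nV = refl
      ; pure = λ { (inj₁ p) → ⊥-elim (p (here refl)) ; (inj₂ p) → ⊥-elim (p (here refl)) } }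
    go 1 0 = record { cfg = cfg₂₄ ; inv = found (inv? 6 10 cfg₂₄) refl ; ord = found (ord? 6 cfg₂₄) refl
      ; shp = ↭-refl ; nU = refl ; nV = refl ; pure = λ _ → found (pure? cfg₂₄) refl }
    go 0 1 = record { cfg = cfg₄₄ ; inv = found (inv? 7 12 cfg₄₄) refl ; ord = found (ord? 7 cfg₄₄) refl
      ; shp = ↭-refl ; nU = refl ; nV = refl ; pure = λ _ → found (pure? cfg₄₄) refl }
    go 1 1 = record { cfg = cfg₄₆ ; inv = found (inv? 8 14 cfg₄₆) refl ; ord = found (ord? 8 cfg₄₆) refl
      ; shp = ↭-refl ; nU = refl ; nV = refl ; pure = λ _ → found (pure? cfg₄₆) refl }
    go 0 (suc (suc k)) = proj₁ (solved {ps = sym₂ (# 2 +ᴸ var 0) (# 2 +ᴸ var 0)} (env (k ∷ [])) ≤-refl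
      (found (search (checkOrd 2) rules₃₂ (sym₂ (# 2 +ᴸ var 0) (# 2 +ᴸ var 0))) refl)
      (↭-trans (↭-reflexive (cong (λ n → row (suc (suc n)) (suc (suc n))) (+00 k))) (perm (suc (suc k)) (suc (suc k)))))
    go 1 (suc (suc k)) = proj₁ (solved {ps = sym₂ (# 2 +ᴸ var 0) (# 3 +ᴸ var 0)} (env (k ∷ [])) ≤-refl
      (found (search (checkOrd 2) rules₃₂ (sym₂ (# 2 +ᴸ var 0) (# 3 +ᴸ var 0))) refl)
      (↭-trans (↭-reflexive (cong (λ n → row (suc (suc n)) (suc (suc (suc n)))) (+00 k))) (perm (suc (suc k)) (suc (suc (suc k))))))
    -- The longer leg is listed first, hence inserted first, and the order is restored by the
    -- permutation at the end.
    go (suc (suc d)) k = proj₁ (solved {ps = sym₂ (# 2 +ᴸ var 1 +ᴸ var 0) (var 0)} (env (k ∷ d ∷ [])) ≤-refl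
      (found (search (checkOrd 2) rules₃₂ (sym₂ (# 2 +ᴸ var 1 +ᴸ var 0) (var 0))) refl)
      (↭-trans (↭-reflexive (cong₂ row (lem k d) (+00 k)))
        (↭-trans (perm (suc (suc d) + k) k) (spider-resp {1 ∷ 1 ∷ 1 ∷ []} 1 ↭-refl (swap _ _ ↭-refl)))))
      where
      lem : ∀ k d → 2 + (k + 0 + (d + 0 + 0)) ≡ suc (suc d) + k
      lem = solve-∀

  isI-one : ∀ t j → 1 ≡ lenT t j → isI t ≡ true
  isI-one I  j e = refl

  ∨-introˡ : ∀ {a b} → a ≡ true → a ∨ b ≡ true
  ∨-introˡ refl = refl

  ∨-introʳ : ∀ a {b} → b ≡ true → a ∨ b ≡ true
  ∨-introʳ true  e = refl
  ∨-introʳ false e = e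

  ∨-elim : ∀ {a b} → a ∨ b ≡ true → a ≡ true ⊎ b ≡ true
  ∨-elim {true}  e = inj₁ refl
  ∨-elim {false} e = inj₂ e

  given : ∀ {a b} → not a ∨ b ≡ true → a ≡ true → b ≡ true
  given e refl = e

  NoOne : List ℕ → List ℕ → ℕ → Set
  NoOne U V κ = Σ (Result U V κ) λ r →
    1 ∉ U → Pure (Result.cfg r) × lv (totV (Result.cfg r)) ≤ suc (lv (totU (Result.cfg r)))

  gap-I : ∀ t₁ t₂ t₃ {j₁ j₂ j₃} {n m : ℕ} → 1 ∉ lenT t₁ j₁ ∷ lenT t₂ j₂ ∷ lenT t₃ j₃ ∷ [] →
          n ≤ m + gap₃₂ t₁ t₂ t₃ → n ≤ suc m
  gap-I I  _  _  p h = ⊥-elim (p (here refl))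
  gap-I Od _  _  p h = ≤-trans h (≤-reflexive (+-comm _ 1))
  gap-I Ev _  _  p h = ≤-trans h (≤-reflexive (+-comm _ 1))

  gap≤2 : ∀ t₁ t₂ t₃ → gap₃₂ t₁ t₂ t₃ ≤ 2
  gap≤2 t₁ t₂ t₃ with isI t₁ ∧ (isI t₂ ∧ isI t₃)
  ... | true  = ≤-refl
  ... | false = s≤s z≤n

  someI : ∀ t₁ t₂ t₃ s₁ s₂ {j₁ j₂ j₃ k₁ k₂} →
    1 ∈ lenT t₁ j₁ ∷ lenT t₂ j₂ ∷ lenT t₃ j₃ ∷ lenT s₁ k₁ ∷ lenT s₂ k₂ ∷ [] → someI₃₂ t₁ t₂ t₃ s₁ s₂ ≡ true
  someI t₁ t₂ t₃ s₁ s₂ (here e) = ∨-introˡ (isI-one t₁ _ e)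
  someI t₁ t₂ t₃ s₁ s₂ (there (here e)) = ∨-introʳ (isI t₁) (∨-introˡ (isI-one t₂ _ e))
  someI t₁ t₂ t₃ s₁ s₂ (there (there (here e))) = ∨-introʳ (isI t₁) (∨-introʳ (isI t₂) (∨-introˡ (isI-one t₃ _ e)))
  someI t₁ t₂ t₃ s₁ s₂ (there (there (there (here e)))) =
    ∨-introʳ (isI t₁) (∨-introʳ (isI t₂) (∨-introʳ (isI t₃) (∨-introˡ (isI-one s₁ _ e))))
  someI t₁ t₂ t₃ s₁ s₂ (there (there (there (there (here e))))) =
    ∨-introʳ (isI t₁) (∨-introʳ (isI t₂) (∨-introʳ (isI t₃) (∨-introʳ (isI s₁) (isI-one s₂ _ e))))

  exc : ∀ t₁ t₂ t₃ s₁ s₂ k {i j₁ j₂ j₃} k₁ k₂ → k₁ ≤ k₂ → exceptional t₁ t₂ t₃ s₁ s₂ k ≡ true →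
    NoOne (lenT t₁ j₁ ∷ lenT t₂ j₂ ∷ lenT t₃ j₃ ∷ []) (lenT s₁ k₁ ∷ lenT s₂ k₂ ∷ []) (coreLen k i)
  exc I I I Ev Ev k1 k₁ k₂ h refl = exception k₁ k₂ h , λ p → ⊥-elim (p (here refl))

  sorted₃₂ : ∀ t₁ t₂ t₃ s₁ s₂ k i j₁ j₂ j₃ k₁ k₂ → k₁ ≤ k₂ →
    1 ∈ lenT t₁ j₁ ∷ lenT t₂ j₂ ∷ lenT t₃ j₃ ∷ lenT s₁ k₁ ∷ lenT s₂ k₂ ∷ [] →
    NoOne (lenT t₁ j₁ ∷ lenT t₂ j₂ ∷ lenT t₃ j₃ ∷ []) (lenT s₁ k₁ ∷ lenT s₂ k₂ ∷ []) (coreLen k i)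
  sorted₃₂ t₁ t₂ t₃ s₁ s₂ k i j₁ j₂ j₃ k₁ k₂ h one
    with ∨-elim (given (every₃₂ t₁ t₂ t₃ s₁ s₂ k) (someI t₁ t₂ t₃ s₁ s₂ one))
  ... | inj₁ e = exc t₁ t₂ t₃ s₁ s₂ k k₁ k₂ h e
  ... | inj₂ e with r , p , l ← solved {ps = pieces₃₂ t₁ t₂ t₃ s₁ s₂ k} (env (i ∷ j₁ ∷ j₂ ∷ j₃ ∷ k₁ ∷ excess s₁ s₂ k₁ k₂ ∷ [])) (gap≤2 t₁ t₂ t₃)
                     (found (search₃₂ t₁ t₂ t₃ s₁ s₂ k) e) (pieces₃₂-shape t₁ t₂ t₃ s₁ s₂ k i j₁ j₂ j₃ k₁ k₂ h) =
    r , λ no → p , gap-I t₁ t₂ t₃ no l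

  base₃₂ : ∀ {x₁ x₂ x₃ y₁ y₂ κ} → 1 ≤ x₁ → 1 ≤ x₂ → 1 ≤ x₃ → 1 ≤ y₁ → 1 ≤ y₂ → 1 ≤ κ →
    1 ∈ x₁ ∷ x₂ ∷ x₃ ∷ y₁ ∷ y₂ ∷ [] → NoOne (x₁ ∷ x₂ ∷ x₃ ∷ []) (y₁ ∷ y₂ ∷ []) κ
  base₃₂ {x₁} {x₂} {x₃} {y₁} {y₂} {κ} h₁ h₂ h₃ g₁ g₂ hκ one
    with t₁ , j₁ , refl ← legView x₁ h₁ with t₂ , j₂ , refl ← legView x₂ h₂ with t₃ , j₃ , refl ← legView x₃ h₃
    with s₁ , k₁ , refl ← legView y₁ g₁ with s₂ , k₂ , refl ← legView y₂ g₂ with k , i , refl ← coreView κ hκ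
    with ≤-total k₁ k₂
  ... | inj₁ h = sorted₃₂ t₁ t₂ t₃ s₁ s₂ k i j₁ j₂ j₃ k₁ k₂ h one
  ... | inj₂ h with r , f ← sorted₃₂ t₁ t₂ t₃ s₂ s₁ k i j₁ j₂ j₃ k₂ k₁ h
                      (∈-resp-↭ (Perm.++⁺ˡ (_ ∷ _ ∷ _ ∷ []) (swap _ _ ↭-refl)) one) =
    Result-resp ↭-refl (swap _ _ ↭-refl) r , f

-- Pairing even legs of `v` with legs of `u`.

module Domination where

  open import Data.Nat.Properties
  open import Relation.Binary.PropositionalEquality using (_≡_; refl; sym; trans; cong; subst; subst₂)
  open Arithmetic
  open Labellings
  open Zigzags
  open Insertion
  open Symbolic
  open Extension
  open SmallDegrees

  -- Every label at v is dominated by one at u, so shifts preserve the order of the hubs.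
  record Lam (Wp : ℕ → ℕ → Lab → Set) (U V : List ℕ) (κ : ℕ) : Set where
    field
      {P R m} : ℕ
      cfg     : Config
      inv     : Inv P R m cfg
      nws     : All (Wp P R) (inner cfg)
      W<V     : All (λ w → val w < val (totV cfg)) (inner cfg)
      PR<V    : P + R + 2 < val (totV cfg)
      V<U     : val (totV cfg) < val (totU cfg)
      4≤V     : 4 ≤ numV cfg
      V≤U     : numV cfg ≤ numU cfg
      1≤lv    : 1 ≤ lv (totV cfg)
      lv≤     : lv (totV cfg) ≤ lv (totU cfg)
      tp≤     : tp (totV cfg) ≤ tp (totU cfg)
      shp     : shape cfg ↭ spider U V κ

  XW-lv : ∀ {P R w} → XW P R w → 1 ≤ lv w × lv w ≤ 2 × tp w ≤ 1
  XW-lv (nw (sl _)) = ≤-refl , s≤s z≤n , z≤n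
  XW-lv (nw (lq _)) = s≤s z≤n , ≤-refl , ≤-refl
  XW-lv (sx _)      = ≤-refl , s≤s z≤n , ≤-refl

  lam-weaken : ∀ {U V κ} → Lam NW U V κ → Lam XW U V κ
  lam-weaken l = record
    { cfg = cfg ; inv = inv ; nws = All.map nw nws ; W<V = W<V ; PR<V = PR<V ; V<U = V<U ; 4≤V = 4≤V ; V≤U = V≤U
    ; 1≤lv = 1≤lv ; lv≤ = lv≤ ; tp≤ = tp≤ ; shp = shp }
    where open Lam l

  private
    1*≤ : ∀ {l} μ → 1 ≤ l → μ ≤ l * μ
    1*≤ μ h = ≤-trans (≤-reflexive (sym (*-identityˡ μ))) (*-monoˡ-≤ μ h)

  module LamStep {U V κ} (l : Lam NW U V κ) {K : Kind} {p : Pc} (f : Fits K p) (j : ℕ)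
                 (c≡d : mids p j ≡ lows p j) (1≤c : 1 ≤ lows p j) where
    open Lam l

    c d ν : ℕ
    c = lows p j
    d = mids p j
    ν = isQ p
    open Step P R m c 0 d ν public

    N : Config
    N = (K , list p P′ R′ j) ∷ []
    open Hub {cfg} (Inv.pieces inv) c d ν N public

    private
      V₀ = totV cfg
      S₀ = pc-step {cfg = cfg} j f inv nws
      4c : 4 * c ≤ numV cfg * c
      4c = *-monoˡ-≤ c 4≤V
      d≤ : d ≤ lv V₀ * d
      d≤ = 1*≤ d 1≤lv

      V≥ : ∀ {x} → x < val (sh (numV cfg) c d ν V₀) → x < val (totV next)
      V≥ {x} h = subst (λ y → x < val y) (sym totV-next) (<-≤-trans h (m≤n+m _ (val (totV N))))

      isQ≤1 : ∀ p → isQ p ≡ 0 ⊎ isQ p ≡ 1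
      isQ≤1 One = inj₁ refl
      isQ≤1 O   = inj₁ refl
      isQ≤1 E   = inj₁ refl
      isQ≤1 Qᵖ  = inj₂ refl
      isQ≤1 CO  = inj₁ refl
      isQ≤1 CS  = inj₁ refl
      isQ≤1 CQ  = inj₂ refl

      new≤ : ∀ {w} → Any (w ≼_) (tops₀ p c d P′ R′) → val w ≤ P′ + R′ + 2
      new≤ a = go p a
        where
        c+d≤R′ : c + d ≤ R′
        c+d≤R′ = ≤-trans (m≤n+m (c + d) R) (≤-reflexive (sym (+-assoc R c d)))
        t₀ : P′ + c + d ≤ P′ + R′ + 2
        t₀ = ≤-trans (≤-reflexive (+-assoc P′ c d)) (≤-trans (+-monoʳ-≤ P′ c+d≤R′) (m≤m+n _ 2))
        z : ∀ {w} → Any (w ≼_) (topZ c d P′ R′) → val w ≤ P′ + R′ + 2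
        z (here (_ , _ , h)) = ≤-trans h t₀
        q : ∀ {w} → Any (w ≼_) (topQ c d P′ R′) → val w ≤ P′ + R′ + 2
        q (here (_ , _ , h))         = ≤-trans h t₀
        q (there (here (_ , _ , h))) = ≤-trans h (lq-val P′ R′)
        go : ∀ p {w} → Any (w ≼_) (tops₀ p c d P′ R′) → val w ≤ P′ + R′ + 2
        go O  = z
        go E  = z
        go Qᵖ = q
        go CO = z
        go CS = z
        go CQ = q

    inv′ : Inv P′ R′ m′ next
    inv′ = step inv (StepOK.ok S₀)

    nws′ : All (NW P′ R′) (inner next)
    nws′ = subst (All _) (sym (inner-step c d ν N cfg))
      (Allₚ.++⁺ (StepOK.nwN S₀) (Allₚ.map⁺ (All.map (NW-sh {m = m} {ν = ν}) nws)))

    PR<V′ : P′ + R′ + 2 < val (totV next)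
    PR<V′ = V≥ (lamPR (val V₀) P R c d _ _ PR<V 4c (≤-reflexive c≡d))

    W<V′ : All (λ w → val w < val (totV next)) (inner next)
    W<V′ = subst (All _) (sym (inner-step c d ν N cfg))
      (Allₚ.++⁺ (All.map (λ a → ≤-<-trans (new≤ a) PR<V′) (StepOK.topN S₀))
        (Allₚ.map⁺ (All.zipWith (λ {w} → old w) (W<V , nws))))
      where
      old : ∀ w → val w < val V₀ × NW P R w → val (sh 2 c d ν w) < val (totV next)
      old w (h , n) with isQ≤1 p
      ... | inj₁ e = V≥ (subst (λ ν → val (sh 2 c d ν w) < val (sh (numV cfg) c d ν V₀)) (sym e)
        (lamW (val w) (val V₀) c d _ _ (tp V₀ * 0) (lv w * d) (tp w) h 4c d≤ (*-monoˡ-≤ d (proj₁ (proj₂ (XW-lv (nw n))))) (≤-reflexive c≡d)))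
      ... | inj₂ e = V≥ (subst₂ (λ ν d → val (sh 2 c d ν w) < val (sh (numV cfg) c d ν V₀)) (sym e) (sym c≡d)
        (lamWQ (val w) (val V₀) c _ _ (tp V₀ * 1) (lv w * c) (tp w) h 4c (1*≤ c 1≤lv) (*-monoˡ-≤ c (proj₁ (proj₂ (XW-lv (nw n))))) (proj₂ (proj₂ (XW-lv (nw n)))) 1≤c))

    numV≥ : 4 ≤ numV next
    numV≥ = subst (4 ≤_) (sym numV-next) (≤-trans 4≤V (m≤n+m _ (numV N)))

    lvV≥ : 1 ≤ lv (totV next)
    lvV≥ = subst (λ x → 1 ≤ lv x) (sym totV-next) (≤-trans 1≤lv (m≤n+m _ (lv (totV N))))

  -- The state between the two halves of a pair. The coming leg of `v` has hub label `P + c + 1`: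
  -- `gap` pays `P + 1` of it, and the shift of the additional label counted by `nn` pays `c`.
  record LamU (U V : List ℕ) (κ : ℕ) : Set where
    field
      lam : Lam NW U V κ
      gap : val (totV (Lam.cfg lam)) + suc (Lam.P lam) < val (totU (Lam.cfg lam))
      nn  : numV (Lam.cfg lam) < numU (Lam.cfg lam)
      lv< : lv (totV (Lam.cfg lam)) < lv (totU (Lam.cfg lam))

  private
    uStep : ∀ {U V κ x} → Lam NW U V κ → ∀ {p} → Fits uK p → ∀ j → mids p j ≡ lows p j → 1 ≤ lows p j →
            size p j ≡ x → (∀ {P′ R′} → P′ ≤ R′ → P′ < val (hd (list p P′ R′ j)) × 1 ≤ lv (hd (list p P′ R′ j))) → LamU (x ∷ U) V κ
    uStep {U} {V} {κ} l {p} f j e h₁ refl h = record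
      { lam = record
        { cfg = next ; inv = inv′ ; nws = nws′ ; W<V = W<V′ ; PR<V = PR<V′
        ; V<U = ≤-<-trans (m≤m+n _ _) gap′
        ; 4≤V = numV≥
        ; V≤U = <⇒≤ nn′
        ; 1≤lv = lvV≥
        ; lv≤ = subst₂ (λ x y → lv x ≤ lv y) (sym totV-next) (sym totU-next) (≤-trans lv≤ (m≤n+m _ (lv (totU N))))
        ; tp≤ = subst₂ (λ x y → tp x ≤ tp y) (sym totV-next) (sym totU-next) (≤-trans tp≤ (m≤n+m _ (tp (totU N))))
        ; shp = ↭-trans (↭-reflexive (trans (shape-step c d ν N cfg) (cong (λ n → (uT , n) ∷ shape cfg) (size-list p P′ R′ j))))
                  (↭-trans (prep _ shp) (spider-u _ U V κ))
        }
      ; gap = gap′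
      ; nn  = nn′
      ; lv< = subst₂ (λ x y → lv x < lv y) (sym totV-next) (sym totU-next)
          (+-mono-≤ (≤-trans (proj₂ hub′) (m≤m+n _ 0)) lv≤)
      }
      where
      open Lam l
      open LamStep l f j e h₁
      nn′ : numV next < numU next
      nn′ = subst₂ _<_ (sym numV-next) (sym numU-next) (s≤s V≤U)
      hub′ : P′ < val (hd (list p P′ R′ j)) × 1 ≤ lv (hd (list p P′ R′ j))
      hub′ = h (≤-trans (m≤m+n P′ d) (P′≤R′ (Inv.P≤R inv)))
      hub : P′ < val (totU N)
      hub = subst (P′ <_) (sym (+-identityʳ (val (hd (list p P′ R′ j))))) (proj₁ hub′)
      gap′ : val (totV next) + suc P′ < val (totU next)
      gap′ = subst₂ (λ x y → val x + suc P′ < val y) (sym totV-next) (sym totU-next)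
        (lamU (val (totV cfg)) (val (totU cfg)) P′ (val (totU N)) _ _ _ _ _ _ V<U hub (*-monoˡ-≤ c V≤U) (*-monoˡ-≤ d lv≤) (*-monoˡ-≤ ν tp≤))

    -- The leg just added at u pays for the one at v.
    vStep : ∀ {U V κ} → LamU U V κ → ∀ j → Lam NW U (twice (suc j) ∷ V) κ
    vStep {U} {V} {κ} l j = record
        { cfg = next ; inv = inv′ ; nws = nws′ ; W<V = W<V′ ; PR<V = PR<V′
        ; V<U = subst₂ (λ x y → val x < val y) (sym totV-next) (sym totU-next)
            (subst (λ z → z + val (sh (numV cfg) c d ν (totV cfg)) < val (sh (numU cfg) c d ν (totU cfg))) (sym (+-identityʳ (suc P′)))
            (lamV (val (totV cfg)) (val (totU cfg)) P c _ _ _ _ _ _ (LamU.gap l) (*-monoˡ-≤ c (LamU.nn l)) (*-monoˡ-≤ d lv≤) (*-monoˡ-≤ ν tp≤)))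
        ; 4≤V = numV≥
        ; V≤U = subst₂ _≤_ (sym numV-next) (sym numU-next) (LamU.nn l)
        ; 1≤lv = lvV≥
        ; lv≤ = subst₂ (λ x y → lv x ≤ lv y) (sym totV-next) (sym totU-next) (LamU.lv< l)
        ; tp≤ = subst₂ (λ x y → tp x ≤ tp y) (sym totV-next) (sym totU-next) tp≤
        ; shp = ↭-trans (↭-reflexive (trans (shape-step c d ν N cfg) (cong (λ n → (vT , n) ∷ shape cfg) (size-list E P′ R′ j))))
                  (↭-trans (prep _ shp) (spider-v _ U V κ))
        }
      where
      open Lam (LamU.lam l)
      open LamStep (LamU.lam l) vE j refl (s≤s z≤n)

  pairE : ∀ {U V κ} → Lam NW U V κ → ∀ i j → Lam NW (twice (suc i) ∷ U) (twice (suc j) ∷ V) κ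
  pairE l i = vStep (uStep l uE i refl (s≤s z≤n) refl (λ _ → ≤-refl , ≤-refl))

  pairO : ∀ {U V κ} → Lam NW U V κ → ∀ i j → Lam NW (suc (twice (suc i)) ∷ U) (twice (suc j) ∷ V) κ
  pairO l i = vStep (uStep l uQ i refl (s≤s z≤n) refl (λ h → s≤s h , ≤-refl))

  -- A leg of length one gives `u` a small label only, so the leg of `v` has to start with a small
  -- label too. The number of large labels then stays the same at both hubs.
  pairX : ∀ {U V κ} → Lam XW U V κ → ∀ j → Lam XW (1 ∷ U) (twice (suc (suc j)) ∷ V) κ
  pairX {U} {V} {κ} l j = record
    { cfg = next
    ; inv = step inv (xp-ok inv nws)
    ; nws = xp-XW {cfg} nws
    ; W<V = subst (All _) (sym (inner-step c μ 1 xpN cfg))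
        (Allₚ.++⁺ (subst (All _) (sym xp-inner)
            (≤-<-trans (≤-trans (sx-val P R c c) (m≤m+n _ 2)) PR<V′
             ∷ ≤-<-trans (lq-val P′ R′) PR<V′
             ∷ All.map (λ { (inUp p q) → ≤-<-trans (≤-trans (up≤PR _ R′ P′ c c (≤-pred (≤-trans q (Zig.hi z))) c+c≤R′) (m≤m+n _ 2)) PR<V′ })
                 (in-up (Zig.s z) (Zig.k z) ≤-refl)))
          (Allₚ.map⁺ (All.zipWith (λ {w} → old w) (W<V , nws))))
    ; PR<V = PR<V′
    ; V<U = subst₂ (λ x y → val x < val y) (sym totV-next) (sym totU-next)
        (subst₂ (λ a b → a + val (sh (numV cfg) c μ 1 V₀) < b + val (sh (numU cfg) c μ 1 (totU cfg))) (sym (+-identityʳ (suc (P + c)))) (sym (+-identityʳ P′))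
          (lamX (val V₀) (val (totU cfg)) P c _ _ _ _ _ _ V<U (*-monoˡ-≤ c V≤U) (*-monoˡ-≤ μ lv≤) (*-monoˡ-≤ 1 tp≤)))
    ; 4≤V = subst (4 ≤_) (sym numV-next) (m≤n⇒m≤1+n 4≤V)
    ; V≤U = subst₂ _≤_ (sym numV-next) (sym numU-next) (s≤s V≤U)
    ; 1≤lv = subst (λ x → 1 ≤ lv x) (sym totV-next) 1≤lv
    ; lv≤ = subst₂ (λ x y → lv x ≤ lv y) (sym totV-next) (sym totU-next) lv≤
    ; tp≤ = subst₂ (λ x y → tp x ≤ tp y) (sym totV-next) (sym totU-next) tp≤
    ; shp = ↭-trans (↭-reflexive (trans (shape-step c μ 1 xpN cfg) (cong (λ n → (vT , n) ∷ (uT , 1) ∷ shape cfg) (cong (λ n → suc (suc n)) (len-zLS 1 (suc P′) (suc j))))))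
        (↭-trans (prep _ (↭-trans (prep _ shp) (spider-u 1 U V κ))) (spider-v _ (1 ∷ U) V κ))
    }
    where
    open Lam l
    open XP P R m j
    c = suc j
    V₀ = totV cfg
    open Hub {cfg} (Inv.pieces inv) c μ 1 xpN
    z = legE-zig P′ j (≤-trans (m≤n+m c P) (m≤m+n (P + c) 2))
    c+c≤R′ : c + c ≤ R′
    c+c≤R′ = ≤-trans (m≤n+m (c + c) R) (≤-trans (≤-reflexive (sym (+-assoc R c c))) (+-monoʳ-≤ (R + c) (m≤n+m c 2)))
    4c : 4 * c ≤ numV cfg * c
    4c = *-monoˡ-≤ c 4≤V
    V≥ : ∀ {x} → x < suc (P + c) + val (sh (numV cfg) c μ 1 V₀) → x < val (totV next)
    V≥ {x} h = subst (λ y → x < val y) (sym totV-next) (subst (λ a → x < a + val (sh (numV cfg) c μ 1 V₀)) (sym (+-identityʳ (suc (P + c)))) h)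
    PR<V′ : P′ + R′ + 2 < val (totV next)
    PR<V′ = V≥ (lamPRX (val V₀) P R c _ _ _ PR<V 4c (1*≤ μ 1≤lv) (s≤s z≤n))
    old : ∀ w → val w < val V₀ × XW P R w → val (sh 2 c μ 1 w) < val (totV next)
    old w (h , n) with _ , a , b ← XW-lv n =
      V≥ (lamWX (val w) (val V₀) P c _ _ _ (lv w * μ) (tp w) h 4c (1*≤ μ 1≤lv) (*-monoˡ-≤ μ a) b (s≤s z≤n))

  module _ {U V κ} (l : Lam XW U V κ) where
    open Lam l

    private
      pu : Pure cfg
      pu = All.map (λ n → proj₁ (XW-lv n)) nws

    module _ (c d : ℕ) (xs : List Lab) (d≤c : d ≤ c) (z : Zig (P + c + 0) c d xs) (e : EndS xs) where
      private
        open Step P R m c 0 d 0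

        N : Config
        N = (uK , xs) ∷ []
        open Hub {cfg} (Inv.pieces inv) c d 0 N
        V₀ = totV cfg
        4c : 4 * c ≤ numV cfg * c
        4c = *-monoˡ-≤ c 4≤V
        PR<V′ : P′ + R′ + 2 < val (totV next)
        PR<V′ = subst (λ y → P′ + R′ + 2 < val y) (sym totV-next) (lamPR (val V₀) P R c d _ _ PR<V 4c d≤c)
        c+d≤R′ : c + d ≤ R′
        c+d≤R′ = ≤-trans (m≤n+m (c + d) R) (≤-reflexive (sym (+-assoc R c d)))
        lv≤′ : lv (totV next) ≤ lv (totU next)
        lv≤′ = subst₂ (λ x y → lv x ≤ lv y) (sym totV-next) (sym totU-next) (≤-trans lv≤ (m≤n+m _ (lv (totU N))))
        s : shape next ↭ spider (length xs ∷ U) V κ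
        s = ↭-trans (↭-reflexive (shape-step c d 0 N cfg)) (↭-trans (prep _ shp) (spider-u _ U V κ))

      -- The first leg of `u` beyond the pairs makes its degree strictly larger, which turns
      -- domination into `Ord`; further legs can then be added by `addLeg`.
      extra : Strong (length xs ∷ U) V κ 1
      extra = record
        { cfg = next
        ; inv = step inv (insert-ok inv pu z (okU e))
        ; ord = record
          { V<U = subst₂ (λ x y → val x < val y) (sym totV-next) (sym totU-next)
              (lamE (val V₀) (val (totU cfg)) (val (totU N)) _ _ _ _ _ _ V<U (*-monoˡ-≤ c V≤U) (*-monoˡ-≤ d lv≤) (*-monoˡ-≤ 0 tp≤))
          ; P<V = lam-P P′ R′ _ PR<V′
          ; W<V = subst (All _) (sym (inner-step c d 0 N cfg)) (Allₚ.++⁺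
              (All.map (λ { (a , b) → ≤-<-trans (≤-trans a (≤-trans (≤-trans (≤-reflexive (+-assoc P′ c d)) (+-monoʳ-≤ P′ c+d≤R′)) (m≤m+n _ 2))) PR<V′
                                    , ≤-trans b (s≤s z≤n) }) (zig-top uK z))
              (Allₚ.map⁺ (All.zipWith (λ {w} → old w) (W<V , nws))))
          ; lvs = ≤-trans lv≤′ (m≤m+n _ 2)
          ; 3≤ = subst (3 ≤_) (sym numV-next) (≤-trans (n≤1+n 3) 4≤V)
          ; nn = subst₂ _<_ (sym numV-next) (sym numU-next) (s≤s V≤U)
          }
        ; shp = s ; nU = shape-numU {length xs ∷ U} {V} {κ} next s ; nV = shape-numV {length xs ∷ U} {V} {κ} next s
        ; pure = λ _ → pu′ }
        , pu′ , ≤-trans lv≤′ (m≤m+n _ 1)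
        where
        pu′ : Pure next
        pu′ = Pure-step c d 0 N cfg (zig-pure uK z) pu
        old : ∀ w → val w < val V₀ × XW P R w → val (sh 2 c d 0 w) < val (totV next) × lv w ≤ suc (lv (totV next))
        old w (h , n) with _ , a , b ← XW-lv n =
          subst (λ y → val (sh 2 c d 0 w) < val y) (sym totV-next)
            (lamW (val w) (val V₀) c d _ _ (tp V₀ * 0) (lv w * d) (tp w) h 4c (1*≤ d 1≤lv) (*-monoˡ-≤ d a) d≤c) ,
          ≤-trans a (s≤s (subst (λ x → 1 ≤ lv x) (sym totV-next) 1≤lv))

-- All legs of `v` even of length at least four.

module EvenLegs where

  open import Data.Bool using (Bool; true; false; _∧_; T)
  open import Data.Nat using (_≤ᵇ_)
  open import Data.Nat.Properties
  open import Data.List.Properties using (++-assoc)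
  open import Data.Unit using (tt)
  open import Relation.Binary.PropositionalEquality using (_≡_; refl; sym; trans; cong; subst; subst₂)
  open Labellings
  open Zigzags
  open Insertion
  open Symbolic
  open Tables
  open Extension
  open SmallDegrees
  open Domination

  Strong-resp : ∀ {U U′ V V′ κ g} → U ↭ U′ → V ↭ V′ → Strong U V κ g → Strong U′ V′ κ g
  Strong-resp p q (r , s) = Result-resp p q r , s

  legZig : ∀ x → 1 ≤ x → ∃₂ λ c d → d ≤ c × (∀ P′ → c ≤ P′ → Σ (List Lab) λ xs → Zig P′ c d xs × EndS xs × length xs ≡ x)
  legZig x h with legView x h
  ... | I  , j , refl = 1 , 0 , z≤n , λ P′ q → legO P′ 0 , legO-zig P′ 0 q , EndS-legO P′ 0 , refl
  ... | Od , j , refl = suc (suc j) , suc j , n≤1+n _ , λ P′ q →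
    legO P′ (suc j) , legO-zig P′ (suc j) q , EndS-legO P′ (suc j) , cong suc (len-zLS 2 (suc P′) (suc j))
  ... | Ev , j , refl = suc j , suc j , ≤-refl , λ P′ q →
    legE P′ j , legE-zig P′ j q , EndS-legE P′ j , len-zLS 1 (suc P′) (suc j)

  private
    c≤ : ∀ P c → c ≤ P + c + 0
    c≤ P c = ≤-trans (m≤n+m c P) (≤-reflexive (sym (+-identityʳ _)))

  addLeg : ∀ {U V κ} → Strong U V κ 1 → ∀ x → 1 ≤ x → Strong (x ∷ U) V κ 1
  addLeg {U} {V} {κ} (r , pu , l) x h with c , d , d≤c , f ← legZig x h with xs , z , e , refl ← f (Result.P r + c + 0) (c≤ (Result.P r) c) =
    record
      { cfg = next ; inv = addU-inv c d xs d≤c z e ; ord = addU-ord c d xs d≤c z e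
      ; shp = s ; nU = shape-numU {length xs ∷ U} {V} {κ} next s ; nV = shape-numV {length xs ∷ U} {V} {κ} next s
      ; pure = λ _ → addU-pure c d xs d≤c z e }
    , addU-pure c d xs d≤c z e
    , ≤-trans (addU-lv c d xs d≤c z e) (≤-reflexive (+-comm 1 _))
    where
    open Result r
    open AddU inv ord pu (≤-trans l (≤-reflexive (+-comm _ 1)))
    next = (uK , xs) ∷ shC c d 0 cfg
    s : shape next ↭ spider (length xs ∷ U) V κ
    s = ↭-trans (↭-reflexive (shape-step c d 0 ((uK , xs) ∷ []) cfg)) (↭-trans (prep _ shp) (spider-u _ U V κ))

  addLegs : ∀ {U V κ} → Strong U V κ 1 → ∀ es → All (1 ≤_) es → Strong (es ++ U) V κ 1
  addLegs s []       []       = s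
  addLegs s (x ∷ es) (h ∷ hs) = addLeg (addLegs s es hs) x h

  firstExtra : ∀ {U V κ} → Lam XW U V κ → ∀ x → 1 ≤ x → Strong (x ∷ U) V κ 1
  firstExtra l x h with c , d , d≤c , f ← legZig x h with xs , z , e , refl ← f (Lam.P l + c + 0) (c≤ (Lam.P l) c) =
    extra l c d xs d≤c z e

  -- A leg of u of odd (true) or even length at least two, and the even leg of v it is paired with.
  PairΛ : Set
  PairΛ = Bool × ℕ × ℕ

  uLen : PairΛ → ℕ
  uLen (true  , i , _) = suc (twice (suc i))
  uLen (false , i , _) = twice (suc i)

  vLen : ℕ → ℕ
  vLen j = twice (suc (suc j))

  vLenP : PairΛ → ℕ
  vLenP (_ , _ , j) = vLen j

  checkΛ : Summary → Bool
  checkΛ s = ltᴸ (sval (Vˢ s)) (sval (Uˢ s)) ∧ (ltᴸ (Pˢ s +ᴸ Rˢ s +ᴸ # 2) (sval (Vˢ s)) ∧ (checkTops (Vˢ s) (topsˢ s) ∧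
    ((4 ≤ᵇ nVˢ s) ∧ ((nVˢ s ≤ᵇ nUˢ s) ∧ ((1 ≤ᵇ slv (Vˢ s)) ∧ ((slv (Vˢ s) ≤ᵇ slv (Uˢ s)) ∧ (stp (Vˢ s) ≤ᵇ stp (Uˢ s))))))))

  nuc-lam : ∀ {Wp ρ s shp U V κ} → checkΛ s ≡ true → Nuc Wp ρ s shp → shp ↭ spider U V κ → Lam Wp U V κ
  nuc-lam {ρ = ρ} {s} t n p
    with t₁ , t ← ∧-T {ltᴸ (sval (Vˢ s)) (sval (Uˢ s))} (subst T (sym t) tt)
    with t₂ , t ← ∧-T {ltᴸ (Pˢ s +ᴸ Rˢ s +ᴸ # 2) (sval (Vˢ s))} t
    with t₃ , t ← ∧-T {checkTops (Vˢ s) (topsˢ s)} t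
    with t₄ , t ← ∧-T {4 ≤ᵇ nVˢ s} t
    with t₅ , t ← ∧-T {nVˢ s ≤ᵇ nUˢ s} t
    with t₆ , t ← ∧-T {1 ≤ᵇ slv (Vˢ s)} t
    with t₇ , t₈ ← ∧-T {slv (Vˢ s) ≤ᵇ slv (Uˢ s)} t = record
    { cfg = cfg ; inv = inv ; nws = nws
    ; W<V = subst (λ x → All (λ w → val w < val x) (inner cfg)) (sym eV) (All.map proj₁ (tops-below ρ (Vˢ s) (topsˢ s) t₃ tops))
    ; PR<V = subst₂ (λ a x → a < val x)
        (trans (ev-+ ρ (Pˢ s +ᴸ Rˢ s) (# 2)) (cong (_+ 2) (ev-+ ρ (Pˢ s) (Rˢ s)))) (sym eV)
        (lt-ev ρ (Pˢ s +ᴸ Rˢ s +ᴸ # 2) (sval (Vˢ s)) t₂)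
    ; V<U = subst₂ (λ x y → val x < val y) (sym eV) (sym eU) (lt-ev ρ (sval (Vˢ s)) (sval (Uˢ s)) t₁)
    ; 4≤V = subst (4 ≤_) (sym nV) (≤ᵇ⇒≤ 4 _ t₄)
    ; V≤U = subst₂ _≤_ (sym nV) (sym nU) (≤ᵇ⇒≤ _ _ t₅)
    ; 1≤lv = subst (λ x → 1 ≤ lv x) (sym eV) (≤ᵇ⇒≤ 1 _ t₆)
    ; lv≤ = subst₂ (λ x y → lv x ≤ lv y) (sym eV) (sym eU) (≤ᵇ⇒≤ _ _ t₇)
    ; tp≤ = subst₂ (λ x y → tp x ≤ tp y) (sym eV) (sym eU) (≤ᵇ⇒≤ _ _ t₈)
    ; shp = ↭-trans (↭-reflexive shpe) p
    }
    where open Nuc n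

  -- Both choices favour `u`: the large labels of an odd core ascend along its list, which therefore
  -- runs from `v` to `u`, and an even core has its Q-label at `u`.
  coreΛ : Bool → Item
  coreΛ true  = item rO (var 0)
  coreΛ false = item cQ (var 0)

  coreLenΛ : Bool → ℕ → ℕ
  coreLenΛ true  i = suc (twice i)
  coreLenΛ false i = twice (suc i)

  uItem : Bool → Lin → Item
  uItem true  e = item uQ e
  uItem false e = item uE e

  private
    uI-shape : ∀ ρ b e i → ev ρ e ≡ i → shapeᴵ ρ (uItem b e) ≡ (uT , uLen (b , i , 0))
    uI-shape ρ true  e i refl = refl
    uI-shape ρ false e i refl = refl

    uLen-j : ∀ b i j → uLen (b , i , 0) ≡ uLen (b , i , j)
    uLen-j true  i j = refl
    uLen-j false i j = refl

    coreΛ-shape : ∀ b ρ {i} → ρ 0 ≡ i → shapeᴵ ρ (coreΛ b) ≡ (cT , coreLenΛ b i)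
    coreΛ-shape true  ρ refl = cong (λ n → cT , suc (twice n)) (+00 (ρ 0))
    coreΛ-shape false ρ refl = cong (λ n → cT , twice (suc n)) (+00 (ρ 0))

    _⊳_ : ∀ {x y : Tag × ℕ} {s t s′} → x ≡ y → s ↭ t → (y ∷ t ↭ s′) → x ∷ s ↭ s′
    (refl ⊳ p) q = ↭-trans (prep _ p) q

    pair-shape : ∀ U V {κ} ρ b {eu ew i j s} → ev ρ eu ≡ i → ev ρ ew ≡ j → s ↭ spider U V κ →
      (vT , twice (suc (suc (ev ρ ew)))) ∷ shapeᴵ ρ (uItem b eu) ∷ s ↭ spider (uLen (b , i , j) ∷ U) (vLen j ∷ V) κ
    pair-shape U V {κ} ρ b {eu} {i = i} {j} p refl q =
      ↭-trans (prep _ (((trans (uI-shape ρ b eu i p) (cong (uT ,_) (uLen-j b i j))) ⊳ q) (spider-u _ U V κ))) (spider-v _ _ V κ)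

    x-shape : ∀ U V {κ x j s} → x ≡ j → s ↭ spider U V κ → (vT , twice (suc (suc x))) ∷ (uT , 1) ∷ s ↭ spider (1 ∷ U) (vLen j ∷ V) κ
    x-shape U V {κ} refl q = ↭-trans (prep _ (↭-trans (prep _ q) (spider-u 1 U V κ))) (spider-v _ _ V κ)

    -- The even leg of v of length 2(j+2) has parameter j+1.
    vItem : Lin → Item
    vItem e = item vE (# 1 +ᴸ e)

    items₃ : Bool → Bool → Bool → Bool → List Item
    items₃ k b₁ b₂ b₃ = vItem (var 2) ∷ uItem b₁ (var 1) ∷ vItem (var 4) ∷ uItem b₂ (var 3) ∷ vItem (var 6) ∷ uItem b₃ (var 5) ∷ coreΛ k ∷ []
    items₂ : Bool → Bool → Bool → List Item
    items₂ k b₁ b₂ = vItem (var 2) ∷ uItem b₁ (var 1) ∷ vItem (var 4) ∷ uItem b₂ (var 3) ∷ coreΛ k ∷ []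
    items₁ : Bool → Bool → List Item
    items₁ k b₁ = vItem (var 2) ∷ uItem b₁ (var 1) ∷ coreΛ k ∷ []

    -- Four labels at `v` are present once the core and three pairs are, so domination starts there.
    -- The four families of checks differ in how many of the three pairs have a leg of `u` of length
    -- one.
    chk₃ : ∀ k b₁ b₂ b₃ → checkΛ (run (items₃ k b₁ b₂ b₃)) ≡ true
    chk₃ true  true  true  true  = refl
    chk₃ true  true  true  false = refl
    chk₃ true  true  false true  = refl
    chk₃ true  true  false false = refl
    chk₃ true  false true  true  = refl
    chk₃ true  false true  false = refl
    chk₃ true  false false true  = refl
    chk₃ true  false false false = refl
    chk₃ false true  true  true  = refl
    chk₃ false true  true  false = refl
    chk₃ false true  false true  = refl
    chk₃ false true  false false = refl
    chk₃ false false true  true  = refl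
    chk₃ false false true  false = refl
    chk₃ false false false true  = refl
    chk₃ false false false false = refl

    chk₂ : ∀ k b₁ b₂ → checkΛ (stepX (var 5) (run (items₂ k b₁ b₂))) ≡ true
    chk₂ true  true  true  = refl
    chk₂ true  true  false = refl
    chk₂ true  false true  = refl
    chk₂ true  false false = refl
    chk₂ false true  true  = refl
    chk₂ false true  false = refl
    chk₂ false false true  = refl
    chk₂ false false false = refl

    chk₁ : ∀ k b₁ → checkΛ (stepX (var 4) (stepX (var 3) (run (items₁ k b₁)))) ≡ true
    chk₁ true  true  = refl
    chk₁ true  false = refl
    chk₁ false true  = refl
    chk₁ false false = refl

    chk₀ : ∀ k → checkΛ (stepX (var 3) (stepX (var 2) (stepX (var 1) (run (coreΛ k ∷ []))))) ≡ true
    chk₀ true  = refl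
    chk₀ false = refl

    start-shape : ∀ k ρ {i} → ρ 0 ≡ i → map (shapeᴵ ρ) (coreΛ k ∷ []) ↭ spider [] [] (coreLenΛ k i)
    start-shape k ρ e = ↭-reflexive (cong (_∷ []) (coreΛ-shape k ρ e))

    lam₃ : ∀ k i p₁ p₂ p₃ → Lam NW (uLen p₁ ∷ uLen p₂ ∷ uLen p₃ ∷ []) (vLenP p₁ ∷ vLenP p₂ ∷ vLenP p₃ ∷ []) (coreLenΛ k i)
    lam₃ k i (b₁ , i₁ , j₁) (b₂ , i₂ , j₂) (b₃ , i₃ , j₃) = nuc-lam (chk₃ k b₁ b₂ b₃) (nuc-run ρ (items₃ k b₁ b₂ b₃))
      (pair-shape (_ ∷ _ ∷ []) (_ ∷ _ ∷ []) ρ b₁ {var 1} {var 2} (+00 i₁) (+00 j₁)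
        (pair-shape (_ ∷ []) (_ ∷ []) ρ b₂ {var 3} {var 4} (+00 i₂) (+00 j₂)
          (pair-shape [] [] ρ b₃ {var 5} {var 6} (+00 i₃) (+00 j₃) (start-shape k ρ refl))))
      where ρ = env (i ∷ i₁ ∷ j₁ ∷ i₂ ∷ j₂ ∷ i₃ ∷ j₃ ∷ [])

    lam₂ : ∀ k i p₁ p₂ x → Lam XW (1 ∷ uLen p₁ ∷ uLen p₂ ∷ []) (vLen x ∷ vLenP p₁ ∷ vLenP p₂ ∷ []) (coreLenΛ k i)
    lam₂ k i (b₁ , i₁ , j₁) (b₂ , i₂ , j₂) x = nuc-lam (chk₂ k b₁ b₂) (nuc-stepX (var 5) (nuc-weaken (nuc-run ρ (items₂ k b₁ b₂))))
      (x-shape (_ ∷ _ ∷ []) (_ ∷ _ ∷ []) (+00 x) (pair-shape (_ ∷ []) (_ ∷ []) ρ b₁ {var 1} {var 2} (+00 i₁) (+00 j₁)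
        (pair-shape [] [] ρ b₂ {var 3} {var 4} (+00 i₂) (+00 j₂) (start-shape k ρ refl))))
      where ρ = env (i ∷ i₁ ∷ j₁ ∷ i₂ ∷ j₂ ∷ x ∷ [])

    lam₁ : ∀ k i p₁ x y → Lam XW (1 ∷ 1 ∷ uLen p₁ ∷ []) (vLen x ∷ vLen y ∷ vLenP p₁ ∷ []) (coreLenΛ k i)
    lam₁ k i (b₁ , i₁ , j₁) x y = nuc-lam (chk₁ k b₁) (nuc-stepX (var 4) (nuc-stepX (var 3) (nuc-weaken (nuc-run ρ (items₁ k b₁)))))
      (x-shape (_ ∷ _ ∷ []) (_ ∷ _ ∷ []) (+00 x) (x-shape (_ ∷ []) (_ ∷ []) (+00 y) (pair-shape [] [] ρ b₁ {var 1} {var 2} (+00 i₁) (+00 j₁) (start-shape k ρ refl))))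
      where ρ = env (i ∷ i₁ ∷ j₁ ∷ y ∷ x ∷ [])

    lam₀ : ∀ k i x y z → Lam XW (1 ∷ 1 ∷ 1 ∷ []) (vLen x ∷ vLen y ∷ vLen z ∷ []) (coreLenΛ k i)
    lam₀ k i x y z = nuc-lam (chk₀ k) (nuc-stepX (var 3) (nuc-stepX (var 2) (nuc-stepX (var 1) (nuc-weaken (nuc-run ρ (coreΛ k ∷ []))))))
      (x-shape (_ ∷ _ ∷ []) (_ ∷ _ ∷ []) (+00 x) (x-shape (_ ∷ []) (_ ∷ []) (+00 y) (x-shape [] [] (+00 z) (start-shape k ρ refl))))
      where ρ = env (i ∷ z ∷ y ∷ x ∷ [])

    addPairs : ∀ {U V κ} → Lam NW U V κ → ∀ ps → Lam NW (map uLen ps ++ U) (map vLenP ps ++ V) κ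
    addPairs l []                     = l
    addPairs l ((true  , i , j) ∷ ps) = pairO (addPairs l ps) i (suc j)
    addPairs l ((false , i , j) ∷ ps) = pairE (addPairs l ps) i (suc j)

    addXs : ∀ {U V κ} → Lam XW U V κ → ∀ xs → Lam XW (map (λ _ → 1) xs ++ U) (map vLen xs ++ V) κ
    addXs l []       = l
    addXs l (x ∷ xs) = pairX (addXs l xs) x

    Lam-resp : ∀ {Wp U U′ V V′ κ} → U ↭ U′ → V ↭ V′ → Lam Wp U V κ → Lam Wp U′ V′ κ
    Lam-resp {κ = κ} p q l = record
      { cfg = cfg ; inv = inv ; nws = nws ; W<V = W<V ; PR<V = PR<V ; V<U = V<U ; 4≤V = 4≤V ; V≤U = V≤U
      ; 1≤lv = 1≤lv ; lv≤ = lv≤ ; tp≤ = tp≤ ; shp = ↭-trans shp (spider-resp κ p q) }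
      where open Lam l

    front : ∀ {A : Set} (as bs cs : List A) → as ++ (bs ++ cs) ↭ cs ++ (bs ++ as)
    front as bs cs = ↭-trans (Perm.++-comm as (bs ++ cs)) (↭-trans (↭-reflexive (++-assoc bs cs as)) (Perm.shifts bs cs))

  -- Pairs with a long leg of `u` come before those with a leg of length one, because the latter
  -- leave `NW` for `XW` and the former need `NW`.
  lamΛ : ∀ k i ps xs → 3 ≤ length ps + length xs →
         Lam XW (map uLen ps ++ map (λ _ → 1) xs) (map vLenP ps ++ map vLen xs) (coreLenΛ k i)
  lamΛ k i (p₁ ∷ p₂ ∷ p₃ ∷ ps) xs h = Lam-resp (front (map (λ _ → 1) xs) (map uLen ps) _) (front (map vLen xs) (map vLenP ps) _)
    (addXs (lam-weaken (addPairs (lam₃ k i p₁ p₂ p₃) ps)) xs)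
  lamΛ k i (p₁ ∷ p₂ ∷ []) (x ∷ xs) h = Lam-resp (front (map (λ _ → 1) xs) (1 ∷ []) _) (front (map vLen xs) (vLen x ∷ []) _)
    (addXs (lam₂ k i p₁ p₂ x) xs)
  lamΛ k i (p₁ ∷ []) (x ∷ y ∷ xs) h = Lam-resp (front (map (λ _ → 1) xs) (1 ∷ 1 ∷ []) _) (front (map vLen xs) (vLen x ∷ vLen y ∷ []) _)
    (addXs (lam₁ k i p₁ x y) xs)
  lamΛ k i [] (x ∷ y ∷ z ∷ xs) h = Lam-resp (Perm.++-comm (map (λ _ → 1) xs) _) (Perm.++-comm (map vLen xs) _)
    (addXs (lam₀ k i x y z) xs)
  lamΛ k i (p₁ ∷ p₂ ∷ []) [] (s≤s (s≤s ()))
  lamΛ k i (p₁ ∷ []) [] (s≤s ())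
  lamΛ k i (p₁ ∷ []) (x ∷ []) (s≤s (s≤s ()))
  lamΛ k i [] [] ()
  lamΛ k i [] (x ∷ []) (s≤s ())
  lamΛ k i [] (x ∷ y ∷ []) (s≤s (s≤s ()))

-- Induction on the total length of the legs.

module Recursion where

  open import Data.Bool using (Bool; true; false; _∧_; _∨_; T)
  open import Data.Bool.Properties using (T-∨)
  open import Data.Maybe using (is-just)
  open import Data.Nat using (_∸_; _≟_)
  open import Data.Nat.Properties hiding (_≟_)
  open import Data.Nat.Tactic.RingSolver using (solve-∀)
  open import Data.List using (replicate)
  open import Data.List.Properties using (length-++; length-map; length-replicate)
  open import Data.List.Membership.Propositional.Properties using (∈-∃++)
  open import Data.List.Membership.DecPropositional _≟_ using (_∈?_)
  open import Data.Nat.ListAction using (sum)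
  open import Data.Nat.ListAction.Properties using (sum-↭)
  open import Function.Bundles using (Equivalence)
  open import Relation.Nullary using (yes; no)
  open import Relation.Binary.PropositionalEquality using (_≡_; _≢_; refl; sym; trans; cong; cong₂; subst; subst₂)
  open Labellings
  open Zigzags
  open Insertion
  open Symbolic hiding (size)
  open Tables
  open Extension
  open SmallDegrees
  open Domination
  open EvenLegs

  long : Bool × ℕ → ℕ
  long (b , i) = uLen (b , i , 0)

  splitOnes : ∀ {U} → All (1 ≤_) U → ∃₂ λ qs α → map long qs ++ replicate α 1 ↭ U
  splitOnes []                   = [] , 0 , ↭-refl
  splitOnes {x ∷ U} (h ∷ hs) with legView x h | splitOnes hs
  ... | I  , j , refl | qs , α , p = qs , suc α , ↭-trans (Perm.shift 1 (map long qs) (replicate α 1)) (prep 1 p)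
  ... | Od , j , refl | qs , α , p = (true , j) ∷ qs , α , prep _ p
  ... | Ev , j , refl | qs , α , p = (false , j) ∷ qs , α , prep _ p

  -- The list `x ∷ es` holds the legs of `u` left over by the pairing; it has at least one element,
  -- since `u` has more legs than `v`.
  record Match (U J : List ℕ) : Set where
    field
      ps   : List PairΛ
      xs   : List ℕ
      x    : ℕ
      es   : List ℕ
      uEq  : (map uLen ps ++ map (λ _ → 1) xs) ++ x ∷ es ≡ U
      vEq  : map vLenP ps ++ map vLen xs ≡ map vLen J
      size≡ : length ps + length xs ≡ length J

  matchOnes : ∀ α J → length J < α → Match (replicate α 1) J
  matchOnes α J h = record
    { ps = [] ; xs = J ; x = 1 ; es = replicate (α ∸ suc (length J)) 1 ; uEq = eq α J h ; vEq = refl ; size≡ = refl }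
    where
    eq : ∀ α J → length J < α → map (λ _ → 1) J ++ 1 ∷ replicate (α ∸ suc (length J)) 1 ≡ replicate α 1
    eq (suc α) []      h       = refl
    eq (suc α) (_ ∷ J) (s≤s h) = cong (1 ∷_) (eq α J h)

  match : ∀ qs α J → length J < length qs + α → Match (map long qs ++ replicate α 1) J
  match []             α J       h       = matchOnes α J h
  match (q ∷ qs)       α []      h       =
    record { ps = [] ; xs = [] ; x = long q ; es = map long qs ++ replicate α 1 ; uEq = refl ; vEq = refl ; size≡ = refl }
  match ((b , i) ∷ qs) α (j ∷ J) (s≤s h) = record
    { ps = (b , i , j) ∷ ps ; xs = xs ; x = x ; es = es
    ; uEq = cong₂ _∷_ (uLen-j b) uEq ; vEq = cong (vLen j ∷_) vEq ; size≡ = cong suc size≡ }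
    where
    open Match (match qs α J h)
    uLen-j : ∀ b → uLen (b , i , j) ≡ long (b , i)
    uLen-j true  = refl
    uLen-j false = refl

  coreΛView : ∀ κ → 1 ≤ κ → ∃₂ λ k i → κ ≡ coreLenΛ k i
  coreΛView κ h with halves κ
  ... | inj₂ (j , e)     = true , j , e
  ... | inj₁ (suc j , e) = false , j , e
  ... | inj₁ (zero , refl) with () ← h

  allEven : ∀ {U κ} J → All (1 ≤_) U → 1 ≤ κ → 3 ≤ length J → length J < length U → Result U (map vLen J) κ
  allEven {U} {κ} J hU hκ h3 h with qs , α , p ← splitOnes hU with k , i , refl ← coreΛView κ hκ =
    proj₁ (Strong-resp (↭-trans (Perm.++-comm es _) (↭-trans (↭-sym (Perm.shift x _ es)) (↭-trans (↭-reflexive uEq) p))) (↭-reflexive vEq)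
      (addLegs (firstExtra (lamΛ k i ps xs (subst (3 ≤_) (sym size≡) h3)) x (All.head rest)) es (All.tail rest)))
    where
    len : length J < length qs + α
    len = subst (length J <_) (trans (sym (↭-length p)) (trans (length-++ (map long qs)) (cong₂ _+_ (length-map long qs) (length-replicate α)))) h
    open Match (match qs α J len)
    rest : All (1 ≤_) (x ∷ es)
    rest = Allₚ.++⁻ʳ (map uLen ps ++ map (λ _ → 1) xs) (All-resp-↭ (↭-trans (↭-sym p) (↭-reflexive (sym uEq))) hU)

  Raw-resp : ∀ {U U′ V V′ κ} → U ↭ U′ → V ↭ V′ → Raw U V κ → Raw U′ V′ κ
  Raw-resp p q r = record
    { cfg = cfg ; pieces = pieces ; diff = diff ; range = range ; innD = innD ; low = low ; inU = inU ; inV = inV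
    ; endU = endU ; endV = endV
    ; hubs = subst₂ (λ a b → (b < a × _) ⊎ (b ≡ a × _)) (↭-length p) (↭-length q) hubs
    ; shp = ↭-trans shp (spider-resp _ p q)
    ; nU = trans nU (cong suc (↭-length p)) ; nV = trans nV (cong suc (↭-length q)) }
    where open Raw r

  above-sound : ∀ ρ h {ws} ts → T (checkAbove h ts) → All (λ w → Any (λ t → w ≼ evl ρ t) ts) ws →
                All (λ w → val w < ev ρ (sval h)) ws
  above-sound ρ h ts c = All.map (go ts c)
    where
    go : ∀ ts {w} → T (checkAbove h ts) → Any (λ t → w ≼ evl ρ t) ts → val w < ev ρ (sval h)
    go (t ∷ ts) c (here (_ , _ , l)) = ≤-<-trans l (lt-ev ρ (sval t) (sval h) (proj₁ (∧-T {ltᴸ (sval t) (sval h)} c)))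
    go (t ∷ ts) c (there a)          = go ts (proj₂ (∧-T {ltᴸ (sval t) (sval h)} c)) a

  solved₂₂ : ∀ {U V κ ps} ρ → length V ≡ length U → Solved check₂₂ ps → map (shapeP ρ) ps ↭ spider U V κ → Raw U V κ
  solved₂₂ {U} {V} {κ} ρ l (is , t , f) p
    with t₁ , t ← ∧-T {ltᴸ (sval (Vˢ (run is))) (sval (Uˢ (run is))) ∨ ltᴸ (sval (Uˢ (run is))) (sval (Vˢ (run is)))} t
    with t₂ , t₃ ← ∧-T {ltᴸ (Pˢ (run is)) (sval (Vˢ (run is))) ∧ checkAbove (Vˢ (run is)) (topsˢ (run is))} t
    with t₄ , t₅ ← ∧-T {ltᴸ (Pˢ (run is)) (sval (Vˢ (run is)))} t₂
    with t₆ , t₇ ← ∧-T {ltᴸ (Pˢ (run is)) (sval (Uˢ (run is)))} t₃ =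
    inv-raw inv (subst (λ x → All (λ w → val w < val x) (inner cfg)) (sym eU) (above-sound ρ (Uˢ s) (topsˢ s) t₇ tops))
      (subst (λ x → All (λ w → val w < val x) (inner cfg)) (sym eV) (above-sound ρ (Vˢ s) (topsˢ s) t₅ tops))
      (subst (λ x → ev ρ (Pˢ s) < val x) (sym eU) (lt-ev ρ (Pˢ s) (sval (Uˢ s)) t₆))
      (subst (λ x → ev ρ (Pˢ s) < val x) (sym eV) (lt-ev ρ (Pˢ s) (sval (Vˢ s)) t₄))
      (inj₂ (l , λ e → differ (Equivalence.to T-∨ t₁) (trans (cong val (sym eV)) (trans e (cong val eU)))))
      shp (shape-numU {U} {V} {κ} cfg shp) (shape-numV {U} {V} {κ} cfg shp)
    where
    s = run is
    open Nuc (nuc-run ρ is)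
    shp : shape cfg ↭ spider U V κ
    shp = ↭-trans (↭-reflexive shpe) (↭-trans (f ρ) p)
    differ : T (ltᴸ (sval (Vˢ s)) (sval (Uˢ s))) ⊎ T (ltᴸ (sval (Uˢ s)) (sval (Vˢ s))) → ev ρ (sval (Vˢ s)) ≢ ev ρ (sval (Uˢ s))
    differ (inj₁ t) e = <-irrefl e (lt-ev ρ (sval (Vˢ s)) (sval (Uˢ s)) t)
    differ (inj₂ t) e = <-irrefl (sym e) (lt-ev ρ (sval (Uˢ s)) (sval (Vˢ s)) t)

  found₂₂ : ∀ t₁ t₂ s₁ s₂ k i {j₁ j₂ k₁ k₂} → j₁ ≤ j₂ → k₁ ≤ k₂ → is-just (search₂₂ t₁ t₂ s₁ s₂ k) ≡ true →
    Raw (lenT t₁ j₁ ∷ lenT t₂ j₂ ∷ []) (lenT s₁ k₁ ∷ lenT s₂ k₂ ∷ []) (coreLen k i)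
  found₂₂ t₁ t₂ s₁ s₂ k i {j₁} {j₂} {k₁} {k₂} h g e = solved₂₂ {ps = pieces₂₂ t₁ t₂ s₁ s₂ k} ρ refl (found (search₂₂ t₁ t₂ s₁ s₂ k) e)
    (↭-trans (↭-reflexive (cong₂ _∷_ (cong (λ n → uT , lenT t₂ n) (sec t₁ t₂ (var 1) (var 2) (+00 j₁) (+00 _) h))
        (cong₂ _∷_ (cong (λ n → uT , lenT t₁ n) (+00 j₁))
        (cong₂ _∷_ (cong (λ n → vT , lenT s₂ n) (sec s₁ s₂ (var 3) (var 4) (+00 k₁) (+00 _) g))
        (cong₂ _∷_ (cong (λ n → vT , lenT s₁ n) (+00 k₁)) (cong (_∷ []) (core-shape ρ k i refl)))))))
      (↭-trans (Perm.++-comm (_ ∷ _ ∷ _ ∷ _ ∷ []) _) (prep _ (swap _ _ (swap _ _ ↭-refl)))))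
    where
    ρ = env (i ∷ j₁ ∷ excess t₁ t₂ j₁ j₂ ∷ k₁ ∷ excess s₁ s₂ k₁ k₂ ∷ [])
    sec : ∀ t₁ t₂ x y {j₁ j₂} → ev ρ x ≡ j₁ → ev ρ y ≡ excess t₁ t₂ j₁ j₂ → j₁ ≤ j₂ → ev ρ (second t₁ t₂ x y) ≡ j₂
    sec t₁ t₂ x y {j₁} ex ey h = ev-second ρ t₁ t₂ x y ex
      (λ e → trans (cong (_+ j₁) ey) (excess-true t₁ t₂ h e)) (λ e → trans ey (excess-false t₁ t₂ e))

  sorted₂₂ : ∀ t₁ t₂ s₁ s₂ k i {j₁ j₂ k₁ k₂} → j₁ ≤ j₂ → k₁ ≤ k₂ →
    1 ∈ lenT t₁ j₁ ∷ lenT t₂ j₂ ∷ lenT s₁ k₁ ∷ lenT s₂ k₂ ∷ [] →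
    Raw (lenT t₁ j₁ ∷ lenT t₂ j₂ ∷ []) (lenT s₁ k₁ ∷ lenT s₂ k₂ ∷ []) (coreLen k i)
  sorted₂₂ t₁ t₂ s₁ s₂ k i h g one with ∨-elim (given (every₂₂ t₁ t₂ s₁ s₂ k) (some one))
    where
    some : ∀ {j₁ j₂ k₁ k₂} → 1 ∈ lenT t₁ j₁ ∷ lenT t₂ j₂ ∷ lenT s₁ k₁ ∷ lenT s₂ k₂ ∷ [] → isI t₁ ∨ (isI t₂ ∨ (isI s₁ ∨ isI s₂)) ≡ true
    some (here e)                         = ∨-introˡ (isI-one t₁ _ e)
    some (there (here e))                 = ∨-introʳ (isI t₁) (∨-introˡ (isI-one t₂ _ e))
    some (there (there (here e)))         = ∨-introʳ (isI t₁) (∨-introʳ (isI t₂) (∨-introˡ (isI-one s₁ _ e)))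
    some (there (there (there (here e)))) = ∨-introʳ (isI t₁) (∨-introʳ (isI t₂) (∨-introʳ (isI s₁) (isI-one s₂ _ e)))
  ... | inj₁ e = found₂₂ t₁ t₂ s₁ s₂ k i h g e
  ... | inj₂ e = raw-swap refl (found₂₂ s₁ s₂ t₁ t₂ k i g h e)

  base₂₂ : ∀ {x₁ x₂ y₁ y₂ κ} → 1 ≤ x₁ → 1 ≤ x₂ → 1 ≤ y₁ → 1 ≤ y₂ → 1 ≤ κ →
    1 ∈ x₁ ∷ x₂ ∷ y₁ ∷ y₂ ∷ [] → Raw (x₁ ∷ x₂ ∷ []) (y₁ ∷ y₂ ∷ []) κ
  base₂₂ {x₁} {x₂} {y₁} {y₂} {κ} h₁ h₂ g₁ g₂ hκ one
    with t₁ , j₁ , refl ← legView x₁ h₁ with t₂ , j₂ , refl ← legView x₂ h₂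
    with s₁ , k₁ , refl ← legView y₁ g₁ with s₂ , k₂ , refl ← legView y₂ g₂ with k , i , refl ← coreView κ hκ
    with ≤-total j₁ j₂ | ≤-total k₁ k₂
  ... | inj₁ h | inj₁ g = sorted₂₂ t₁ t₂ s₁ s₂ k i h g one
  ... | inj₁ h | inj₂ g = Raw-resp ↭-refl (swap _ _ ↭-refl)
    (sorted₂₂ t₁ t₂ s₂ s₁ k i h g (∈-resp-↭ (prep _ (prep _ (swap _ _ ↭-refl))) one))
  ... | inj₂ h | inj₁ g = Raw-resp (swap _ _ ↭-refl) ↭-refl
    (sorted₂₂ t₂ t₁ s₁ s₂ k i h g (∈-resp-↭ (swap _ _ ↭-refl) one))
  ... | inj₂ h | inj₂ g = Raw-resp (swap _ _ ↭-refl) (swap _ _ ↭-refl)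
    (sorted₂₂ t₂ t₁ s₂ s₁ k i h g (∈-resp-↭ (swap _ _ (swap _ _ ↭-refl)) one))

  noOnes : ∀ {U} → All (1 ≤_) U → 1 ∉ U → ∃ λ U′ → U ≡ map suc U′ × All (1 ≤_) U′
  noOnes []       ne = [] , refl , []
  noOnes {suc zero ∷ U}    (h ∷ hs) ne = ⊥-elim (ne (here refl))
  noOnes {suc (suc x) ∷ U} (h ∷ hs) ne with U′ , refl , a ← noOnes hs (ne ∘ there) = suc x ∷ U′ , refl , s≤s z≤n ∷ a

  pull : ∀ {A : Set} {x : A} {U} → x ∈ U → ∃ λ U′ → U ↭ x ∷ U′
  pull {x = x} i with as , bs , refl ← ∈-∃++ i = as ++ bs , Perm.shift x as bs

  evenOrOdd : ∀ {V} → All (1 ≤_) V → 2 ∉ V → (∃ λ j → suc (twice j) ∈ V) ⊎ (∃ λ J → V ≡ map vLen J)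
  evenOrOdd []       ne = inj₂ ([] , refl)
  evenOrOdd {x ∷ V} (h ∷ hs) ne with halves x | evenOrOdd hs (ne ∘ there)
  ... | inj₂ (j , e)                 | _             = inj₁ (j , here (sym e))
  ... | inj₁ _                       | inj₁ (j , p)  = inj₁ (j , there p)
  ... | inj₁ (zero , refl)           | _ with () ← h
  ... | inj₁ (suc zero , refl)       | _             = ⊥-elim (ne (here refl))
  ... | inj₁ (suc (suc j) , refl)    | inj₂ (J , refl) = inj₂ (j ∷ J , refl)

  -- As `u` has no leg of length one, the base case is pure with a surplus of at most one, and all
  -- further legs of `u` can be put in as zigzags.
  twoLegs : ∀ U {y₁ y₂ κ} → 3 ≤ length U → All (1 ≤_) U → All (1 ≤_) (y₁ ∷ y₂ ∷ []) → 1 ≤ κ →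
            1 ∉ U → 1 ∈ y₁ ∷ y₂ ∷ [] → Strong U (y₁ ∷ y₂ ∷ []) κ 1
  twoLegs (x₁ ∷ x₂ ∷ x₃ ∷ []) h (a ∷ b ∷ c ∷ []) (d ∷ e ∷ []) hκ ne one
    with r , f ← base₃₂ a b c d e hκ (there (there (there one))) =
    r , proj₁ (f ne) , ≤-trans (proj₂ (f ne)) (≤-reflexive (+-comm 1 _))
  twoLegs (x₁ ∷ x₂ ∷ x₃ ∷ x₄ ∷ U) h (a ∷ as) hV hκ ne one =
    addLeg (twoLegs (x₂ ∷ x₃ ∷ x₄ ∷ U) (s≤s (s≤s (s≤s z≤n))) as hV hκ (ne ∘ there) one) x₁ a
  twoLegs (x₁ ∷ x₂ ∷ []) (s≤s (s≤s ()))
  twoLegs (x₁ ∷ []) (s≤s ())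

  Legs : List ℕ → Set
  Legs = All (1 ≤_)

  private
    size : List ℕ → List ℕ → ℕ
    size U V = sum U + sum V

    size-u : ∀ {x U U′ V n} → 1 ≤ x → U ↭ x ∷ U′ → size U V ≤ suc n → size U′ V ≤ n
    size-u {x} {U} {U′} {V} hx p h = ≤-pred (≤-trans (+-monoˡ-≤ (sum V) (≤-trans (+-monoˡ-≤ (sum U′) hx) (≤-reflexive (sym (sum-↭ p))))) h)

    size-v : ∀ {y U V V′ n} → 1 ≤ y → V ↭ y ∷ V′ → size U V ≤ suc n → size U V′ ≤ n
    size-v {y} {U} {V} {V′} hy p h = ≤-pred (≤-trans (≤-trans (≤-reflexive (sym (+-suc (sum U) (sum V′))))
      (+-monoʳ-≤ (sum U) (≤-trans (+-monoˡ-≤ (sum V′) hy) (≤-reflexive (sym (sum-↭ p)))))) h)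

    sum-suc : ∀ U → sum (map suc U) ≡ length U + sum U
    sum-suc []      = refl
    sum-suc (x ∷ U) = trans (cong (suc x +_) (sum-suc U)) (lem x (length U) (sum U))
      where
      lem : ∀ x a b → suc x + (a + b) ≡ suc a + (x + b)
      lem = solve-∀

    size-suc : ∀ {U V n} → 1 ≤ length U → size (map suc U) (map suc V) ≤ suc n → size U V ≤ n
    size-suc {U} {V} h p = ≤-pred (≤-trans (+-mono-≤ (≤-trans (+-monoˡ-≤ (sum U) h) (≤-reflexive (sym (sum-suc U))))
      (≤-trans (m≤n+m (sum V) (length V)) (≤-reflexive (sym (sum-suc V))))) p)

    pulled : ∀ {x : ℕ} {U U′} → U ↭ x ∷ U′ → suc (length U′) ≡ length U
    pulled p = sym (↭-length p)

    step< : ∀ {a b c d} → suc a ≡ c → suc b ≡ d → c < d → a < b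
    step< refl refl (s≤s h) = h

    suc≤ : ∀ {a c k} → suc a ≡ c → suc k ≤ c → k ≤ a
    suc≤ refl (s≤s h) = h

  -- The legs to be removed are located by membership, so the recursion runs on a bound `n` for the
  -- total length instead of the structure of the lists.
  unequal : ∀ n {U V κ} → size U V ≤ n → Legs U → Legs V → 1 ≤ κ → 2 ≤ length V → length V < length U → Result U V κ
  unequal zero {U = x ∷ U} h (s≤s z≤n ∷ _) with () ← h
  unequal (suc n) {U} {V} h hU hV hκ 2≤V V<U with 1 ∈? U
  ... | no 1∉U with 1 ∈? V
  ...   | no 1∉V with U′ , refl , hU′ ← noOnes hU 1∉U with V′ , refl , hV′ ← noOnes hV 1∉V =
    Extend.extend-result (result-raw V<U′ (unequal n (size-suc {U′} {V′} (≤-trans (s≤s z≤n) V<U′) h) hU′ hV′ hκ 2≤V′ V<U′))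
      (≤-trans (s≤s 2≤V′) (≤-trans V<U′ (m≤m+n _ _))) (≤-trans (s≤s z≤n) 2≤V′) (<⇒≤ V<U′) V<U′ 2≤V′
    where
    V<U′ = subst₂ _<_ (length-map suc V′) (length-map suc U′) V<U
    2≤V′ = subst (2 ≤_) (length-map suc V′) 2≤V
  unequal (suc n) {U} {y₁ ∷ y₂ ∷ []} h hU hV hκ 2≤V V<U | no 1∉U | yes 1∈V = proj₁ (twoLegs U V<U hU hV hκ 1∉U 1∈V)
  unequal (suc n) {U} {V@(y₁ ∷ y₂ ∷ y₃ ∷ _)} h hU hV hκ 2≤V V<U | no 1∉U | yes 1∈V with V′ , p ← pull 1∈V =
    -- A leg of length one is the odd leg with parameter 0; purity of the remainder comes from
    -- `1 ∉ U`.
    Result-resp ↭-refl (↭-sym p) (addVodd r 0 (Result.pure r (inj₁ 1∉U)) (subst (_< length U) (↭-length p) V<U))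
    where
    r = unequal n (size-v {U = U} ≤-refl p h) hU (All.tail (All-resp-↭ p hV)) hκ (suc≤ (pulled p) (s≤s (s≤s (s≤s z≤n))))
          (<-trans (n<1+n _) (subst (_< length U) (↭-length p) V<U))
  unequal (suc n) {V = []} h hU hV hκ () V<U | no 1∉U | yes 1∈V
  unequal (suc n) {V = _ ∷ []} h hU hV hκ (s≤s ()) V<U | no 1∉U | yes 1∈V
  unequal (suc n) {x₁ ∷ x₂ ∷ x₃ ∷ []} {y₁ ∷ y₂ ∷ []} h (a ∷ b ∷ c ∷ []) (d ∷ e ∷ []) hκ 2≤V V<U | yes 1∈U =
    proj₁ (base₃₂ a b c d e hκ (Any-++ˡ 1∈U))
    where
    Any-++ˡ : ∀ {x : ℕ} {as bs} → x ∈ as → x ∈ as ++ bs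
    Any-++ˡ (here e)  = here e
    Any-++ˡ (there i) = there (Any-++ˡ i)
  unequal (suc n) {U@(_ ∷ _ ∷ _ ∷ _ ∷ _)} {V@(_ ∷ _ ∷ [])} h hU hV hκ 2≤V V<U | yes 1∈U with U′ , p ← pull 1∈U =
    Result-resp (↭-sym p) ↭-refl (addU1 (unequal n (size-u {V = V} ≤-refl p h) (All.tail (All-resp-↭ p hU)) hV hκ 2≤V
      (suc≤ (pulled p) (s≤s (s≤s (s≤s (s≤s z≤n)))))))
  unequal (suc n) {U} {V@(_ ∷ _ ∷ _ ∷ _)} h hU hV hκ 2≤V V<U | yes 1∈U with 2 ∈? V
  ... | yes 2∈V with U′ , p ← pull 1∈U with V′ , q ← pull 2∈V =
    Result-resp (↭-sym p) (↭-sym q) (addD (unequal n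
      (size-v {U = U′} (s≤s z≤n) q (m≤n⇒m≤1+n (size-u {V = V} ≤-refl p h)))
      (All.tail (All-resp-↭ p hU)) (All.tail (All-resp-↭ q hV)) hκ (suc≤ (pulled q) (s≤s (s≤s (s≤s z≤n)))) (step< (pulled q) (pulled p) V<U)))
  ... | no 2∉V with evenOrOdd hV 2∉V
  ...   | inj₂ (J , eJ) = subst (λ V → Result U V _) (sym eJ) (allEven J hU hκ
            (subst (3 ≤_) lJ (s≤s (s≤s (s≤s z≤n)))) (subst (_< length U) lJ V<U))
    where
    lJ : length V ≡ length J
    lJ = trans (cong length eJ) (length-map vLen J)
  ...   | inj₁ (j , j∈V) with V′ , q ← pull j∈V =
    -- Now `u` has a leg of length one, so purity of the remainder has to come from the absence of
    -- legs of `v` of length two.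
    Result-resp ↭-refl (↭-sym q) (addVodd r j (Result.pure r (inj₂ λ i → 2∉V (∈-resp-↭ (↭-sym q) (there i)))) (subst (_< length U) (↭-length q) V<U))
    where
    r = unequal n (size-v {U = U} (s≤s z≤n) q h) hU (All.tail (All-resp-↭ q hV)) hκ (suc≤ (pulled q) (s≤s (s≤s (s≤s z≤n))))
          (<-trans (n<1+n _) (subst (_< length U) (↭-length q) V<U))
  unequal (suc n) {V = []} h hU hV hκ () V<U | yes 1∈U
  unequal (suc n) {V = _ ∷ []} h hU hV hκ (s≤s ()) V<U | yes 1∈U
  unequal (suc n) {_ ∷ _ ∷ []} {_ ∷ _ ∷ []} h hU hV hκ _ (s≤s (s≤s ())) | yes 1∈U
  unequal (suc n) {_ ∷ []} {_ ∷ _ ∷ []} h hU hV hκ _ (s≤s ()) | yes 1∈U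

  -- Without a leg of `v` of length one the degrees are unequal, and that case is solved; the
  -- removed edge gets the label 1 in the end. Two legs at each hub are left to the second table.
  equal₁ : ∀ {U V κ} → Legs U → Legs V → 1 ≤ κ → 2 ≤ length V → length V ≡ length U → 1 ∈ V → Raw U V κ
  equal₁ {x₁ ∷ x₂ ∷ []} {y₁ ∷ y₂ ∷ []} (a ∷ b ∷ []) (c ∷ d ∷ []) hκ 2≤V e 1∈V = base₂₂ a b c d hκ (there (there 1∈V))
  equal₁ {U} {V@(_ ∷ _ ∷ _ ∷ _)} hU hV hκ 2≤V e 1∈V with V′ , p ← pull 1∈V =
    Raw-resp ↭-refl (↭-sym p) (addV1-raw (unequal _ ≤-refl hU (All.tail (All-resp-↭ p hV)) hκ (suc≤ (pulled p) (s≤s (s≤s (s≤s z≤n))))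
      (≤-reflexive (trans (pulled p) e))) (trans (pulled p) e))
  equal₁ {V = _ ∷ []} hU hV hκ (s≤s ())

  equal : ∀ n {U V κ} → size U V ≤ n → Legs U → Legs V → 1 ≤ κ → 2 ≤ length V → length V ≡ length U → Raw U V κ
  equal zero {U = x ∷ U} h (s≤s z≤n ∷ _) with () ← h
  equal zero {[]} {[]} h hU hV hκ ()
  equal (suc n) {U} {V} h hU hV hκ 2≤V e with 1 ∈? V | 1 ∈? U
  ... | yes 1∈V | _       = equal₁ hU hV hκ 2≤V e 1∈V
  ... | no _    | yes 1∈U = raw-swap e (equal₁ hV hU hκ (subst (2 ≤_) e 2≤V) (sym e) 1∈U)
  ... | no 1∉V  | no 1∉U with U′ , refl , hU′ ← noOnes hU 1∉U with V′ , refl , hV′ ← noOnes hV 1∉V =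
    Extend.extend-raw (equal n (size-suc {U′} {V′} (subst (1 ≤_) e′ (≤-trans (s≤s z≤n) 2≤V′)) h) hU′ hV′ hκ 2≤V′ e′)
      (≤-trans (+-mono-≤ (s≤s {0} z≤n) 2≤V′) (+-monoˡ-≤ (length V′) (subst (1 ≤_) e′ (≤-trans (s≤s z≤n) 2≤V′)))) (≤-trans (s≤s z≤n) 2≤V′) (≤-reflexive e′) e′
    where
    e′ = trans (sym (length-map suc V′)) (trans e (length-map suc U′))
    2≤V′ = subst (2 ≤_) (length-map suc V′) 2≤V

  labelling : ∀ {U V κ} → Legs U → Legs V → 1 ≤ κ → 2 ≤ length V → length V ≤ length U → Raw U V κ
  labelling hU hV hκ 2≤V h with m≤n⇒m<n∨m≡n h
  ... | inj₁ l = result-raw l (unequal _ ≤-refl hU hV hκ 2≤V l)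
  ... | inj₂ e = equal _ ≤-refl hU hV hκ 2≤V e

-- Incidence lists and uniqueness of paths in an acyclic graph.

module Trees where

  open import Data.Fin using (Fin; zero; suc; inject₁; fromℕ; _≟_)
  open import Data.Fin.Properties using (injective⇒≤)
  open import Data.List using (filter; allFin; lookup; _ʳ++_; tabulate)
  open import Data.Nat.ListAction using (sum)
  open import Data.List.Membership.Propositional.Properties using (∈-∃++; ∈-filter⁺; ∈-filter⁻; ∈-allFin)
  open import Data.List.Relation.Unary.All.Properties using (¬Any⇒All¬)
  open import Data.List.Relation.Unary.Unique.Propositional using (Unique)
  open import Data.List.Relation.Unary.Unique.Propositional.Properties as Uₚ using (allFin⁺)
  open import Data.List.Relation.Binary.Permutation.Propositional.Properties using (++↭ʳ++)
  open import Data.Unit using (⊤)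
  open import Function using (id)
  open import Function.Definitions using (Injective)
  open import Relation.Nullary using (Dec; yes; no; ¬_)
  open import Relation.Binary.PropositionalEquality using (_≡_; _≢_; refl; sym; trans; cong; cong₂)
  open import Defs
  open Extension using (AllPairs-resp-↭; AllPairs-++⁻)

  lookup-injective : ∀ {A : Set} {xs : List A} → Unique xs → Injective _≡_ _≡_ (lookup xs)
  lookup-injective                (a ∷ u) {zero}  {zero}  e = refl
  lookup-injective {xs = x ∷ xs} (a ∷ u) {zero}  {suc j} e = ⊥-elim (All.lookup a (Mem j) e)
    where
    Mem : ∀ {xs : List _} j → lookup xs j ∈ xs
    Mem {x ∷ xs} zero    = here refl
    Mem {x ∷ xs} (suc j) = there (Mem j)
  lookup-injective {xs = x ∷ xs} (a ∷ u) {suc i} {zero}  e = sym (lookup-injective (a ∷ u) {zero} {suc i} (sym e))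
  lookup-injective                (a ∷ u) {suc i} {suc j} e = cong suc (lookup-injective u e)

  unique-length : ∀ {k} {xs : List (Fin k)} → Unique xs → length xs ≤ k
  unique-length u = injective⇒≤ (lookup-injective u)

  unique-resp : ∀ {A : Set} {xs ys : List A} → xs ↭ ys → Unique xs → Unique ys
  unique-resp = AllPairs-resp-↭ (_∘ sym)

  module Incidence (G : Graph) where

    V E : Set
    V = Fin (n G)
    E = Fin (m G)

    inc : V → List E
    inc x = filter (incident? G x) (allFin (m G))

    inc-unique : ∀ x → Unique (inc x)
    inc-unique x = Uₚ.filter⁺ (incident? G x) (allFin⁺ (m G))

    ∈-inc⁺ : ∀ {x e} → Incident G x e → e ∈ inc x
    ∈-inc⁺ {x} = ∈-filter⁺ (incident? G x) (∈-allFin _)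

    ∈-inc⁻ : ∀ {x e} → e ∈ inc x → Incident G x e
    ∈-inc⁻ {x} i = proj₂ (∈-filter⁻ (incident? G x) {xs = allFin (m G)} i)

    private
      choose : ∀ {P : Set} → Dec P → ℕ → ℕ
      choose (yes _) k = k
      choose (no _)  _ = 0

      -- The summand of incSum, a definition local to Defs.
      summand : ∀ w x → Σ (E → ℕ) λ F → incSum G w x ≡ sumFin (m G) F
      summand w x = _ , refl

      summand≡ : ∀ w x e → proj₁ (summand w x) e ≡ choose (incident? G x e) (w e)
      summand≡ w x e with incident? G x e
      ... | yes _ = refl
      ... | no _  = refl

      sumFin-filter : ∀ {A : Set} {P : A → Set} (P? : ∀ a → Dec (P a)) (w : A → ℕ) k (g : Fin k → A) (F : Fin k → ℕ) →
        (∀ i → F i ≡ choose (P? (g i)) (w (g i))) → sumFin k F ≡ sum (map w (filter P? (tabulate g)))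
      sumFin-filter P? w zero    g F h = refl
      sumFin-filter P? w (suc k) g F h with P? (g zero) | h zero
      ... | yes _ | e = cong₂ _+_ e (sumFin-filter P? w k (g ∘ suc) (F ∘ suc) (h ∘ suc))
      ... | no _  | e = trans (cong (_+ sumFin k (F ∘ suc)) e) (sumFin-filter P? w k (g ∘ suc) (F ∘ suc) (h ∘ suc))

    incSum≡ : ∀ w x → incSum G w x ≡ sum (map w (inc x))
    incSum≡ w x = sumFin-filter (incident? G x) w (m G) id (proj₁ (summand w x)) (summand≡ w x)

    degree≡ : ∀ x → degree G x ≡ length (inc x)
    degree≡ x = trans (incSum≡ (λ _ → 1) x) (ones (inc x))
      where
      ones : ∀ (xs : List E) → sum (map (λ _ → 1) xs) ≡ length xs
      ones []       = refl
      ones (_ ∷ xs) = cong suc (ones xs)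

    Joins : E → V → V → Set
    Joins e x y = ends G e ≡ (x , y) ⊎ ends G e ≡ (y , x)

    joins-sym : ∀ {e x y} → Joins e x y → Joins e y x
    joins-sym = Sum.swap

    joins-inc : ∀ {e x y} → Joins e x y → e ∈ inc x
    joins-inc (inj₁ p) = ∈-inc⁺ (inj₁ (cong proj₁ p))
    joins-inc (inj₂ p) = ∈-inc⁺ (inj₂ (cong proj₂ p))

    inc-joins : ∀ {e x} → e ∈ inc x → ∃ λ y → Joins e x y
    inc-joins {e} i with ∈-inc⁻ i
    ... | inj₁ refl = proj₂ (ends G e) , inj₁ refl
    ... | inj₂ refl = proj₁ (ends G e) , inj₂ refl

    joins-ends : ∀ {e x y z} → Joins e x y → e ∈ inc z → z ≡ x ⊎ z ≡ y
    joins-ends (inj₁ p) i with ∈-inc⁻ i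
    ... | inj₁ refl = inj₁ (cong proj₁ p)
    ... | inj₂ refl = inj₂ (cong proj₂ p)
    joins-ends (inj₂ p) i with ∈-inc⁻ i
    ... | inj₁ refl = inj₂ (cong proj₁ p)
    ... | inj₂ refl = inj₁ (cong proj₂ p)

  module Acyclic (G : Graph) (simple : IsSimple G) (acyclic : ¬ HasCycle G) where
    open Incidence G public

    joins-≢ : ∀ {e x y} → Joins e x y → x ≢ y
    joins-≢ {e} (inj₁ p) refl = proj₁ simple e (trans (cong proj₁ p) (sym (cong proj₂ p)))
    joins-≢ {e} (inj₂ p) refl = proj₁ simple e (trans (cong proj₁ p) (sym (cong proj₂ p)))

    joins-unique : ∀ {e e′ x y} → Joins e x y → Joins e′ x y → e ≡ e′
    joins-unique p q = proj₂ simple _ _ (go p q)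
      where
      go : ∀ {e e′ x y} → Joins e x y → Joins e′ x y →
           ends G e ≡ ends G e′ ⊎ ends G e ≡ (proj₂ (ends G e′) , proj₁ (ends G e′))
      go (inj₁ p) (inj₁ q) = inj₁ (trans p (sym q))
      go (inj₁ p) (inj₂ q) = inj₂ (trans p (sym (cong (λ z → proj₂ z , proj₁ z) q)))
      go (inj₂ p) (inj₁ q) = inj₂ (trans p (sym (cong (λ z → proj₂ z , proj₁ z) q)))
      go (inj₂ p) (inj₂ q) = inj₁ (trans p (sym q))

    Away : V → List V → Set
    Away x []      = ⊤
    Away x (y ∷ _) = x ≢ y

    -- Non-backtracking walks, listed from the last vertex to the first.
    data NB : List V → Set where
      [-] : ∀ {x} → NB (x ∷ [])
      _∷_ : ∀ {e x y l} → Joins e x y × Away x l → NB (y ∷ l) → NB (x ∷ y ∷ l)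

    nb-tail : ∀ {x y l} → NB (x ∷ y ∷ l) → NB (y ∷ l)
    nb-tail (_ ∷ p) = p

    private
      chain : ∀ x as {bs} → NB (x ∷ as ++ bs) → ∀ (i : Fin (length as)) → Adj G (lookup (x ∷ as) (inject₁ i)) (lookup (x ∷ as) (suc i))
      chain x (y ∷ as) (_∷_ {e} (j , _) p) zero    = e , j
      chain x (y ∷ as) (_ ∷ p)             (suc i) = chain y as p i

      close : ∀ x as {z bs} → NB (x ∷ as ++ z ∷ bs) → Adj G (lookup (x ∷ as) (fromℕ (length as))) z
      close x []       (_∷_ {e} (j , _) p) = e , j
      close x (y ∷ as) (_ ∷ p)             = close y as p

    -- If the new vertex `x` occurred before, it would not be the last vertex, as there are no
    -- loops, nor the one before it, by `Away`. Any other occurrence closes a cycle of at least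
    -- three vertices.
    nb-unique : ∀ {l} → NB l → Unique l
    nb-unique [-] = [] ∷ []
    nb-unique (_∷_ {x = x} {y} {l} (j , a) p) = ¬Any⇒All¬ _ (fresh (nb-unique p)) ∷ nb-unique p
      where
      fresh : Unique (y ∷ l) → x ∉ y ∷ l
      fresh u (here e)          = joins-≢ j e
      fresh u (there i) with ∈-∃++ i
      ... | []     , bs , refl = a refl
      -- The cycle consists of `x`, `y`, `z` and `as`, closed by the edge leading to the earlier
      -- occurrence of `x`; `HasCycle` counts the vertices beyond three.
      ... | z ∷ as , bs , refl = acyclic (length as , lookup (x ∷ y ∷ z ∷ as) , lookup-injective cyc ,
                                   chain x (y ∷ z ∷ as) ((j , a) ∷ p) , close x (y ∷ z ∷ as) ((j , a) ∷ p))
        where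
        parts : Unique (y ∷ z ∷ as) × Unique (x ∷ bs) × All (λ w → All (w ≢_) (x ∷ bs)) (y ∷ z ∷ as)
        parts = AllPairs-++⁻ (y ∷ z ∷ as) u
        cyc : Unique (x ∷ y ∷ z ∷ as)
        cyc = All.map (λ ne e → All.head ne (sym e)) (proj₂ (proj₂ parts)) ∷ proj₁ parts

    Apart : List V → List V → Set
    Apart []      _ = ⊤
    Apart (x ∷ _) r = Away x r

    -- The first walk is reversed onto the second at their common last vertex `a`. Only the turn at
    -- `a` could backtrack, and `Apart` rules this out.
    glue : ∀ l {a r} → NB (a ∷ l) → NB (a ∷ r) → Apart l r → NB (l ʳ++ a ∷ r)
    glue []          p             q d = q
    glue (x ∷ [])    ((j , _) ∷ p) q d = (joins-sym j , d) ∷ q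
    glue (x ∷ y ∷ l) ((j , a) ∷ p) q d = glue (y ∷ l) p ((joins-sym j , d) ∷ q) (a ∘ sym)

    module Rooted (u : V) where

      data Root : List V → Set where
        root : Root (u ∷ [])
        _∷_  : ∀ x {l} → Root l → Root (x ∷ l)

      root-∈ : ∀ {l} → Root l → u ∈ l
      root-∈ root    = here refl
      root-∈ (x ∷ r) = there (root-∈ r)

      Path : List V → Set
      Path p = NB p × Root p

      -- If two paths to `x` had different last steps, gluing them at `x` would give a
      -- non-backtracking walk that contains `u` twice.
      path-unique : ∀ {x l r} → Path (x ∷ l) → Path (x ∷ r) → l ≡ r
      path-unique {l = []}    {[]}    _       _       = refl
      path-unique {l = []}    {y ∷ r} (_ , root) (q , _ ∷ b) with nb-unique q
      ... | a ∷ _ = ⊥-elim (All.lookup a (root-∈ b) refl)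
      path-unique {l = y ∷ l} {[]}    (p , _ ∷ b) (_ , root) with nb-unique p
      ... | a ∷ _ = ⊥-elim (All.lookup a (root-∈ b) refl)
      path-unique {x} {y ∷ l} {z ∷ r} (p , _ ∷ a) (q , _ ∷ b) with y ≟ z
      ... | yes refl = cong (y ∷_) (path-unique (nb-tail p , a) (nb-tail q , b))
      ... | no y≢z   = ⊥-elim (All.lookup (All.lookup (proj₂ (proj₂ (AllPairs-++⁻ (y ∷ l)
            (unique-resp (↭-sym (++↭ʳ++ (y ∷ l) (x ∷ z ∷ r))) (nb-unique (glue (y ∷ l) p q y≢z)))))) (root-∈ a)) (there (root-∈ b)) refl)

-- Splitting the tree into a core and the legs of its two hubs.

module Decomposition where

  open import Data.Nat.Properties as ℕₚ using (≤-trans; ≤-reflexive; <⇒≱; +-suc; m≤n+m; n≮n)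
  open import Data.Fin using (Fin; zero; suc; _≟_)
  open import Data.List.Properties using (++-assoc; length-++; map-++; ∷-injectiveˡ; ∷-injectiveʳ)
  open import Data.List.Membership.Propositional.Properties using (∈-++⁺ʳ; ∈-++⁺ˡ; ∈-++⁻)
  open import Data.List.Relation.Unary.Unique.Propositional using (Unique)
  open import Data.Unit using (tt)
  open import Relation.Nullary using (yes; no; ¬_)
  open import Relation.Binary.PropositionalEquality using (_≡_; _≢_; refl; sym; trans; cong; cong₂; subst)
  open import Defs
  open Recursion using (pull)
  open Trees

  -- Paths are listed from their last vertex, so an initial segment of a path is a suffix of its
  -- list.
  Suf : ∀ {A : Set} → List A → List A → Set
  Suf l p = ∃ λ k → p ≡ k ++ l

  suf-refl : ∀ {A : Set} {l : List A} → Suf l l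
  suf-refl = [] , refl

  suf-trans : ∀ {A : Set} {l p q : List A} → Suf l p → Suf p q → Suf l q
  suf-trans {l = l} (k , refl) (k′ , refl) = k′ ++ k , sym (++-assoc k′ k l)

  suf-∷ : ∀ {A : Set} {x : A} {l p} → Suf (x ∷ l) p → Suf l p
  suf-∷ = suf-trans (_ ∷ [] , refl)

  suf-irrefl : ∀ {A : Set} {x : A} {l} → ¬ Suf (x ∷ l) l
  suf-irrefl {x = x} {l} (k , e) = n≮n (length l)
    (≤-trans (m≤n+m (suc (length l)) (length k)) (≤-reflexive (trans (sym (length-++ k)) (cong length (sym e)))))

  -- The two suffixes have the same length. This separates branches: a path that extends the first
  -- steps of two branches determines both.
  suf-head : ∀ {A : Set} {x y : A} {l p} → Suf (x ∷ l) p → Suf (y ∷ l) p → x ≡ y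
  suf-head ([]    , refl) ([]     , q) = ∷-injectiveˡ q
  suf-head ([]    , refl) (z ∷ k′ , q) = ⊥-elim (suf-irrefl (k′ , ∷-injectiveʳ q))
  suf-head (z ∷ k , refl) ([]     , q) = ⊥-elim (suf-irrefl (k , sym (∷-injectiveʳ q)))
  suf-head (z ∷ k , refl) (w ∷ k′ , q) = suf-head (k , refl) (k′ , ∷-injectiveʳ q)

  extractʳ : ∀ {A : Set} {P Q : A → Set} {xs} → All (λ x → P x ⊎ Q x) xs →
             All P xs ⊎ ∃₂ λ x rest → xs ↭ x ∷ rest × Q x × All (λ x → P x ⊎ Q x) rest
  extractʳ []                    = inj₁ []
  extractʳ {xs = x ∷ xs} (inj₂ q ∷ ps) = inj₂ (x , xs , ↭-refl , q , ps)
  extractʳ {xs = x ∷ xs} (inj₁ p ∷ ps) with extractʳ ps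
  ... | inj₁ qs                       = inj₁ (p ∷ qs)
  ... | inj₂ (y , rest , r , q , qs) = inj₂ (y , x ∷ rest , ↭-trans (prep x r) (swap x y ↭-refl) , q , inj₁ p ∷ qs)

  module Walks (G : Graph) (simple : IsSimple G) (acyclic : ¬ HasCycle G) (connected : Connected G)
               (u v : Fin (n G)) (u≢v : u ≢ v) (2<u : 2 < degree G u) (2<v : 2 < degree G v)
               (only : ∀ w → 2 < degree G w → w ≡ u ⊎ w ≡ v) where
    open Acyclic G simple acyclic public
    open Rooted u public

    -- Connectivity enters here, once to show that not all branches at `u` are legs and once to show
    -- that core and legs exhaust the tree.
    closed⇒all : ∀ {VS : List V} {ES : List E} → (∀ {x e} → x ∈ VS → e ∈ inc x → e ∈ ES) →
                 (∀ {e x} → e ∈ ES → e ∈ inc x → x ∈ VS) → u ∈ VS → ∀ x → x ∈ VS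
    closed⇒all {VS} f g i x = go i (connected u x)
      where
      go : ∀ {a b} → a ∈ VS → Reach G a b → b ∈ VS
      go i here             = i
      go i (step (e , j) r) = go (g (f i (joins-inc j)) (joins-inc (joins-sym j))) r

    -- The vertex x is reached by the edge e along the path x ∷ π from u.
    data Arr : List V → V → E → Set where
      arr : ∀ {e x y π} → Joins e y x → Path (x ∷ y ∷ π) → Arr (y ∷ π) x e

    path-tail : ∀ {x y l} → Path (x ∷ y ∷ l) → Path (y ∷ l)
    path-tail (_ ∷ p , _ ∷ r) = p , r

    arr-path : ∀ {π x e} → Arr π x e → Path (x ∷ π)
    arr-path (arr _ p) = p

    arr-inc : ∀ {π x e} → Arr π x e → e ∈ inc x
    arr-inc (arr j _) = joins-inc (joins-sym j)

    arr-fresh : ∀ {π x e} → Arr π x e → x ∉ π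
    arr-fresh (arr _ p) i with nb-unique (proj₁ p)
    ... | a ∷ _ = All.lookup a i refl

    arr-start : ∀ {e y} → Joins e u y → Arr (u ∷ []) y e
    arr-start j = arr j ((joins-sym j , tt) ∷ [-] , _ ∷ root)

    arr-next : ∀ {π x e e′ z} → Arr π x e → e′ ≢ e → Joins e′ x z → Arr (x ∷ π) z e′
    arr-next (arr j (p , r)) ne j′ =
      arr j′ ((joins-sym j′ , λ { refl → ne (joins-unique j′ (joins-sym j)) }) ∷ p , _ ∷ r)

    -- If an edge were entered from both of its ends, uniqueness of the path to the nearer end would
    -- force the other path to turn back along that edge.
    arr-same : ∀ {π π′ x x′ e} → Arr π x e → Arr π′ x′ e → x ∷ π ≡ x′ ∷ π′
    arr-same (arr {x = x} {y} j p) (arr j′ p′) with joins-ends j (joins-inc (joins-sym j′))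
    ... | inj₂ refl = cong (x ∷_) (path-unique p p′)
    ... | inj₁ refl with joins-ends j (joins-inc j′)
    ...   | inj₁ refl = ⊥-elim (joins-≢ j′ refl)
    ...   | inj₂ refl with refl ← path-unique (path-tail p) p′ with (_ , away) ∷ _ , _ ← p = ⊥-elim (away refl)

    inc-distinct : ∀ {x e e′ es} → inc x ↭ e ∷ es → e′ ∈ es → e′ ≢ e
    inc-distinct {x} p i with unique-resp p (inc-unique x)
    ... | a ∷ _ = λ e → All.lookup a i (sym e)

    -- A walk through vertices of degree two. The condition `End` is being a leaf for a leg and
    -- being `v` for the core, so both share one development.
    data Walk (End : V → E → Set) (π : List V) (x : V) (e : E) : Set where
      stop : End x e → Walk End π x e
      mid  : ∀ {e′ z} → inc x ↭ e ∷ e′ ∷ [] → Joins e′ x z → Walk End (x ∷ π) z e′ → Walk End π x e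

    arr-mid : ∀ {π x e e′ z} → Arr π x e → inc x ↭ e ∷ e′ ∷ [] → Joins e′ x z → Arr (x ∷ π) z e′
    arr-mid a p = arr-next a (inc-distinct p (here refl))

    -- An edge is kept with the vertex it reaches and the path before it: distinctness of edges is
    -- proved through distinctness of paths.
    Step : Set
    Step = E × V × List V

    path : Step → List V
    path (_ , x , π) = x ∷ π

    Good : Step → Set
    Good (e , x , π) = Arr π x e

    module _ {End : V → E → Set} where

      more : ∀ {π x e} → Walk End π x e → List E
      more (stop _)             = []
      more (mid {e′ = e′} _ _ w) = e′ ∷ more w

      edges : ∀ {π x e} → Walk End π x e → List E
      edges {e = e} w = e ∷ more w

      inits : ∀ {π x e} → Walk End π x e → List V
      inits (stop _)             = []
      inits {x = x} (mid _ _ w) = x ∷ inits w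

      fin : ∀ {π x e} → Walk End π x e → V
      fin {x = x} (stop _)    = x
      fin         (mid _ _ w) = fin w

      before : ∀ {π x e} → Walk End π x e → List V
      before {π} (stop _)    = π
      before     (mid _ _ w) = before w

      lastE : ∀ {π x e} → Walk End π x e → E
      lastE {e = e} (stop _)    = e
      lastE         (mid _ _ w) = lastE w

      steps : ∀ {π x e} → Walk End π x e → List Step
      steps {π} {x} {e} (stop _)    = (e , x , π) ∷ []
      steps {π} {x} {e} (mid _ _ w) = (e , x , π) ∷ steps w

      verts : ∀ {π x e} → Walk End π x e → List V
      verts w = inits w ++ fin w ∷ []

      steps-edges : ∀ {π x e} (w : Walk End π x e) → map proj₁ (steps w) ≡ edges w
      steps-edges         (stop _)    = refl
      steps-edges {e = e} (mid _ _ w) = cong (e ∷_) (steps-edges w)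

      steps-good : ∀ {π x e} → Arr π x e → (w : Walk End π x e) → All Good (steps w)
      steps-good a (stop _)    = a ∷ []
      steps-good a (mid p j w) = a ∷ steps-good (arr-mid a p j) w

      steps-suf : ∀ {π x e} (w : Walk End π x e) → All (λ s → Suf (x ∷ π) (path s)) (steps w)
      steps-suf (stop _)    = suf-refl ∷ []
      steps-suf (mid _ _ w) = suf-refl ∷ All.map suf-∷ (steps-suf w)

      steps-apart : ∀ {π x e} (w : Walk End π x e) → AllPairs (λ s t → path s ≢ path t) (steps w)
      steps-apart (stop _)    = [] ∷ []
      steps-apart (mid _ _ w) = All.map (λ h e → suf-irrefl (subst (Suf _) (sym e) h)) (steps-suf w) ∷ steps-apart w

      fin-suf : ∀ {π x e} (w : Walk End π x e) → Suf (x ∷ π) (fin w ∷ before w)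
      fin-suf (stop _)    = suf-refl
      fin-suf (mid _ _ w) = suf-∷ (fin-suf w)

      steps-below : ∀ {π x e} (w : Walk End π x e) → All (λ s → Suf (path s) (fin w ∷ before w)) (steps w)
      steps-below (stop _)      = suf-refl ∷ []
      steps-below w@(mid _ _ w′) = fin-suf w ∷ steps-below w′

      fin-arr : ∀ {π x e} → Arr π x e → (w : Walk End π x e) → Arr (before w) (fin w) (lastE w)
      fin-arr a (stop _)    = a
      fin-arr a (mid p j w) = fin-arr (arr-mid a p j) w

      fin-end : ∀ {π x e} (w : Walk End π x e) → End (fin w) (lastE w)
      fin-end (stop p)    = p
      fin-end (mid _ _ w) = fin-end w

      lastE-∈ : ∀ {π x e} (w : Walk End π x e) → lastE w ∈ edges w
      lastE-∈ (stop _)    = here refl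
      lastE-∈ (mid _ _ w) = there (lastE-∈ w)

      inits-inc : ∀ {π x e} (w : Walk End π x e) {y e′} → y ∈ inits w → e′ ∈ inc y → e′ ∈ edges w
      inits-inc (mid p _ w) (here refl) i with ∈-resp-↭ p i
      ... | here refl         = here refl
      ... | there (here refl) = there (here refl)
      inits-inc (mid p _ w) (there k) i = there (inits-inc w k i)

      inits-deg : ∀ {π x e} (w : Walk End π x e) {y} → y ∈ inits w → length (inc y) ≡ 2
      inits-deg (mid p _ w) (here refl) = ↭-length p
      inits-deg (mid p _ w) (there k)   = inits-deg w k

      edges-ends : ∀ {y π x e} → Arr (y ∷ π) x e → (w : Walk End (y ∷ π) x e) → ∀ {e′ z} → e′ ∈ edges w → e′ ∈ inc z → z ∈ y ∷ verts w
      edges-ends (arr j _) (stop _) (here refl) i with joins-ends j i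
      ... | inj₁ refl = here refl
      ... | inj₂ refl = there (here refl)
      edges-ends (arr j _) (mid _ _ _) (here refl) i with joins-ends j i
      ... | inj₁ refl = here refl
      ... | inj₂ refl = there (here refl)
      edges-ends a (mid p j w) (there k) i = there (edges-ends (arr-mid a p j) w k i)

    Leaf : V → E → Set
    Leaf x e = inc x ↭ e ∷ []

    Leg Core : List V → V → E → Set
    Leg  = Walk Leaf
    Core = Walk (λ x _ → x ≡ v)

    leg-inc : ∀ {π x e} (w : Leg π x e) {y e′} → y ∈ verts w → e′ ∈ inc y → e′ ∈ edges w
    leg-inc w k i with ∈-++⁻ (inits w) k
    ... | inj₁ k′          = inits-inc w k′ i
    ... | inj₂ (here refl) with ∈-resp-↭ (fin-end w) i
    ...   | here refl = lastE-∈ w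

    -- This shows that no branch at `v` away from the core leads back to `v`, hence that all of them
    -- are legs.
    core-fresh : ∀ {π x e} → Arr π x e → Core π x e → v ∉ π
    core-fresh a (stop refl) i = arr-fresh a i
    core-fresh a (mid p j w) i = core-fresh (arr-mid a p j) w (there i)

    -- Walks cannot go on for ever, as their vertices are distinct.
    explore : ∀ k {π x e} → Arr π x e → n G < k + length (x ∷ π) → Leg π x e ⊎ Core π x e
    explore zero    a h = ⊥-elim (<⇒≱ h (unique-length (nb-unique (proj₁ (arr-path a)))))
    explore (suc k) {π} {x} {e} a h with x ≟ v | x ≟ u
    ... | yes p | _        = inj₂ (stop p)
    ... | no _  | yes refl = ⊥-elim (arr-fresh a (from a))
      where
      from : ∀ {π x e} → Arr π x e → u ∈ π
      from (arr _ (_ , _ ∷ r)) = root-∈ r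
    ... | no x≢v | no x≢u with pull (arr-inc a)
    ...   | [] , p = inj₁ (stop p)
    ...   | e′ ∷ [] , p with z , j ← inc-joins (∈-resp-↭ (↭-sym p) (there (here refl))) =
      Sum.map (mid p j) (mid p j) (explore k (arr-mid a p j) (subst (n G <_) (sym (+-suc k (length (x ∷ π)))) h))
    ...   | _ ∷ _ ∷ _ , p with only x (subst (2 <_) (sym (trans (degree≡ x) (↭-length p))) (s≤s (s≤s (s≤s z≤n))))
    ...     | inj₁ q = ⊥-elim (x≢u q)
    ...     | inj₂ q = ⊥-elim (x≢v q)

    LegAt CoreAt : List V → E → Set
    LegAt  π e = ∃ λ x → Arr π x e × Leg π x e
    CoreAt π e = ∃ λ x → Arr π x e × Core π x e

    explore-at : ∀ {π x e} → Arr π x e → LegAt π e ⊎ CoreAt π e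
    explore-at {π} {x} a = Sum.map (λ w → x , a , w) (λ w → x , a , w)
      -- Fuel `n G` suffices, as the path explored so far already contains a vertex.
      (explore (n G) a (≤-trans (≤-reflexive (sym (ℕₚ.+-comm (n G) 1))) (ℕₚ.+-monoʳ-≤ (n G) (s≤s z≤n))))

    gather : ∀ {B : Set} {π es} → (∀ {e} → LegAt π e → List B) → All (LegAt π) es → List B
    gather f []       = []
    gather f (l ∷ ls) = f l ++ gather f ls

    legEdges : ∀ {π e} → LegAt π e → List E
    legEdges (_ , _ , w) = edges w

    legSteps : ∀ {π e} → LegAt π e → List Step
    legSteps (_ , _ , w) = steps w

    legInits legFin legVerts : ∀ {π e} → LegAt π e → List V
    legInits (_ , _ , w) = inits w
    legFin   (_ , _ , w) = fin w ∷ []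
    legVerts (_ , _ , w) = verts w

    module _ {π : List V} where

      legs-first : ∀ {es} (ls : All (LegAt π) es) {e} → e ∈ es → e ∈ gather legEdges ls
      legs-first (l ∷ ls) (here refl) = here refl
      legs-first (l ∷ ls) (there i)   = ∈-++⁺ʳ (legEdges l) (legs-first ls i)

      legs-inc : ∀ {es} (ls : All (LegAt π) es) {y e} → y ∈ gather legVerts ls → e ∈ inc y → e ∈ gather legEdges ls
      legs-inc ((_ , _ , w) ∷ ls) k i with ∈-++⁻ (verts w) k
      ... | inj₁ k′ = ∈-++⁺ˡ (leg-inc w k′ i)
      ... | inj₂ k′ = ∈-++⁺ʳ (edges w) (legs-inc ls k′ i)

      legs-steps : ∀ {es} (ls : All (LegAt π) es) → map proj₁ (gather legSteps ls) ≡ gather legEdges ls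
      legs-steps []                 = refl
      legs-steps ((_ , _ , w) ∷ ls) = trans (map-++ proj₁ (steps w) _) (cong₂ _++_ (steps-edges w) (legs-steps ls))

      legs-good : ∀ {es} (ls : All (LegAt π) es) → All Good (gather legSteps ls)
      legs-good []                 = []
      legs-good ((_ , a , w) ∷ ls) = Allₚ.++⁺ (steps-good a w) (legs-good ls)

      legs-deg : ∀ {es} (ls : All (LegAt π) es) {y} → y ∈ gather legVerts ls → length (inc y) ≤ 2
      legs-deg ((_ , _ , w) ∷ ls) k with ∈-++⁻ (verts w) k
      ... | inj₂ k′ = legs-deg ls k′
      ... | inj₁ k′ with ∈-++⁻ (inits w) k′
      ...   | inj₁ k″ = ≤-reflexive (inits-deg w k″)
      ...   | inj₂ (here refl) = ≤-trans (≤-reflexive (↭-length (fin-end w))) (s≤s z≤n)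

      legs-verts : ∀ {es} (ls : All (LegAt π) es) → gather legVerts ls ↭ gather legInits ls ++ gather legFin ls
      legs-verts []                 = ↭-refl
      legs-verts ((_ , _ , w) ∷ ls) = ↭-trans (Perm.++⁺ˡ (verts w) (legs-verts ls))
        (↭-trans (↭-reflexive (++-assoc (inits w) (fin w ∷ []) _))
        (↭-trans (Perm.++⁺ˡ (inits w) (Perm.shifts (fin w ∷ []) (gather legInits ls)))
                 (↭-reflexive (sym (++-assoc (inits w) (gather legInits ls) _)))))

      -- The path of each step of a leg extends the first step of that leg, so legs with different
      -- first edges share no path.
      From : List E → Step → Set
      From es s = ∃₂ λ y e → e ∈ es × Arr π y e × Suf (y ∷ π) (path s)

      legs-from : ∀ {es} (ls : All (LegAt π) es) → All (From es) (gather legSteps ls)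
      legs-from []                               = []
      legs-from ((x , a , w) ∷ ls) = Allₚ.++⁺ (All.map (λ h → x , _ , here refl , a , h) (steps-suf w))
        (All.map (λ { (y , e , i , a , h) → y , e , there i , a , h }) (legs-from ls))

      arr-first : ∀ {x e e′} → Arr π x e → Arr π x e′ → e ≡ e′
      arr-first (arr j _) (arr j′ _) = joins-unique j j′

      from-apart : ∀ {es x e s} → Arr π x e → e ∉ es → Suf (x ∷ π) (path s) → ∀ {t} → From es t → path s ≢ path t
      from-apart a ne h (y , e , i , a′ , h′) q with refl ← suf-head h (subst (Suf _) (sym q) h′) =
        ne (subst (_∈ _) (sym (arr-first a a′)) i)

      legs-apart : ∀ {es} → Unique es → (ls : All (LegAt π) es) → AllPairs (λ s t → path s ≢ path t) (gather legSteps ls)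
      legs-apart []       []                 = []
      legs-apart (ne ∷ u) ((x , a , w) ∷ ls) = APₚ.++⁺ (steps-apart w) (legs-apart u ls)
        (All.map (λ {s} h → All.map (λ {t} → from-apart {s = s} a (λ i → All.lookup ne i refl) h {t}) (legs-from ls)) (steps-suf w))

    legs-ends : ∀ {y π es} (ls : All (LegAt (y ∷ π)) es) {e z} → e ∈ gather legEdges ls → e ∈ inc z → z ∈ y ∷ gather legVerts ls
    legs-ends ((_ , a , w) ∷ ls) k i with ∈-++⁻ (edges w) k
    ... | inj₁ k′ = ∈-++⁺ˡ {ys = gather legVerts ls} (edges-ends a w k′ i)
    ... | inj₂ k′ with legs-ends ls k′ i
    ...   | here q  = here q
    ...   | there q = there (∈-++⁺ʳ (verts w) q)

    record Spider : Set where
      field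
        {ec}  : E
        {esU} : List E
        incU  : inc u ↭ ec ∷ esU
        {xc}  : V
        arrC  : Arr (u ∷ []) xc ec
        core  : Core (u ∷ []) xc ec
        legsU : All (LegAt (u ∷ [])) esU
        {esV} : List E
        incV  : inc v ↭ lastE core ∷ esV
        legsV : All (LegAt (v ∷ before core)) esV

      ES : List E
      ES = edges core ++ gather legEdges legsU ++ gather legEdges legsV

      inner : List V
      inner = inits core ++ gather legInits legsU ++ gather legInits legsV

      leaves : List V
      leaves = gather legFin legsU ++ gather legFin legsV

      VS : List V
      VS = u ∷ v ∷ inner ++ leaves

    private
      core-path : ∀ {e e′} ((x , a , w) : CoreAt (u ∷ []) e) ((x′ , a′ , w′) : CoreAt (u ∷ []) e′) → fin w ∷ before w ≡ fin w′ ∷ before w′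
      core-path (x , a , w) (x′ , a′ , w′) = go (fin-end w) (fin-end w′) (arr-path (fin-arr a w)) (arr-path (fin-arr a′ w′))
        where
        go : ∀ {x l y r} → x ≡ v → y ≡ v → Path (x ∷ l) → Path (y ∷ r) → x ∷ l ≡ y ∷ r
        go refl refl p q = cong (v ∷_) (path-unique p q)

      -- Two cores are paths from `u` to `v`, hence equal, and so are their first edges.
      core-unique : ∀ {e e′} → CoreAt (u ∷ []) e → CoreAt (u ∷ []) e′ → e ≡ e′
      core-unique c@(x , a , w) c′@(x′ , a′ , w′)
        with refl ← suf-head {x = x} {x′} (fin-suf w) (subst (Suf _) (sym (core-path c c′)) (fin-suf w′)) = arr-first a a′

      branches : All (λ e → LegAt (u ∷ []) e ⊎ CoreAt (u ∷ []) e) (inc u)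
      branches = All.tabulate λ i → explore-at (arr-start (proj₂ (inc-joins i)))

      -- Otherwise `u` and its legs would be closed under incidence and form the whole tree, in
      -- which only `u` could have degree above two.
      not-all : ¬ All (LegAt (u ∷ [])) (inc u)
      not-all ls with closed⇒all {u ∷ gather legVerts ls} {gather legEdges ls}
                        (λ { (here refl) i → legs-first ls i ; (there k) i → legs-inc ls k i }) (legs-ends ls) (here refl) v
      ... | here e  = u≢v (sym e)
      ... | there i = <⇒≱ (subst (2 <_) (degree≡ v) 2<v) (legs-deg ls i)

      onlyLegs : ∀ {π es} → All (λ e → LegAt π e ⊎ CoreAt π e) es → (∀ {e} → e ∈ es → ¬ CoreAt π e) → All (LegAt π) es
      onlyLegs []            no′ = []
      onlyLegs (inj₁ l ∷ ls) no′ = l ∷ onlyLegs ls (no′ ∘ there)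
      onlyLegs (inj₂ c ∷ ls) no′ = ⊥-elim (no′ (here refl) c)

    spider : Spider
    spider with extractʳ branches
    ... | inj₁ ls = ⊥-elim (not-all ls)
    ... | inj₂ (ec , esU , p , (xc , a , w) , bs) = atV (fin-end w) (fin-arr a w)
      where
      legsU = onlyLegs bs (λ i c → inc-distinct p i (core-unique c (xc , a , w)))
      atV : fin w ≡ v → Arr (before w) (fin w) (lastE w) → Spider
      atV e b with esV , q ← pull (arr-inc (subst (λ x → Arr (before w) x (lastE w)) e b)) = record
        { incU = p ; arrC = a ; core = w ; legsU = legsU ; incV = q
        ; legsV = onlyLegs (All.tabulate λ i → explore-at (next i))
                    (λ i (x , a′ , c) → core-fresh a′ c (here refl)) }
        where
        next : ∀ {e} (i : e ∈ esV) → Arr (v ∷ before w) (proj₁ (inc-joins (∈-resp-↭ (↭-sym q) (there i)))) e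
        next i = arr-next (subst (λ x → Arr (before w) x (lastE w)) e b) (inc-distinct q i) (proj₂ (inc-joins (∈-resp-↭ (↭-sym q) (there i))))

    module SpiderProps (sp : Spider) where
      open Spider sp

      private
        fin≡v : fin core ≡ v
        fin≡v = fin-end core

        vs : ∀ {x} → x ∈ u ∷ v ∷ (inits core ++ gather legVerts legsU ++ gather legVerts legsV) → x ∈ VS
        vs = ∈-resp-↭ (prep u (prep v (↭-trans (Perm.++⁺ˡ (inits core) (↭-trans (Perm.++⁺ (legs-verts legsU) (legs-verts legsV))
          (inter (gather legInits legsU) (gather legFin legsU) (gather legInits legsV) (gather legFin legsV))))
          (↭-reflexive (sym (++-assoc (inits core) _ _))))))
          where
          inter : ∀ (as bs cs ds : List V) → (as ++ bs) ++ cs ++ ds ↭ (as ++ cs) ++ bs ++ ds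
          inter as bs cs ds = ↭-trans (↭-reflexive (++-assoc as bs (cs ++ ds)))
            (↭-trans (Perm.++⁺ˡ as (Perm.shifts bs cs)) (↭-reflexive (sym (++-assoc as cs (bs ++ ds)))))

        inc⊆ : ∀ {x e} → x ∈ u ∷ v ∷ (inits core ++ gather legVerts legsU ++ gather legVerts legsV) → e ∈ inc x → e ∈ ES
        inc⊆ (here refl) i with ∈-resp-↭ incU i
        ... | here refl = here refl
        ... | there k   = ∈-++⁺ʳ (edges core) (∈-++⁺ˡ (legs-first legsU k))
        inc⊆ (there (here refl)) i with ∈-resp-↭ incV i
        ... | here refl = ∈-++⁺ˡ (lastE-∈ core)
        ... | there k   = ∈-++⁺ʳ (edges core) (∈-++⁺ʳ (gather legEdges legsU) (legs-first legsV k))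
        inc⊆ (there (there k)) i with ∈-++⁻ (inits core) k
        ... | inj₁ k′ = ∈-++⁺ˡ (inits-inc core k′ i)
        ... | inj₂ k′ with ∈-++⁻ (gather legVerts legsU) k′
        ...   | inj₁ k″ = ∈-++⁺ʳ (edges core) (∈-++⁺ˡ (legs-inc legsU k″ i))
        ...   | inj₂ k″ = ∈-++⁺ʳ (edges core) (∈-++⁺ʳ (gather legEdges legsU) (legs-inc legsV k″ i))

        ends⊆ : ∀ {e x} → e ∈ ES → e ∈ inc x → x ∈ u ∷ v ∷ (inits core ++ gather legVerts legsU ++ gather legVerts legsV)
        ends⊆ k i with ∈-++⁻ (edges core) k
        ... | inj₂ k′ with ∈-++⁻ (gather legEdges legsU) k′
        ...   | inj₁ k″ with legs-ends legsU k″ i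
        ...     | here q  = here q
        ...     | there q = there (there (∈-++⁺ʳ (inits core) (∈-++⁺ˡ q)))
        ends⊆ k i | inj₂ k′ | inj₂ k″ with legs-ends legsV k″ i
        ...     | here q  = there (here q)
        ...     | there q = there (there (∈-++⁺ʳ (inits core) (∈-++⁺ʳ (gather legVerts legsU) q)))
        ends⊆ k i | inj₁ k′ with edges-ends arrC core k′ i
        ... | here q  = here q
        ... | there q with ∈-++⁻ (inits core) q
        ...   | inj₁ q′        = there (there (∈-++⁺ˡ q′))
        ...   | inj₂ (here q′) = there (here (trans q′ fin≡v))

        coverV : ∀ x → x ∈ u ∷ v ∷ (inits core ++ gather legVerts legsU ++ gather legVerts legsV)
        coverV = closed⇒all inc⊆ ends⊆ (here refl)

      all-vertices : ∀ x → x ∈ VS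
      all-vertices x = vs (coverV x)

      all-edges : ∀ e → e ∈ ES
      all-edges e = inc⊆ (coverV (proj₁ (ends G e))) (∈-inc⁺ (inj₁ refl))

      private
        allSteps : List Step
        allSteps = steps core ++ gather legSteps legsU ++ gather legSteps legsV

        steps≡ : map proj₁ allSteps ≡ ES
        steps≡ = trans (map-++ proj₁ (steps core) _) (cong₂ _++_ (steps-edges core)
          (trans (map-++ proj₁ (gather legSteps legsU) _) (cong₂ _++_ (legs-steps legsU) (legs-steps legsV))))

        -- The paths of the steps at the legs of `v` properly extend the whole core. This separates
        -- them from the core itself and from the legs of `u`, which leave the core at its first
        -- edge.
        beyond : All (λ t → ∃ λ y → Suf (y ∷ fin core ∷ before core) (path t)) (gather legSteps legsV)
        beyond = All.map (λ { (y , _ , _ , _ , h) → y , subst (λ z → Suf (y ∷ z ∷ before core) _) (sym fin≡v) h }) (legs-from legsV)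

        uniqueU : Unique (ec ∷ esU)
        uniqueU = unique-resp incU (inc-unique u)

        apart : AllPairs (λ s t → path s ≢ path t) allSteps
        apart = APₚ.++⁺ (steps-apart core) (APₚ.++⁺ (legs-apart (AllPairs.tail uniqueU) legsU) (legs-apart (AllPairs.tail (unique-resp incV (inc-unique v))) legsV)
            (All.map (λ {s} f → All.map (λ {t} (y , h) e → from-apart {s = t} arrC ec∉ (suf-trans (fin-suf core) (suf-∷ h)) {s} f (sym e)) beyond) (legs-from legsU)))
          (All.zipWith (λ {s} (h , b) → Allₚ.++⁺ (All.map (λ {t} → from-apart {s = s} arrC ec∉ h {t}) (legs-from legsU))
              (All.map (λ {t} (y , h′) e → suf-irrefl (suf-trans (subst (Suf _) (sym e) h′) b)) beyond)) (steps-suf core , steps-below core))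
          where
          ec∉ : ec ∉ esU
          ec∉ i with uniqueU
          ... | a ∷ _ = All.lookup a i refl

        good : All Good allSteps
        good = Allₚ.++⁺ (steps-good arrC core) (Allₚ.++⁺ (legs-good legsU) (legs-good legsV))

      -- By `arr-same` an edge determines the path that ends with it, so steps with distinct paths
      -- have distinct edges.
      edges-unique : Unique ES
      edges-unique = subst Unique steps≡ (APₚ.map⁺ (go good apart))
        where
        go : ∀ {ss} → All Good ss → AllPairs (λ s t → path s ≢ path t) ss → AllPairs (λ s t → proj₁ s ≢ proj₁ t) ss
        go []       []       = []
        go (g ∷ gs) (a ∷ as) = All.zipWith (λ { (g′ , ne) refl → ne (arr-same g g′) }) (gs , a) ∷ go gs as

-- Transfer of the labelling from lists to the graph.

module Antimagic where

  open import Data.Nat using (_∸_)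
  open import Data.Nat.Properties as ℕₚ using (≤-refl; ≤-trans; ≤-reflexive; <-irrefl; <⇒≱; +-comm; +-assoc; +-identityʳ; ≤-total; <⇒≤; <-cmp; suc-injective)
  open import Data.Fin using (Fin; suc; _≟_; toℕ; fromℕ<; punchOut)
  open import Data.Fin.Properties using (injective⇒≤; toℕ-fromℕ<; punchOut-injective; any?)
  open import Data.List using (concat; reverse; _ʳ++_)
  open import Data.List.Properties using (length-++; map-++; length-map; map-∘; map-cong; ∷-injectiveˡ; ∷-injectiveʳ; ++-identityʳ; length-reverse; concat-map; map-id; concatMap-map; concatMap-++)
  open import Data.Nat.ListAction using (sum)
  open import Data.Nat.ListAction.Properties using (sum-↭)
  open import Data.List.Relation.Unary.Unique.Propositional using (Unique)
  open import Data.List.Relation.Binary.Permutation.Propositional using (refl; trans)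
  open import Data.List.Relation.Binary.Permutation.Propositional.Properties using (↭-map-inv; ↭-reverse)
  open import Function.Bundles using (_⤖_; mk⤖)
  open import Function.Definitions using (Injective)
  open import Relation.Binary.Definitions using (Symmetric; tri<; tri≈; tri>)
  open import Relation.Nullary using (yes; no; ¬_)
  open import Relation.Binary.PropositionalEquality as ≡ using (_≡_; _≢_; cong; cong₂; subst; subst₂)
  open import Defs hiding (ends)
  open Labellings
  open Insertion
  open Extension
  open Recursion
  open Trees
  open Decomposition

  -- The order of the vertex sums, for the lists of the edge labels, of the sums at the vertices of
  -- degree two, of the pendant labels and of the labels at the two hubs.
  record Order (ls is es hu hv : List Lab) : Set where
    field
      diff  : AllPairs Differ ls
      range : All (λ x → 1 ≤ val x × val x ≤ length ls) ls
      innD  : AllPairs Differ is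
      endD  : AllPairs Differ es
      low   : All (λ w → All (λ e → val e < val w) es) is
      inU   : All (λ w → val w < val (total hu)) is
      inV   : All (λ w → val w < val (total hv)) is
      endU  : All (λ e → val e < val (total hu)) es
      endV  : All (λ e → val e < val (total hv)) es
      hubs  : (length hv < length hu × val (total hv) < val (total hu)) ⊎
              (length hv ≡ length hu × val (total hv) ≢ val (total hu))

  raw-order : ∀ {U V κ} (r : Raw U V κ) → let cfg = Raw.cfg r in Order (labels cfg) (inner cfg) (ends cfg) (hubU cfg) (hubV cfg)
  raw-order r = record
    { diff = diff ; range = range ; innD = innD ; endD = ends-diff pieces diff ; low = low ; inU = inU ; inV = inV
    ; endU = endU ; endV = endV
    ; hubs = Sum.map (λ (a , b) → subst₂ _<_ (≡.sym nV) (≡.sym nU) (s≤s a) , b)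
                     (λ (a , b) → ≡.trans nV (≡.trans (cong suc a) (≡.sym nU)) , b) hubs }
    where open Raw r

  ⊕-comm : ∀ x y → x ⊕ y ≡ y ⊕ x
  ⊕-comm ⟨ a , b , c ⟩ ⟨ d , e , f ⟩ rewrite +-comm a d | +-comm b e | +-comm c f = ≡.refl

  ⊕-swap : ∀ x y z → x ⊕ (y ⊕ z) ≡ y ⊕ (x ⊕ z)
  ⊕-swap ⟨ a , b , c ⟩ ⟨ d , e , f ⟩ ⟨ g , h , i ⟩ = cong₂ (λ p (q , r) → ⟨ p , q , r ⟩) (lem a d g) (cong₂ _,_ (lem b e h) (lem c f i))
    where
    lem : ∀ x y z → x + (y + z) ≡ y + (x + z)
    lem x y z = ≡.trans (≡.sym (+-assoc x y z)) (≡.trans (cong (_+ z) (+-comm x y)) (+-assoc y x z))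

  total-↭ : ∀ {xs ys} → xs ↭ ys → total xs ≡ total ys
  total-↭ refl         = ≡.refl
  total-↭ (prep x p)   = cong (x ⊕_) (total-↭ p)
  total-↭ (swap x y p) = ≡.trans (cong (λ t → x ⊕ (y ⊕ t)) (total-↭ p)) (⊕-swap x y _)
  total-↭ (trans p q)  = ≡.trans (total-↭ p) (total-↭ q)

  Differ-sym : Symmetric Differ
  Differ-sym ne = ne ∘ ≡.sym

  order-resp : ∀ {ls ls′ is is′ es es′ hu hu′ hv hv′} → ls ↭ ls′ → is ↭ is′ → es ↭ es′ → hu ↭ hu′ → hv ↭ hv′ →
               Order ls is es hu hv → Order ls′ is′ es′ hu′ hv′
  order-resp pl pi pe pu pv o = record
    { diff = AllPairs-resp-↭ (λ {x} {y} → Differ-sym {x} {y}) pl diff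
    ; range = All-resp-↭ pl (subst (λ k → All (λ x → 1 ≤ val x × val x ≤ k) _) (↭-length pl) range)
    ; innD = AllPairs-resp-↭ (λ {x} {y} → Differ-sym {x} {y}) pi innD
    ; endD = AllPairs-resp-↭ (λ {x} {y} → Differ-sym {x} {y}) pe endD
    ; low = All-resp-↭ pi (All.map (All-resp-↭ pe) low)
    ; inU = All-resp-↭ pi (subst (λ t → All (λ w → val w < val t) _) (total-↭ pu) inU)
    ; inV = All-resp-↭ pi (subst (λ t → All (λ w → val w < val t) _) (total-↭ pv) inV)
    ; endU = All-resp-↭ pe (subst (λ t → All (λ w → val w < val t) _) (total-↭ pu) endU)
    ; endV = All-resp-↭ pe (subst (λ t → All (λ w → val w < val t) _) (total-↭ pv) endV)
    ; hubs = Sum.map (λ (a , b) → subst₂ _<_ (↭-length pv) (↭-length pu) a , subst₂ (λ x y → val x < val y) (total-↭ pv) (total-↭ pu) b)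
                     (λ (a , b) → subst₂ _≡_ (↭-length pv) (↭-length pu) a , subst₂ (λ x y → val x ≢ val y) (total-↭ pv) (total-↭ pu) b) hubs }
    where open Order o

  hd-ʳ++ : ∀ x xs ys → hd ((x ∷ xs) ʳ++ ys) ≡ lst (x ∷ xs)
  hd-ʳ++ x []       ys = ≡.refl
  hd-ʳ++ x (y ∷ xs) ys = hd-ʳ++ y xs (x ∷ ys)

  lst-ʳ++ : ∀ xs y ys → lst (xs ʳ++ y ∷ ys) ≡ lst (y ∷ ys)
  lst-ʳ++ []       y ys = ≡.refl
  lst-ʳ++ (x ∷ xs) y ys = lst-ʳ++ xs x (y ∷ ys)

  sums-ʳ++ : ∀ x xs y ys → sums ((x ∷ xs) ʳ++ y ∷ ys) ↭ sums (x ∷ xs) ++ x ⊕ y ∷ sums (y ∷ ys)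
  sums-ʳ++ x []       y ys = ↭-refl
  sums-ʳ++ x (z ∷ xs) y ys = ↭-trans (sums-ʳ++ z xs x (y ∷ ys))
    (↭-trans (Perm.shift (z ⊕ x) (sums (z ∷ xs)) _) (↭-reflexive (cong (_∷ sums (z ∷ xs) ++ x ⊕ y ∷ sums (y ∷ ys)) (⊕-comm z x))))

  sums-reverse : ∀ xs → sums (reverse xs) ↭ sums xs
  sums-reverse []           = ↭-refl
  sums-reverse (x ∷ [])     = ↭-refl
  sums-reverse (x ∷ y ∷ xs) = ↭-trans (sums-ʳ++ y xs x [])
    (↭-trans (Perm.++-comm (sums (y ∷ xs)) _) (↭-reflexive (cong (_∷ sums (y ∷ xs)) (⊕-comm y x))))

  concatMap-↭ : ∀ {A B : Set} (f : A → List B) {xs ys} → xs ↭ ys → concatMap f xs ↭ concatMap f ys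
  concatMap-↭ f refl         = ↭-refl
  concatMap-↭ f (prep x p)   = Perm.++⁺ˡ (f x) (concatMap-↭ f p)
  concatMap-↭ f (swap x y p) = ↭-trans (Perm.++⁺ˡ (f x) (Perm.++⁺ˡ (f y) (concatMap-↭ f p))) (Perm.shifts (f x) (f y))
  concatMap-↭ f (trans p q)  = ↭-trans (concatMap-↭ f p) (concatMap-↭ f q)

  module _ (c : List Lab) (XU XV : List (List Lab)) where
    labelsOf innerOf endsOf hubOfU hubOfV : List Lab
    labelsOf = c ++ concat XU ++ concat XV
    innerOf  = sums c ++ concatMap sums XU ++ concatMap sums XV
    endsOf   = map lst XU ++ map lst XV
    hubOfU   = hd c ∷ map hd XU
    hubOfV   = lst c ∷ map hd XV

  -- The lists appear in the order in which the tree was decomposed, with the core running from `u`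
  -- to `v`, so labels can be assigned to edges by position.
  record Canonical (U V : List ℕ) (κ : ℕ) : Set where
    field
      c     : List Lab
      XU XV : List (List Lab)
      lenC  : length c ≡ κ
      lenU  : map length XU ≡ U
      lenV  : map length XV ≡ V
      order : Order (labelsOf c XU XV) (innerOf c XU XV) (endsOf c XU XV) (hubOfU c XU XV) (hubOfV c XU XV)

  private
    legs : List (List Lab) → List (List Lab) → Config
    legs XU XV = map (uK ,_) XU ++ map (vK ,_) XV

    legs-inv : ∀ U V cfg → map (uT ,_) U ++ map (vT ,_) V ≡ shape cfg →
               ∃₂ λ XU XV → cfg ≡ legs XU XV × map length XU ≡ U × map length XV ≡ V
    legs-inv []      []      []               e = [] , [] , ≡.refl , ≡.refl , ≡.refl
    legs-inv []      (y ∷ V) ((vK , xs) ∷ cfg) e with legs-inv [] V cfg (∷-injectiveʳ e)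
    ... | []     , XV , ≡.refl , _ , q = [] , xs ∷ XV , ≡.refl , ≡.refl , cong₂ _∷_ (≡.sym (cong proj₂ (∷-injectiveˡ e))) q
    legs-inv (x ∷ U) V       ((uK , xs) ∷ cfg) e with legs-inv U V cfg (∷-injectiveʳ e)
    ... | XU , XV , ≡.refl , p , q = xs ∷ XU , XV , ≡.refl , cong₂ _∷_ (≡.sym (cong proj₂ (∷-injectiveˡ e))) p , q

    concatMap-legs : ∀ {B : Set} (f : Piece → List B) XU XV →
      concatMap f (legs XU XV) ≡ concatMap (λ xs → f (uK , xs)) XU ++ concatMap (λ xs → f (vK , xs)) XV
    concatMap-legs f XU XV = ≡.trans (concatMap-++ f (map (uK ,_) XU) _) (cong₂ _++_ (concatMap-map f (uK ,_) XU) (concatMap-map f (vK ,_) XV))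

    single : ∀ {A B : Set} (f : A → B) xs → concatMap (λ x → f x ∷ []) xs ≡ map f xs
    single f []       = ≡.refl
    single f (x ∷ xs) = cong (f x ∷_) (single f xs)

    none : ∀ {A B : Set} (xs : List A) → concatMap {B = B} (λ _ → []) xs ≡ []
    none []       = ≡.refl
    none (x ∷ xs) = none xs

    labels-legs : ∀ XU XV → labels (legs XU XV) ≡ concat XU ++ concat XV
    labels-legs XU XV = ≡.trans (concatMap-legs proj₂ XU XV) (cong₂ (λ a b → concat a ++ concat b) (map-id XU) (map-id XV))

    ends-legs : ∀ XU XV → ends (legs XU XV) ≡ map lst XU ++ map lst XV
    ends-legs XU XV = ≡.trans (concatMap-legs end-of XU XV) (cong₂ _++_ (single lst XU) (single lst XV))

    hubU-legs : ∀ XU XV → hubU (legs XU XV) ≡ map hd XU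
    hubU-legs XU XV = ≡.trans (concatMap-legs atU XU XV) (≡.trans (cong₂ _++_ (single hd XU) (none XV)) (++-identityʳ _))

    hubV-legs : ∀ XU XV → hubV (legs XU XV) ≡ map hd XV
    hubV-legs XU XV = ≡.trans (concatMap-legs atV XU XV) (cong₂ _++_ (none XU) (single hd XV))

  canonical : ∀ {U V κ} → 1 ≤ κ → Raw U V κ → Canonical U V κ
  canonical {U} {V} {κ} 1≤κ r = go (↭-map-inv (λ p → tag (proj₁ p) , length (proj₂ p)) shp)
    where
    open Raw r using (cfg; shp)
    o = raw-order r
    go : (∃ λ cfg′ → spider U V κ ≡ shape cfg′ × cfg ↭ cfg′) → Canonical U V κ
    go ((cK , xs) ∷ cfg′ , e , p) with legs-inv U V cfg′ (∷-injectiveʳ e)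
    ... | XU , XV , ≡.refl , lu , lv′ = record
      { c = xs ; XU = XU ; XV = XV ; lenC = ≡.sym (cong proj₂ (∷-injectiveˡ e)) ; lenU = lu ; lenV = lv′
      ; order = order-resp
          (↭-trans (concatMap-↭ proj₂ p) (↭-reflexive (cong (xs ++_) (labels-legs XU XV))))
          (↭-trans (concatMap-↭ (λ q → sums (proj₂ q)) p) (↭-reflexive (cong (sums xs ++_) (concatMap-legs (λ q → sums (proj₂ q)) XU XV))))
          (↭-trans (concatMap-↭ end-of p) (↭-reflexive (ends-legs XU XV)))
          (↭-trans (concatMap-↭ atU p) (↭-reflexive (cong (hd xs ∷_) (hubU-legs XU XV))))
          (↭-trans (concatMap-↭ atV p) (↭-reflexive (cong (lst xs ∷_) (hubV-legs XU XV)))) o }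
    -- A core listed from `v` is reversed: its two end labels change places, and its inner sums are
    -- merely permuted.
    go ((rK , xs@(y ∷ ys)) ∷ cfg′ , e , p) with legs-inv U V cfg′ (∷-injectiveʳ e)
    ... | XU , XV , ≡.refl , lu , lv′ = record
      { c = reverse xs ; XU = XU ; XV = XV ; lenC = ≡.trans (length-reverse xs) (≡.sym (cong proj₂ (∷-injectiveˡ e))) ; lenU = lu ; lenV = lv′
      ; order = order-resp
          (↭-trans (concatMap-↭ proj₂ p) (Perm.++⁺ (↭-sym (↭-reverse xs)) (↭-reflexive (labels-legs XU XV))))
          (↭-trans (concatMap-↭ (λ q → sums (proj₂ q)) p) (Perm.++⁺ (↭-sym (sums-reverse xs)) (↭-reflexive (concatMap-legs (λ q → sums (proj₂ q)) XU XV))))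
          (↭-trans (concatMap-↭ end-of p) (↭-reflexive (ends-legs XU XV)))
          (↭-trans (concatMap-↭ atU p) (↭-reflexive (cong₂ _∷_ (≡.sym (hd-ʳ++ y ys [])) (hubU-legs XU XV))))
          (↭-trans (concatMap-↭ atV p) (↭-reflexive (cong₂ _∷_ (≡.sym (lst-ʳ++ ys y [])) (hubV-legs XU XV)))) o }
    go ((rK , []) ∷ cfg′ , e , p) = ⊥-elim (<-irrefl ≡.refl (subst (1 ≤_) (cong proj₂ (∷-injectiveˡ e)) 1≤κ))

  assign : ∀ {k} {B : Set} (es : List (Fin k)) (ls : List B) → B → Unique es → length es ≡ length ls → ∃ λ (A : Fin k → B) → map A es ≡ ls
  assign []       []       d u        e = (λ _ → d) , ≡.refl
  assign {k} {B} (x ∷ es) (l ∷ ls) d (ne ∷ u) e with A , p ← assign es ls d u (suc-injective e) = A′ , cong₂ _∷_ here′ (≡.trans (old ne) p)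
    where
    A′ : Fin k → B
    A′ y with x ≟ y
    ... | yes _ = l
    ... | no _  = A y
    here′ : A′ x ≡ l
    here′ with x ≟ x
    ... | yes _ = ≡.refl
    ... | no q  = ⊥-elim (q ≡.refl)
    old : ∀ {es} → All (x ≢_) es → map A′ es ≡ map A es
    old []                   = ≡.refl
    old {y ∷ es} (q ∷ qs) with x ≟ y
    ... | yes p = ⊥-elim (q p)
    ... | no _  = cong (A y ∷_) (old qs)

  ++-split : ∀ {A : Set} (as as′ : List A) {bs bs′} → length as ≡ length as′ → as ++ bs ≡ as′ ++ bs′ → as ≡ as′ × bs ≡ bs′
  ++-split []       []         l e = ≡.refl , e
  ++-split (x ∷ as) (y ∷ as′) l e with p , q ← ++-split as as′ (suc-injective l) (∷-injectiveʳ e) = cong₂ _∷_ (∷-injectiveˡ e) p , q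

  concat-split : ∀ {A : Set} (as as′ : List (List A)) → map length as ≡ map length as′ → concat as ≡ concat as′ → as ≡ as′
  concat-split []       []         l e = ≡.refl
  concat-split (x ∷ as) (y ∷ as′) l e with p , q ← ++-split x y (∷-injectiveˡ l) e = cong₂ _∷_ p (concat-split as as′ (∷-injectiveʳ l) q)

  length-concat : ∀ {A : Set} (as : List (List A)) → length (concat as) ≡ sum (map length as)
  length-concat []       = ≡.refl
  length-concat (x ∷ as) = ≡.trans (length-++ x) (cong (length x +_) (length-concat as))

  AllPairs-∈ : ∀ {A B : Set} {R : B → B → Set} (f : A → B) → Symmetric R → ∀ {xs} → AllPairs R (map f xs) → ∀ {x y} → x ∈ xs → y ∈ xs → x ≢ y → R (f x) (f y)
  AllPairs-∈ f s (a ∷ as) (here ≡.refl) (here ≡.refl) ne = ⊥-elim (ne ≡.refl)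
  AllPairs-∈ f s (a ∷ as) (here ≡.refl) (there j)     ne = All.lookup (Allₚ.map⁻ a) j
  AllPairs-∈ f s (a ∷ as) (there i)     (here ≡.refl) ne = s (All.lookup (Allₚ.map⁻ a) i)
  AllPairs-∈ f s (a ∷ as) (there i)     (there j)     ne = AllPairs-∈ f s as i j ne

  -- A missed value could be punched out, which would give an injection into a smaller finite set.
  injective⇒surjective : ∀ {k} (f : Fin k → Fin k) → Injective _≡_ _≡_ f → ∀ y → ∃ λ x → f x ≡ y
  injective⇒surjective {suc k} f inj y with any? (λ x → f x ≟ y)
  ... | yes p = p
  ... | no ne = ⊥-elim (<-irrefl ≡.refl (injective⇒≤ {f = λ x → punchOut {i = y} {f x} (λ e → ne (x , ≡.sym e))}
          (λ {a} {b} e → inj (punchOut-injective (λ q → ne (a , ≡.sym q)) (λ q → ne (b , ≡.sym q)) e))))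

  -- One symmetric relation covers both requirements of a strongly antimagic labelling: distinct
  -- sums, and degrees that never run against the order of the sums.
  Ordered : ℕ × ℕ → ℕ × ℕ → Set
  Ordered (d , s) (d′ , s′) = (s < s′ × d ≤ d′) ⊎ (s′ < s × d′ ≤ d)

  ordered-sym : Symmetric Ordered
  ordered-sym = Sum.swap

  module Transfer (G : Graph) (simple : IsSimple G) (acyclic : ¬ HasCycle G) (connected : Connected G)
           (u v : Fin (n G)) (u≢v : u ≢ v) (2<u : 2 < degree G u) (2<v : 2 < degree G v)
           (only : ∀ w → 2 < degree G w → w ≡ u ⊎ w ≡ v) (v≤u : degree G v ≤ degree G u) where

    open Walks G simple acyclic connected u v u≢v 2<u 2<v only using
      (V; E; inc; incSum≡; degree≡; Walk; edges; more; inits; fin; lastE; mid; stop; LegAt; Leg; fin-end; gather; legEdges; legInits; legFin; Spider; module SpiderProps)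
      renaming (spider to theSpider)

    lists : ∀ {π es} → All (LegAt π) es → List (List E)
    lists = gather (λ l → legEdges l ∷ [])

    concat-lists : ∀ {π es} (ls : All (LegAt π) es) → concat (lists ls) ≡ gather legEdges ls
    concat-lists []       = ≡.refl
    concat-lists (l ∷ ls) = cong (legEdges l ++_) (concat-lists ls)

    length-lists : ∀ {π es} (ls : All (LegAt π) es) → length (lists ls) ≡ length es
    length-lists []       = ≡.refl
    length-lists (l ∷ ls) = cong suc (length-lists ls)

    lists-legs : ∀ {π es} (ls : All (LegAt π) es) → Legs (map length (lists ls))
    lists-legs []                 = []
    lists-legs ((_ , _ , w) ∷ ls) = s≤s z≤n ∷ lists-legs ls

    module _ (sp : Spider) where
      open Spider sp using (ES; VS; incU; incV; core; legsU; legsV; esU; esV; ec) renaming (inner to innerV; leaves to leavesV)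
      open SpiderProps sp

      EU EV : List (List E)
      EU = lists legsU
      EV = lists legsV

      degU : degree G u ≡ suc (length esU)
      degU = ≡.trans (degree≡ u) (↭-length incU)

      degV : degree G v ≡ suc (length esV)
      degV = ≡.trans (degree≡ v) (↭-length incV)

      lenU : length (map length EU) ≡ length esU
      lenU = ≡.trans (length-map length EU) (length-lists legsU)

      lenV : length (map length EV) ≡ length esV
      lenV = ≡.trans (length-map length EV) (length-lists legsV)

      Labels : Set
      Labels = Canonical (map length EU) (map length EV) (length (edges core))

      can : Labels
      can = canonical (s≤s z≤n) (labelling (lists-legs legsU) (lists-legs legsV) (s≤s z≤n)
        (subst (2 ≤_) (≡.sym lenV) (ℕₚ.≤-pred (subst (2 <_) degV 2<v)))
        (subst₂ _≤_ (≡.sym lenV) (≡.sym lenU) (ℕₚ.≤-pred (subst₂ _≤_ degV degU v≤u))))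

      module _ (can : Labels) where
        module C = Canonical can

        ES≡ : ES ≡ edges core ++ concat EU ++ concat EV
        ES≡ = cong (edges core ++_) (≡.sym (cong₂ _++_ (concat-lists legsU) (concat-lists legsV)))

        assigned : ∃ λ (A : E → Lab) → map A ES ≡ labelsOf C.c C.XU C.XV
        assigned = assign ES _ (S 0) edges-unique (≡.trans (cong length ES≡) (≡.trans (len (edges core) EU EV)
          (≡.trans (cong₂ _+_ (≡.sym C.lenC) (cong₂ _+_ (cong sum (≡.sym C.lenU)) (cong sum (≡.sym C.lenV)))) (≡.sym (len C.c C.XU C.XV)))))
          where
          len : ∀ {A : Set} (c : List A) XU XV → length (c ++ concat XU ++ concat XV) ≡ length c + (sum (map length XU) + sum (map length XV))
          len c XU XV = ≡.trans (length-++ c) (cong (length c +_) (≡.trans (length-++ (concat XU)) (cong₂ _+_ (length-concat XU) (length-concat XV))))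

        module _ (A : E → Lab) (eqA : map A ES ≡ labelsOf C.c C.XU C.XV) where

          parts : map A (edges core) ≡ C.c × map (map A) EU ≡ C.XU × map (map A) EV ≡ C.XV
          parts = p₁ , concat-split _ _ (≡.trans (lens EU) (≡.sym C.lenU)) (≡.trans (concat-map EU) (proj₁ p₂)) ,
                       concat-split _ _ (≡.trans (lens EV) (≡.sym C.lenV)) (≡.trans (concat-map EV) (proj₂ p₂))
            where
            lens : ∀ (xs : List (List E)) → map length (map (map A) xs) ≡ map length xs
            lens xs = ≡.trans (≡.sym (map-∘ xs)) (map-cong (length-map A) xs)
            whole : map A (edges core) ++ map A (concat EU) ++ map A (concat EV) ≡ labelsOf C.c C.XU C.XV
            whole = ≡.trans (≡.sym (≡.trans (cong (map A) ES≡) (≡.trans (map-++ A (edges core) _) (cong (map A (edges core) ++_) (map-++ A (concat EU) _))))) eqA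
            s₁ = ++-split (map A (edges core)) C.c (≡.trans (length-map A (edges core)) (≡.sym C.lenC)) whole
            p₁ = proj₁ s₁
            p₂ = ++-split (map A (concat EU)) (concat C.XU) (≡.trans (length-map A (concat EU)) (≡.trans (length-concat EU)
                   (≡.trans (cong sum (≡.sym C.lenU)) (≡.sym (length-concat C.XU))))) (proj₂ s₁)

          IS LS HU HV : List Lab
          IS = innerOf C.c C.XU C.XV
          LS = endsOf C.c C.XU C.XV
          HU = hubOfU C.c C.XU C.XV
          HV = hubOfV C.c C.XU C.XV

          ord : Order (map A ES) IS LS HU HV
          ord = subst (λ ls → Order ls IS LS HU HV) (≡.sym eqA) C.order

          open Order ord

          label : E → ℕ
          label e = val (A e)

          label-range : ∀ e → 1 ≤ label e × label e ≤ m G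
          label-range e with p , q ← All.lookup (Allₚ.map⁻ range) (all-edges e) =
            -- Labels are bounded by the number of listed edges, and as these are distinct there are
            -- at most `m G` of them.
            p , ≤-trans q (≤-trans (≤-reflexive (length-map A ES)) (unique-length edges-unique))

          below : ∀ e → label e ∸ 1 < m G
          below e with label e | label-range e
          ... | suc k | _ , h = h

          to : E → E
          to e = fromℕ< (below e)

          label≡ : ∀ e → suc (toℕ (to e)) ≡ label e
          label≡ e = ≡.trans (cong suc (toℕ-fromℕ< (below e))) (ℕₚ.m+[n∸m]≡n (proj₁ (label-range e)))

          to-injective : Injective _≡_ _≡_ to
          to-injective {x} {y} e with x ≟ y
          ... | yes p = p
          ... | no ne = ⊥-elim (AllPairs-∈ A (λ {x} {y} → Differ-sym {x} {y}) diff (all-edges x) (all-edges y) ne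
                  (≡.trans (≡.sym (label≡ x)) (≡.trans (cong (suc ∘ toℕ) e) (label≡ y))))

          f : E ⤖ E
          f = mk⤖ (to-injective , λ y → proj₁ (injective⇒surjective to to-injective y) , λ { ≡.refl → proj₂ (injective⇒surjective to to-injective y) })

          entry : V → ℕ × ℕ
          entry x = degree G x , vertexSum G f x

          entry-inc : ∀ {x es} → inc x ↭ es → entry x ≡ (length (map A es) , val (total (map A es)))
          entry-inc {x} {es} p = cong₂ _,_ (≡.trans (degree≡ x) (≡.trans (↭-length p) (≡.sym (length-map A es))))
            (≡.trans (incSum≡ (labelOf G f) x) (≡.trans (sum-↭ (Perm.map⁺ (labelOf G f) p)) (go es)))
            where
            go : ∀ es → sum (map (labelOf G f) es) ≡ val (total (map A es))
            go []       = ≡.refl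
            go (e ∷ es) = cong₂ _+_ (label≡ e) (go es)

          inits-entries : ∀ {End π x e} (w : Walk End π x e) → map entry (inits w) ≡ map (λ l → 2 , val l) (sums (map A (edges w)))
          inits-entries (stop _)                  = ≡.refl
          inits-entries {e = e} (mid {e′} p _ w) = cong₂ _∷_
            (≡.trans (entry-inc p) (cong (λ k → 2 , label e + k) (+-identityʳ (label e′)))) (inits-entries w)

          lst-edges : ∀ {End π x e} (w : Walk End π x e) → lst (map A (edges w)) ≡ A (lastE w)
          lst-edges (stop _)    = ≡.refl
          lst-edges (mid _ _ w) = lst-edges w

          legs-inits : ∀ {π es} (ls : All (LegAt π) es) → map entry (gather legInits ls) ≡ map (λ l → 2 , val l) (concatMap sums (map (map A) (lists ls)))
          legs-inits []                 = ≡.refl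
          legs-inits ((_ , _ , w) ∷ ls) = ≡.trans (map-++ entry (inits w) _) (≡.trans (cong₂ _++_ (inits-entries w) (legs-inits ls)) (≡.sym (map-++ _ (sums (map A (edges w))) _)))

          legs-fin : ∀ {π es} (ls : All (LegAt π) es) → map entry (gather legFin ls) ≡ map (λ l → 1 , val l) (map lst (map (map A) (lists ls)))
          legs-fin []                 = ≡.refl
          legs-fin ((_ , _ , w) ∷ ls) = cong₂ _∷_
            (≡.trans (entry-inc (fin-end w)) (cong (1 ,_) (≡.trans (+-identityʳ _) (cong val (≡.sym (lst-edges w)))))) (legs-fin ls)

          legs-hub : ∀ {π es} (ls : All (LegAt π) es) → map hd (map (map A) (lists ls)) ≡ map A es
          legs-hub []       = ≡.refl
          legs-hub (l ∷ ls) = cong (_ ∷_) (legs-hub ls)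

          entries : map entry VS ≡ (length HU , val (total HU)) ∷ (length HV , val (total HV)) ∷ map (λ l → 2 , val l) IS ++ map (λ l → 1 , val l) LS
          entries = cong₂ _∷_ (≡.trans (entry-inc incU) (cong (λ h → length h , val (total h)) eHU))
            (cong₂ _∷_ (≡.trans (entry-inc incV) (cong (λ h → length h , val (total h)) eHV))
            (≡.trans (map-++ entry innerV leavesV) (cong₂ _++_ eIS eLS)))
            where
            eHU : map A (ec ∷ esU) ≡ HU
            eHU = cong₂ _∷_ (cong hd (proj₁ parts)) (≡.trans (≡.sym (legs-hub legsU)) (cong (map hd) (proj₁ (proj₂ parts))))
            eHV : map A (lastE core ∷ esV) ≡ HV
            eHV = cong₂ _∷_ (≡.trans (≡.sym (lst-edges core)) (cong lst (proj₁ parts))) (≡.trans (≡.sym (legs-hub legsV)) (cong (map hd) (proj₂ (proj₂ parts))))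
            eIS : map entry innerV ≡ map (λ l → 2 , val l) IS
            eIS = ≡.trans (map-++ entry (inits core) _) (≡.trans (cong₂ _++_ (≡.trans (inits-entries core) (cong (λ c → map _ (sums c)) (proj₁ parts)))
              (≡.trans (map-++ entry (gather legInits legsU) _) (≡.trans (cong₂ _++_
                (≡.trans (legs-inits legsU) (cong (λ X → map _ (concatMap sums X)) (proj₁ (proj₂ parts))))
                (≡.trans (legs-inits legsV) (cong (λ X → map _ (concatMap sums X)) (proj₂ (proj₂ parts)))))
                (≡.sym (map-++ _ (concatMap sums C.XU) _))))) (≡.sym (map-++ _ (sums C.c) _)))
            eLS : map entry leavesV ≡ map (λ l → 1 , val l) LS
            eLS = ≡.trans (map-++ entry (gather legFin legsU) _) (≡.trans (cong₂ _++_
              (≡.trans (legs-fin legsU) (cong (λ X → map _ (map lst X)) (proj₁ (proj₂ parts))))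
              (≡.trans (legs-fin legsV) (cong (λ X → map _ (map lst X)) (proj₂ (proj₂ parts))))) (≡.sym (map-++ _ (map lst C.XU) _)))

          ordered : AllPairs Ordered (map entry VS)
          ordered = subst (AllPairs Ordered) (≡.sym entries)
            ((hubs′ ∷ Allₚ.++⁺ (Allₚ.map⁺ (All.map (λ h → inj₂ (h , 2≤U)) inU)) (Allₚ.map⁺ (All.map (λ h → inj₂ (h , s≤s z≤n)) endU))) ∷
             Allₚ.++⁺ (Allₚ.map⁺ (All.map (λ h → inj₂ (h , 2≤V)) inV)) (Allₚ.map⁺ (All.map (λ h → inj₂ (h , s≤s z≤n)) endV)) ∷
             APₚ.++⁺ (APₚ.map⁺ (AllPairs.map split innD)) (APₚ.map⁺ (AllPairs.map split endD))
               (Allₚ.map⁺ (All.map (λ h → Allₚ.map⁺ (All.map (λ l → inj₂ (l , s≤s z≤n)) h)) low)))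
            where
            split : ∀ {a b d : ℕ} → a ≢ b → Ordered (d , a) (d , b)
            split {a} {b} ne with <-cmp a b
            ... | tri< p _ _ = inj₁ (p , ≤-refl)
            ... | tri≈ _ p _ = ⊥-elim (ne p)
            ... | tri> _ _ p = inj₂ (p , ≤-refl)
            hubs′ : Ordered (length HU , val (total HU)) (length HV , val (total HV))
            hubs′ with hubs
            ... | inj₁ (a , b) = inj₂ (b , <⇒≤ a)
            ... | inj₂ (a , b) = subst (λ k → Ordered (length HU , val (total HU)) (k , val (total HV))) (≡.sym a) (split (b ∘ ≡.sym))
            2≤U : 2 ≤ length HU
            2≤U = subst (2 ≤_) (cong proj₁ (∷-injectiveˡ entries)) (<⇒≤ 2<u)
            2≤V : 2 ≤ length HV
            2≤V = subst (2 ≤_) (cong proj₁ (∷-injectiveˡ (∷-injectiveʳ entries))) (<⇒≤ 2<v)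

          pairwise : ∀ x y → x ≢ y → Ordered (entry x) (entry y)
          pairwise x y = AllPairs-∈ entry ordered-sym ordered (all-vertices x) (all-vertices y)

          strong : StronglyAntimagic G
          strong = f , (λ x y ne e → distinct (pairwise x y ne) e) , λ x y h → increasing h (pairwise x y λ { ≡.refl → <-irrefl ≡.refl h })
            where
            distinct : ∀ {d s d′ s′} → Ordered (d , s) (d′ , s′) → s ≢ s′
            distinct (inj₁ (h , _)) e = <-irrefl e h
            distinct (inj₂ (h , _)) e = <-irrefl (≡.sym e) h
            increasing : ∀ {d s d′ s′} → d < d′ → Ordered (d , s) (d′ , s′) → s < s′
            increasing h (inj₁ (p , _)) = p
            increasing h (inj₂ (_ , q)) = ⊥-elim (<⇒≱ h q)

    spider-antimagic : StronglyAntimagic G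
    spider-antimagic = strong theSpider c (proj₁ a) (proj₂ a)
      where
      c = can theSpider
      a = assigned theSpider c

open import Data.Nat.Properties using (≤-total)
open import Relation.Binary.PropositionalEquality using (sym)
open import Defs
open Antimagic

theorem2 : (G : Graph) → IsDoubleSpider G → StronglyAntimagic G
theorem2 G ((simple , _ , connected , acyclic) , u , v , u≢v , 2<u , 2<v , only) with ≤-total (degree G v) (degree G u)
... | inj₁ h = Transfer.spider-antimagic G simple acyclic connected u v u≢v 2<u 2<v only h
... | inj₂ h = Transfer.spider-antimagic G simple acyclic connected v u (u≢v ∘ sym) 2<v 2<u (λ w p → Sum.swap (only w p)) h
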